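{- Let $q\neq 2$ be a prime power and let $D,N$ be integers with $N>2D\geq 6$. Let $\Gamma=(X,\mathcal R)$ be the bilinear forms graph $H_q(D,N-D)$, and let $E$ be the primitive idempotent of $\Gamma$ associated with its second largest eigenvalue $\theta_1$. Fix $x,y\in X$ with $k=\partial(x,y)$ satisfying $2\leq k\leq D-1$. Let $\{O_i\}_{i=1}^6$ be the $y$-partition of $\Gamma(x)$ and let $\{O'_i\}_{i=1}^6$ be the $x$-partition of $\Gamma(y)$. Then for $1\leq i\leq 6$, \[ E\widehat O_i - E\widehat O'_i = \lambda_i\,(E\hat x - E\hat y), \] where \[ \lambda_i = |O_i|\,\frac{\theta^*_1-\theta^*_k}{\theta^*_0-\theta^*_k}\quad (2\leq i\leq 5),\qquad \lambda_1 = |O_1|\,\frac{\theta^*_1-\theta^*_{k-1}}{\theta^*_0-\theta^*_k},\qquad \lambda_6 = |O_6|\,\frac{\theta^*_1-\theta^*_{k+1}}{\theta^*_0-\theta^*_k}. \]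
   Context: The bilinear forms graph $H_q(D,N-D)$: the vertex set $X$ is the set of all $D\times(N-D)$ matrices over $\mathrm{GF}(q)$, and two vertices are adjacent iff their difference has rank one. It is distance-regular with diameter $D$. $\partial$ is the path-length distance; $\Gamma_i(x)=\{z\in X:\partial(x,z)=i\}$ and $\Gamma(x)=\Gamma_1(x)$. $V=\mathbb R^X$ is the standard module with inner product $\langle u,v\rangle=u^tv$; $\hat x\in V$ is the vector with $x$-coordinate $1$ and all other coordinates $0$; for $\Omega\subseteq X$, $\widehat\Omega=\sum_{z\in\Omega}\hat z$. $A$ is the adjacency matrix, with eigenvalues $\theta_0>\theta_1>\cdots>\theta_D$, $\theta_i=(q^{N-i}+1-q^D-q^{N-D})/(q-1)$; $E$ is the matrix acting as the identity on the $\theta_1$-eigenspace of $A$ and as $0$ on the other eigenspaces. The scalars $\theta^*_i$ ($0\le i\le D$) are defined by $\theta^*_i=(q^{N-i}+1-q^D-q^{N-D})/(q-1)$ (these equal $|X|E_{u,v}$ for $\partial(u,v)=i$). The $y$-partition of $\Gamma(x)$ (for $\partial(x,y)=k$, $2\le k\le D-1$): for $z\in\Gamma(x)$ write $a(z)=|\Gamma(x)\cap\Gamma(z)\cap\Gamma_{k-1}(y)|$ and $b(z)=|\Gamma(x)\cap\Gamma(z)\cap\Gamma_{k+1}(y)|$. Set $O_1=\Gamma(x)\cap\Gamma_{k-1}(y)$, $O_6=\Gamma(x)\cap\Gamma_{k+1}(y)$, and let $O_2,O_3,O_4,O_5$ consist of those $z\in\Gamma(x)\cap\Gamma_k(y)$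 with $(a(z),b(z))$ equal to $(2q^{k-1},0)$, $(2q^{k-1}-1,0)$, $(q^{k-1},q^D-q^k)$, $(q^{k-1},q^{N-D}-q^k)$ respectively. It is known that these six sets are nonempty and partition $\Gamma(x)$. The $x$-partition $\{O'_i\}_{i=1}^6$ of $\Gamma(y)$ is defined in the same way with the roles of $x$ and $y$ interchanged. -}

module Defs where

open import Level using (0ℓ)
open import Data.Nat as ℕ using (ℕ; zero; suc; _∸_; _^_; _≡ᵇ_)
open import Data.Integer as ℤ using (ℤ; +_)
open import Data.Rational as ℚ using (ℚ; 0ℚ; 1ℚ; _÷_; ≢-nonZero)
open import Data.Fin using (Fin; zero; suc)
open import Data.Bool using (Bool; true; false; _∧_; not; if_then_else_)
open import Data.Bool.ListAction using (any; all)
import Data.Bool as B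
open import Data.List as List using (List; []; _∷_; filter; length; concatMap; foldr; allFin)
open import Data.Vec as Vec using (Vec; []; _∷_; lookup)
import Data.Vec.Properties as VecP
open import Data.Product using (Σ; _,_)
open import Function.Bundles using (_↔_; Inverse)
open import Relation.Nullary using (yes; no; ¬_)
open import Relation.Nullary.Decidable using (⌊_⌋)
open import Relation.Binary.Definitions using (DecidableEquality)
open import Relation.Binary.PropositionalEquality using (_≡_; _≢_)
open import Algebra.Structures using (IsCommutativeRing)

record FiniteField : Set₁ where
  field
    Carrier : Set
    _+_ _*_ : Carrier → Carrier → Carrier
    -_      : Carrier → Carrier
    0# 1#   : Carrier
    isCommutativeRing : IsCommutativeRing _≡_ _+_ _*_ -_ 0# 1#
    0≢1     : 0# ≢ 1#
    inverse : ∀ a → a ≢ 0# → Σ Carrier (λ b → a * b ≡ 1#)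
    _≟_     : DecidableEquality Carrier
    size    : ℕ
    enum    : Fin size ↔ Carrier

-- Total rational division (only ever used with nonzero divisor here).

fromℕℚ : ℕ → ℚ
fromℕℚ n = (+ n) ℚ./ 1

_/ℚ_ : ℚ → ℚ → ℚ
p /ℚ r with r ℚ.≟ 0ℚ
... | yes _ = 0ℚ
... | no r≢0 = _÷_ p r {{≢-nonZero r≢0}}

-- The scalars θ*_i = (q^{N-i} + 1 - q^D - q^{N-D}) / (q - 1)
-- (they coincide with the eigenvalues θ_i).
θ* : (q D N i : ℕ) → ℚ
θ* q D N i =
  ℚ._-_ (ℚ._-_ (ℚ._+_ (fromℕℚ (q ^ (N ∸ i))) 1ℚ) (fromℕℚ (q ^ D)))
        (fromℕℚ (q ^ (N ∸ D)))
  /ℚ fromℕℚ (q ∸ 1)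

allVecsOf : {A : Set} → List A → (n : ℕ) → List (Vec A n)
allVecsOf xs zero = [] ∷ []
allVecsOf xs (suc n) = concatMap (λ a → List.map (a ∷_) (allVecsOf xs n)) xs

sumℚ : List ℚ → ℚ
sumℚ = foldr ℚ._+_ 0ℚ

module Bilinear (F : FiniteField) (D N : ℕ) where
  open FiniteField F

  q : ℕ
  q = size

  M : ℕ
  M = N ∸ D

  allF : List Carrier
  allF = List.map (Inverse.to enum) (allFin size)

  X : Set
  X = Vec (Vec Carrier M) D

  allX : List X
  allX = allVecsOf (allVecsOf allF M) D

  _≟X_ : DecidableEquality X
  _≟X_ = VecP.≡-dec (VecP.≡-dec _≟_)

  _==_ : X → X → Bool
  a == b = ⌊ a ≟X b ⌋

  _-M_ : X → X → X
  a -M b = Vec.zipWith (Vec.zipWith (λ u v → u + (- v))) a b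

  isZeroD : Vec Carrier D → Bool
  isZeroD v = ⌊ VecP.≡-dec _≟_ v (Vec.replicate D 0#) ⌋

  column : X → Fin M → Vec Carrier D
  column m j = Vec.map (λ row → lookup row j) m

  -- rank one: the column space is one-dimensional, i.e. m ≠ 0 and
  -- there is a nonzero v ∈ F^D with every column a scalar multiple of v.
  rankOne : X → Bool
  rankOne m =
    any (λ j → not (isZeroD (column m j))) (allFin M) ∧
    any (λ v → not (isZeroD v) ∧
               all (λ j → any (λ c → ⌊ VecP.≡-dec _≟_ (column m j) (Vec.map (c *_) v) ⌋) allF)
                   (allFin M))
        (allVecsOf allF D)

  adj : X → X → Bool
  adj a b = rankOne (a -M b)

  withinW : ℕ → X → X → Bool
  withinW zero a b = a == b
  withinW (suc n) a b =
    if withinW n a b then true else any (λ w → withinW n a w ∧ adj w b) allX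

  isDist : ℕ → X → X → Bool
  isDist zero a b = withinW zero a b
  isDist (suc i) a b = withinW (suc i) a b ∧ not (withinW i a b)

  card : (X → Bool) → ℕ
  card S = length (filter (λ z → S z B.≟ true) allX)

  aCnt bCnt : X → X → ℕ → X → ℕ
  aCnt x y k z = card (λ w → adj x w ∧ adj z w ∧ isDist (k ∸ 1) y w)
  bCnt x y k z = card (λ w → adj x w ∧ adj z w ∧ isDist (suc k) y w)

  O : X → X → ℕ → Fin 6 → X → Bool
  O x y k zero z = adj x z ∧ isDist (k ∸ 1) y z
  O x y k (suc zero) z = adj x z ∧ isDist k y z ∧
    (aCnt x y k z ≡ᵇ 2 ℕ.* q ^ (k ∸ 1)) ∧ (bCnt x y k z ≡ᵇ 0)
  O x y k (suc (suc zero)) z = adj x z ∧ isDist k y z ∧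
    (aCnt x y k z ≡ᵇ (2 ℕ.* q ^ (k ∸ 1)) ∸ 1) ∧ (bCnt x y k z ≡ᵇ 0)
  O x y k (suc (suc (suc zero))) z = adj x z ∧ isDist k y z ∧
    (aCnt x y k z ≡ᵇ q ^ (k ∸ 1)) ∧ (bCnt x y k z ≡ᵇ q ^ D ∸ q ^ k)
  O x y k (suc (suc (suc (suc zero)))) z = adj x z ∧ isDist k y z ∧
    (aCnt x y k z ≡ᵇ q ^ (k ∸ 1)) ∧ (bCnt x y k z ≡ᵇ q ^ (N ∸ D) ∸ q ^ k)
  O x y k (suc (suc (suc (suc (suc zero))))) z = adj x z ∧ isDist (suc k) y z

  -- the standard module V = ℚ^X (E has rational entries) and operators on it
  V : Set
  V = X → ℚ

  sumX : (X → ℚ) → ℚ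
  sumX f = sumℚ (List.map f allX)

  hat : X → V
  hat x u = if x == u then 1ℚ else 0ℚ

  hatS : (X → Bool) → V
  hatS S u = if S u then 1ℚ else 0ℚ

  Amul : V → V
  Amul v u = sumX (λ w → if adj u w then v w else 0ℚ)

  apply : (X → X → ℚ) → V → V
  apply E v u = sumX (λ w → ℚ._*_ (E u w) (v w))

  θ : ℕ → ℚ
  θ i = θ* q D N i

  IsE₁ : (X → X → ℚ) → Set
  IsE₁ E = ∀ (i : ℕ) → i ℕ.≤ D → (v : V) → (∀ u → Amul v u ≡ ℚ._*_ (θ i) (v u)) →
           ∀ u → apply E v u ≡ (if i ≡ᵇ 1 then v u else 0ℚ)

  jIdx : ℕ → Fin 6 → ℕ
  jIdx k zero = k ∸ 1
  jIdx k (suc (suc (suc (suc (suc zero))))) = suc k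
  jIdx k _ = k

  λc : X → X → ℕ → Fin 6 → ℚ
  λc x y k i = ℚ._*_ (fromℕℚ (card (O x y k i)))
               ((ℚ._-_ (θ 1) (θ (jIdx k i))) /ℚ (ℚ._-_ (θ 0) (θ k)))

{-# OPTIONS --safe #-}

-- Translating and reflecting, O′ᵢ becomes Y - Oᵢ, where x = 0 and Y = y - x. Let κ(d) be the number of
-- vectors in the kernel of d. Expanding in the eigenvectors u ↦ χ(⟨B , u - x⟩) shows that E_{u,w} is an
-- affine function of κ(u - w), so the claim is that the sum over z ∈ Oᵢ of κ(u - z) - κ(u - (Y - z)) is a
-- multiple of κ(u) - κ(u - Y); taking u = 0 gives the multiple. Since κ(d) is, up to constants, the
-- number of pairs (a , b) with aᵗ d b = 0, this follows once the number h(a, b, c) of z ∈ Oᵢ with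
-- aᵗ z b = c satisfies
--   (1) h(a, b, c) = h(a, b, -c) if aᵗ Y b = 0,
--   (2) h(a, b, c) = h(a, b, 1 - c) if aᵗ Y b = 1 and c ≠ 0 , 1,
--   (3) h(a, b, 0) - h(a, b, aᵗ Y b) is the same for all a and b with aᵗ Y b ≠ 0.
-- The stabilizer of 0 and Y yields (3). A set closed under nonzero scalars satisfies (1) and (2), and
-- O₂, O₄, O₅, O₆ and O₁ ∪ O₃ are such sets: adjacency of two matrices of rank one does not depend on
-- their scale, the rank-one z with rank (Y - z) = k - 1 are the (Y w)(rᵗ Y) with rᵗ Y w = 1, and the
-- other multiples of those lie in O₃. For O₁ itself, (1) and (2) come from explicit linear maps.

module Submission where

open import Defs
open import Algebra.Bundles using (CommutativeRing)
import Algebra.Properties.Semiring.Mult as Mult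
open import Algebra.Structures using (IsCommutativeRing)
open import Data.Bool as Bool using (Bool; true; false; if_then_else_; _∧_; _∨_; not; T)
open import Data.Bool.ListAction using (any)
open import Data.Bool.Properties using (T-∧; T-∨)
open import Data.Fin as Fin using (Fin)
import Data.Fin.Properties as Finₚ
open import Data.List as List using (List; []; _∷_)
open import Data.List.Membership.Propositional using (_∈_; lose)
open import Data.List.Membership.Propositional.Properties using (∈-allFin; ∈-concatMap⁺; ∈-map⁺)
import Data.List.Properties as Listₚ
open import Data.List.Relation.Unary.All as All using ()
import Data.List.Relation.Unary.All.Properties as Allₚ
open import Data.List.Relation.Unary.Any as Any using (here; there; any?; satisfied)
import Data.List.Relation.Unary.Any.Properties as Anyₚ
open import Data.Nat as ℕ using (ℕ; zero; suc)
import Data.Nat.Properties as ℕₚ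
open import Data.Product using (Σ; ∃; ∃₂; _×_; _,_; proj₁; proj₂)
open import Data.Sum using (_⊎_; inj₁; inj₂)
open import Data.Unit using (tt)
open import Data.Vec as Vec using (Vec; []; _∷_; lookup)
import Data.Vec.Properties as Vecₚ
open import Function using (_∘_; id)
open import Function.Bundles using (mk⇔; Inverse; Equivalence)
open import Level using (0ℓ)
open import Relation.Binary.Definitions using (DecidableEquality)
open import Relation.Binary.PropositionalEquality
  using (_≡_; _≢_; refl; sym; trans; cong; cong₂; subst; ≢-sym; module ≡-Reasoning)
open import Relation.Nullary using (Dec; yes; no; does; ¬_; contradiction)
open import Relation.Nullary.Decidable
  using (map′; _×-dec_; ¬?; dec-true; dec-false; does-⇔; decidable-stable; toWitness; fromWitness; isYes≗does)

-- Additive characters are in general not rational-valued, so they enter only through `χ`, the sum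
-- of all nontrivial ones. These are ψ(λ c) with λ ≠ 0 for one fixed ψ, and B and λ B have the same
-- rank; hence u ↦ `χ ⟪ B , u -ᴹ x ⟫` is still an eigenvector, its eigenvalue depending on the rank
-- of B. For fixed x these functions add up over B to a multiple of the unit vector at x, so they
-- span, and E is determined by its action on eigenvectors.
--
-- The conditions (1), (2), (3) arise as follows. Put c = aᵗ u b and e = aᵗ Y b. The form (a , b)
-- vanishes on u - z when aᵗ z b = c, and on u - (Y - z) when aᵗ z b = e - c. It therefore suffices
-- that h(a, b, c) - h(a, b, e - c) = l ([c = 0] - [c = e]) with a single l for all a and b. For e =
-- 0 the right side is zero, which gives (1). For e ≠ 0, (3) treats c = 0 and c = e, and (2), after
-- dividing a by e, treats every other c.
--
-- The identity wanted is linear in the indicator of the set, so O₃ follows by subtracting O₁ from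
-- O₁ ∪ O₃.

-- A ring solver with integer coefficients, valid in every commutative ring.

module IntegerSolver (R : CommutativeRing 0ℓ 0ℓ) where

  open import Data.Integer as ℤ using (ℤ; +_; -[1+_])
  import Data.Integer.Properties as ℤₚ
  import Data.Sign as Sign
  open import Data.Maybe as Maybe using (Maybe)
  open import Relation.Nullary.Decidable using (dec⇒maybe)
  open import Algebra.Solver.Ring.AlmostCommutativeRing
    using (fromCommutativeRing; _-Raw-AlmostCommutative⟶_)
  open CommutativeRing R hiding (zero) renaming (refl to ≈-refl; sym to ≈-sym; trans to ≈-trans)
  open import Algebra.Properties.Ring ring
  open import Algebra.Properties.Semiring.Mult.TCOptimised semiring
    using (×-homo-+; ×1-homo-*; 1+×) renaming (_×_ to _·_)
  open import Relation.Binary.Reasoning.Setoid setoid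

  -- With the optimised multiple, `+ 1` computes to `1#` itself and not to a sum with `0#`, so that
  -- the solver constants `:1` and `:0` are the units on the nose.
  ⟦_⟧ℤ : ℤ → Carrier
  ⟦ + n ⟧ℤ = n · 1#
  ⟦ -[1+ n ] ⟧ℤ = - (suc n · 1#)

  private
    x+y-[x+z] : ∀ x y z → (x + y) + - (x + z) ≈ y + - z
    x+y-[x+z] x y z = begin
      (x + y) + - (x + z)   ≈⟨ +-cong (+-comm x y) (≈-sym (-‿+-comm x z)) ⟩
      (y + x) + (- x + - z) ≈⟨ +-assoc y x _ ⟩
      y + (x + (- x + - z)) ≈⟨ +-congˡ (≈-sym (+-assoc x (- x) (- z))) ⟩
      y + ((x + - x) + - z) ≈⟨ +-congˡ (+-congʳ (-‿inverseʳ x)) ⟩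
      y + (0# + - z)        ≈⟨ +-congˡ (+-identityˡ _) ⟩
      y + - z               ∎

    ⊖-homo : ∀ m n → ⟦ m ℤ.⊖ n ⟧ℤ ≈ m · 1# + - (n · 1#)
    ⊖-homo zero zero = ≈-sym (-‿inverseʳ 0#)
    ⊖-homo zero (suc n) = ≈-sym (+-identityˡ _)
    ⊖-homo (suc m) zero = ≈-sym (≈-trans (+-congˡ -0#≈0#) (+-identityʳ _))
    ⊖-homo (suc m) (suc n) = begin
      ⟦ suc m ℤ.⊖ suc n ⟧ℤ ≡⟨ cong ⟦_⟧ℤ (ℤₚ.[1+m]⊖[1+n]≡m⊖n m n) ⟩
      ⟦ m ℤ.⊖ n ⟧ℤ                        ≈⟨ ⊖-homo m n ⟩
      m · 1# + - (n · 1#)                 ≈⟨ ≈-sym (x+y-[x+z] 1# _ _) ⟩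
      (1# + m · 1#) + - (1# + n · 1#)     ≈⟨ ≈-sym (+-cong (1+× m 1#) (-‿cong (1+× n 1#))) ⟩
      suc m · 1# + - (suc n · 1#)         ∎

    ℤ-+-homo : ∀ i j → ⟦ i ℤ.+ j ⟧ℤ ≈ ⟦ i ⟧ℤ + ⟦ j ⟧ℤ
    ℤ-+-homo (+ m) (+ n) = ×-homo-+ 1# m n
    ℤ-+-homo (+ m) -[1+ n ] = ⊖-homo m (suc n)
    ℤ-+-homo -[1+ m ] (+ n) = ≈-trans (⊖-homo n (suc m)) (+-comm _ _)
    ℤ-+-homo -[1+ m ] -[1+ n ] = ≈-trans (-‿cong eq) (≈-sym (-‿+-comm _ _))
      where
      open import Data.Nat.Properties using (+-suc)
      eq : suc (suc (m ℕ.+ n)) · 1# ≈ suc m · 1# + suc n · 1#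
      eq = ≈-trans (reflexive (cong (λ k → suc k · 1#) (sym (+-suc m n)))) (×-homo-+ 1# (suc m) (suc n))

    neg-homo : ∀ i → ⟦ ℤ.- i ⟧ℤ ≈ - ⟦ i ⟧ℤ
    neg-homo (+ zero) = ≈-sym -0#≈0#
    neg-homo (+ suc n) = ≈-refl
    neg-homo -[1+ n ] = ≈-sym (-‿involutive _)

    ℤ-*-homo : ∀ i j → ⟦ i ℤ.* j ⟧ℤ ≈ ⟦ i ⟧ℤ * ⟦ j ⟧ℤ
    ℤ-*-homo (+ m) (+ n) = ≈-trans (reflexive (cong ⟦_⟧ℤ (ℤₚ.+◃n≡+n (m ℕ.* n)))) (×1-homo-* m n)
    ℤ-*-homo (+ m) -[1+ n ] = begin
      ⟦ Sign.- ℤ.◃ (m ℕ.* suc n) ⟧ℤ ≡⟨ cong ⟦_⟧ℤ (ℤₚ.-◃n≡-n (m ℕ.* suc n)) ⟩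
      ⟦ ℤ.- (+ (m ℕ.* suc n)) ⟧ℤ    ≈⟨ neg-homo (+ (m ℕ.* suc n)) ⟩
      - ((m ℕ.* suc n) · 1#)        ≈⟨ -‿cong (×1-homo-* m (suc n)) ⟩
      - (m · 1# * (suc n · 1#))     ≈⟨ -‿distribʳ-* _ _ ⟩
      m · 1# * - (suc n · 1#)       ∎
    ℤ-*-homo -[1+ m ] (+ n) = begin
      ⟦ Sign.- ℤ.◃ (suc m ℕ.* n) ⟧ℤ ≡⟨ cong ⟦_⟧ℤ (ℤₚ.-◃n≡-n (suc m ℕ.* n)) ⟩
      ⟦ ℤ.- (+ (suc m ℕ.* n)) ⟧ℤ    ≈⟨ neg-homo (+ (suc m ℕ.* n)) ⟩
      - ((suc m ℕ.* n) · 1#)        ≈⟨ -‿cong (×1-homo-* (suc m) n) ⟩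
      - (suc m · 1# * (n · 1#))     ≈⟨ -‿distribˡ-* _ _ ⟩
      - (suc m · 1#) * (n · 1#)     ∎
    ℤ-*-homo -[1+ m ] -[1+ n ] = begin
      (suc m ℕ.* suc n) · 1#            ≈⟨ ×1-homo-* (suc m) (suc n) ⟩
      x * y                             ≈⟨ ≈-sym (-‿involutive _) ⟩
      - - (x * y)                       ≈⟨ -‿cong (-‿distribʳ-* _ _) ⟩
      - (x * - y)                       ≈⟨ -‿distribˡ-* _ _ ⟩
      - x * - y                         ∎
      where
      x = suc m · 1#
      y = suc n · 1#

    homomorphism : ℤ.+-*-rawRing -Raw-AlmostCommutative⟶ fromCommutativeRing R
    homomorphism = record
      { ⟦_⟧ = ⟦_⟧ℤ ; +-homo = ℤ-+-homo ; *-homo = ℤ-*-homo ; -‿homo = neg-homo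
      ; 0-homo = ≈-refl ; 1-homo = ≈-refl }

    -- Coefficients are compared as integers. In positive characteristic different integers may have
    -- equal images, so the test is sound but not complete, which `Maybe` permits.
    _coeff≟_ : ∀ i j → Maybe (⟦ i ⟧ℤ ≈ ⟦ j ⟧ℤ)
    i coeff≟ j = Maybe.map (λ eq → reflexive (cong ⟦_⟧ℤ eq)) (dec⇒maybe (i ℤ.≟ j))

  open import Algebra.Solver.Ring ℤ.+-*-rawRing (fromCommutativeRing R) homomorphism _coeff≟_ public
    using (solve; Polynomial; _:=_; _:+_; _:*_; _:-_; :-_; con)

  :1 :0 : ∀ {n} → Polynomial n
  :1 = con (+ 1)
  :0 = con (+ 0)

-- The coefficient ring.

-- This interface stands for `ℚ` until the very end. Cancellation replaces division: identities are
-- proved after multiplication by a nonzero constant such as `Q - 1#` or `pw n`.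
record CharacteristicZeroDomain : Set₁ where
  infix  8 -_
  infixl 7 _*_
  infixl 6 _+_
  field
    Carrier : Set
    _+_ _*_ : Carrier → Carrier → Carrier
    -_      : Carrier → Carrier
    0# 1#   : Carrier
    isCommutativeRing : IsCommutativeRing _≡_ _+_ _*_ -_ 0# 1#

  commutativeRing : CommutativeRing 0ℓ 0ℓ
  commutativeRing = record { isCommutativeRing = isCommutativeRing }

  fromℕ : ℕ → Carrier
  fromℕ n = Mult._×_ (CommutativeRing.semiring commutativeRing) n 1#

  field
    *-cancelˡ : ∀ x {y z} → x ≢ 0# → x * y ≡ x * z → y ≡ z
    fromℕ-injective : ∀ {m n} → fromℕ m ≡ fromℕ n → m ≡ n

  open CommutativeRing commutativeRing public
    using (_-_; semiring; +-identityˡ; +-identityʳ; *-identityˡ; *-identityʳ;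
           zeroˡ; zeroʳ; +-comm; *-comm; +-assoc; *-assoc; distribˡ; -‿inverseʳ)
  open Mult semiring public using (×1-homo-*)

-- Finite sums, indicators and counting.

module Summation (K : CharacteristicZeroDomain) where

  open CharacteristicZeroDomain K public
  open IntegerSolver commutativeRing public
  open ≡-Reasoning

  ind : Bool → Carrier
  ind b = if b then 1# else 0#

  -- Only `does p` enters, so a proof can branch on the decision itself, and Boolean tests from the
  -- definitions match indicators by computation.
  𝟙 : {P : Set} → Dec P → Carrier
  𝟙 p = ind (does p)

  𝟙-yes : {P : Set} (p : Dec P) → P → 𝟙 p ≡ 1#
  𝟙-yes p x = cong ind (dec-true p x)

  𝟙-no : {P : Set} (p : Dec P) → ¬ P → 𝟙 p ≡ 0#
  𝟙-no p x = cong ind (dec-false p x)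

  𝟙-cong : {P R : Set} (p : Dec P) (r : Dec R) → (P → R) → (R → P) → 𝟙 p ≡ 𝟙 r
  𝟙-cong p r f g = cong ind (does-⇔ (mk⇔ f g) p r)

  ind-∧ : ∀ a b → ind (a ∧ b) ≡ ind a * ind b
  ind-∧ true b = sym (*-identityˡ _)
  ind-∧ false b = sym (zeroˡ _)

  𝟙-× : {P R : Set} (p : Dec P) (r : Dec R) → 𝟙 (p ×-dec r) ≡ 𝟙 p * 𝟙 r
  𝟙-× p r = ind-∧ (does p) (does r)

  𝟙-guard : {P : Set} (p : Dec P) {x y : Carrier} → (P → x ≡ y) → 𝟙 p * x ≡ 𝟙 p * y
  𝟙-guard (yes p) f = cong (1# *_) (f p)
  𝟙-guard (no _) f = trans (zeroˡ _) (sym (zeroˡ _))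

  +-swap : ∀ a b c d → (a + b) + (c + d) ≡ (a + c) + (b + d)
  +-swap = solve 4 (λ a b c d → (a :+ b) :+ (c :+ d) := (a :+ c) :+ (b :+ d)) refl

  module _ {A : Set} where

    sumOver : List A → (A → Carrier) → Carrier
    sumOver xs f = List.foldr _+_ 0# (List.map f xs)

    sumOver-cong : ∀ xs {f g} → (∀ a → f a ≡ g a) → sumOver xs f ≡ sumOver xs g
    sumOver-cong [] e = refl
    sumOver-cong (x ∷ xs) e = cong₂ _+_ (e x) (sumOver-cong xs e)

    sumOver-+ : ∀ xs f g → sumOver xs (λ a → f a + g a) ≡ sumOver xs f + sumOver xs g
    sumOver-+ [] f g = sym (+-identityˡ _)
    sumOver-+ (x ∷ xs) f g = trans (cong (f x + g x +_) (sumOver-+ xs f g)) (+-swap _ _ _ _)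

    sumOver-*ˡ : ∀ xs c f → sumOver xs (λ a → c * f a) ≡ c * sumOver xs f
    sumOver-*ˡ [] c f = sym (zeroʳ c)
    sumOver-*ˡ (x ∷ xs) c f = trans (cong (c * f x +_) (sumOver-*ˡ xs c f)) (sym (distribˡ c _ _))

    sumOver-0 : ∀ xs → sumOver xs (λ _ → 0#) ≡ 0#
    sumOver-0 [] = refl
    sumOver-0 (x ∷ xs) = trans (+-identityˡ _) (sumOver-0 xs)

    sumOver-++ : ∀ xs ys f → sumOver (xs List.++ ys) f ≡ sumOver xs f + sumOver ys f
    sumOver-++ [] ys f = sym (+-identityˡ _)
    sumOver-++ (x ∷ xs) ys f = trans (cong (f x +_) (sumOver-++ xs ys f)) (sym (+-assoc _ _ _))

    sumOver-ind : ∀ xs (p : A → Bool) →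
      sumOver xs (λ a → ind (p a)) ≡ fromℕ (List.length (List.filter (λ a → p a Bool.≟ true) xs))
    sumOver-ind [] p = refl
    sumOver-ind (x ∷ xs) p with p x
    ... | true = cong (1# +_) (sumOver-ind xs p)
    ... | false = trans (+-identityˡ _) (sumOver-ind xs p)

    -- Without an order on the ring, positivity of a count is expressed by an explicit successor,
    -- which injectivity of `fromℕ` then separates from zero.
    sumOver-ind≢0 : ∀ {xs} (p : A → Bool) {a} → a ∈ xs → p a ≡ true →
      Σ ℕ λ n → sumOver xs (λ x → ind (p x)) ≡ fromℕ (suc n)
    sumOver-ind≢0 {x ∷ xs} p (here refl) e rewrite e = List.length (List.filter (λ a → p a Bool.≟ true) xs) , cong (1# +_) (sumOver-ind xs p)
    sumOver-ind≢0 {x ∷ xs} p (there m) e with sumOver-ind≢0 p m e | p x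
    ... | n , q | true = suc n , cong (1# +_) q
    ... | n , q | false = n , trans (+-identityˡ _) q

  sumOver-map : {A B : Set} (h : A → B) → ∀ xs f → sumOver (List.map h xs) f ≡ sumOver xs (f ∘ h)
  sumOver-map h [] f = refl
  sumOver-map h (x ∷ xs) f = cong (f (h x) +_) (sumOver-map h xs f)

  sumOver-concatMap : {A B : Set} (h : A → List B) → ∀ xs f →
    sumOver (List.concatMap h xs) f ≡ sumOver xs (λ a → sumOver (h a) f)
  sumOver-concatMap h [] f = refl
  sumOver-concatMap h (x ∷ xs) f =
    trans (sumOver-++ (h x) _ f) (cong (sumOver (h x) f +_) (sumOver-concatMap h xs f))

  sumOver-swap : {A B : Set} → ∀ xs ys (f : A → B → Carrier) →
    sumOver xs (λ a → sumOver ys (f a)) ≡ sumOver ys (λ b → sumOver xs (λ a → f a b))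
  sumOver-swap [] ys f = sym (sumOver-0 ys)
  sumOver-swap (x ∷ xs) ys f =
    trans (cong (sumOver ys (f x) +_) (sumOver-swap xs ys f)) (sym (sumOver-+ ys _ _))

  -- `sift` expresses, in the form in which sums use it, that every element is listed exactly once;
  -- `complete` serves searches and existence statements.
  record Enumeration (A : Set) : Set where
    field
      list : List A
      _≟_  : DecidableEquality A
      complete : ∀ a → a ∈ list
      sift : ∀ a (g : A → Carrier) → sumOver list (λ x → 𝟙 (x ≟ a) * g x) ≡ g a

    ∑ : (A → Carrier) → Carrier
    ∑ = sumOver list

    ∑-cong : ∀ {f g} → (∀ a → f a ≡ g a) → ∑ f ≡ ∑ g
    ∑-cong = sumOver-cong list

    ∑-+ : ∀ f g → ∑ (λ a → f a + g a) ≡ ∑ f + ∑ g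
    ∑-+ = sumOver-+ list

    ∑-*ˡ : ∀ c f → ∑ (λ a → c * f a) ≡ c * ∑ f
    ∑-*ˡ = sumOver-*ˡ list

    ∑-*ʳ : ∀ f c → ∑ (λ a → f a * c) ≡ ∑ f * c
    ∑-*ʳ f c = trans (∑-cong (λ a → *-comm _ c)) (trans (∑-*ˡ c f) (*-comm c _))

    ∑-const : ∀ c → ∑ (λ _ → c) ≡ ∑ (λ _ → 1#) * c
    ∑-const c = trans (∑-cong (λ _ → sym (*-identityˡ c))) (∑-*ʳ (λ _ → 1#) c)

    ∑-- : ∀ f g → ∑ (λ a → f a - g a) ≡ ∑ f - ∑ g
    ∑-- f g = begin
      ∑ (λ a → f a - g a) ≡⟨ ∑-cong (λ a → minus (f a) (g a)) ⟩
      ∑ (λ a → f a + (- 1#) * g a) ≡⟨ ∑-+ f _ ⟩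
      ∑ f + ∑ (λ a → (- 1#) * g a) ≡⟨ cong (∑ f +_) (∑-*ˡ (- 1#) g) ⟩
      ∑ f + (- 1#) * ∑ g ≡⟨ sym (minus (∑ f) (∑ g)) ⟩
      ∑ f - ∑ g                       ∎
      where
      minus : ∀ x y → x - y ≡ x + (- 1#) * y
      minus = solve 2 (λ x y → x :- y := x :+ (:- :1) :* y) refl

    ∑-0 : ∑ (λ _ → 0#) ≡ 0#
    ∑-0 = sumOver-0 list

    ∑-vanish : ∀ {f} → (∀ a → f a ≡ 0#) → ∑ f ≡ 0#
    ∑-vanish e = trans (∑-cong e) ∑-0

    ∑-𝟙≡ : ∀ a → ∑ (λ x → 𝟙 (x ≟ a)) ≡ 1#
    ∑-𝟙≡ a = trans (∑-cong (λ x → sym (*-identityʳ _))) (sift a (λ _ → 1#))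

    ∑-𝟙≡′ : ∀ a → ∑ (λ x → 𝟙 (a ≟ x)) ≡ 1#
    ∑-𝟙≡′ a = trans (∑-cong (λ x → 𝟙-cong (a ≟ x) (x ≟ a) sym sym)) (∑-𝟙≡ a)

    sift′ : ∀ a g → ∑ (λ x → 𝟙 (a ≟ x) * g x) ≡ g a
    sift′ a g = trans (∑-cong (λ x → cong (_* g x) (𝟙-cong (a ≟ x) (x ≟ a) sym sym))) (sift a g)

    search : {P : A → Set} → (∀ a → Dec (P a)) → Dec (∃ P)
    search {P} p? = map′ satisfied (λ (a , p) → lose (complete a) p) (any? p? list)

    ∑-count≢0 : {P : A → Set} (p? : ∀ a → Dec (P a)) → ∃ P → ∑ (λ a → 𝟙 (p? a)) ≢ 0#
    ∑-count≢0 p? (a , p) e with sumOver-ind≢0 (λ a → does (p? a)) (complete a) (dec-true (p? a) p)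
    ... | n , q with fromℕ-injective {suc n} {0} (trans (sym q) e)
    ... | ()

  open Enumeration

  ∑-swap : {A B : Set} (EA : Enumeration A) (EB : Enumeration B) (f : A → B → Carrier) →
    ∑ EA (λ a → ∑ EB (f a)) ≡ ∑ EB (λ b → ∑ EA (λ a → f a b))
  ∑-swap EA EB = sumOver-swap (list EA) (list EB)

  module _ {A B : Set} (EA : Enumeration A) (EB : Enumeration B) where

    ∑-fibres : (φ : A → B) (f : A → Carrier) →
      ∑ EA f ≡ ∑ EB (λ b → ∑ EA (λ a → 𝟙 (_≟_ EB (φ a) b) * f a))
    ∑-fibres φ f = sym (begin
      ∑ EB (λ b → ∑ EA (λ a → 𝟙 (_≟_ EB (φ a) b) * f a)) ≡⟨ ∑-swap EB EA _ ⟩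
      ∑ EA (λ a → ∑ EB (λ b → 𝟙 (_≟_ EB (φ a) b) * f a)) ≡⟨ ∑-cong EA (λ a → sift′ EB (φ a) (λ _ → f a)) ⟩
      ∑ EA f ∎)

    -- The fibre of τ over b is the single point σ b, so summing over fibres and sifting gives the
    -- claim.
    ∑-reindex : (τ : A → B) (σ : B → A) → (∀ a → σ (τ a) ≡ a) → (∀ b → τ (σ b) ≡ b) →
      (f : B → Carrier) → ∑ EA (λ a → f (τ a)) ≡ ∑ EB f
    ∑-reindex τ σ στ τσ f = begin
      ∑ EA (λ a → f (τ a))
        ≡⟨ ∑-fibres τ (λ a → f (τ a)) ⟩
      ∑ EB (λ b → ∑ EA (λ a → 𝟙 (_≟_ EB (τ a) b) * f (τ a)))
        ≡⟨ ∑-cong EB (λ b → ∑-cong EA (λ a → cong (_* f (τ a))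
             (𝟙-cong (_≟_ EB (τ a) b) (_≟_ EA a (σ b))
               (λ e → trans (sym (στ a)) (cong σ e)) (λ e → trans (cong τ e) (τσ b))))) ⟩
      ∑ EB (λ b → ∑ EA (λ a → 𝟙 (_≟_ EA a (σ b)) * f (τ a)))
        ≡⟨ ∑-cong EB (λ b → trans (sift EA (σ b) _) (cong f (τσ b))) ⟩
      ∑ EB f ∎

  module _ {A : Set} (E : Enumeration A) where

    sumOver-vectors : ∀ n (f : Vec A (suc n) → Carrier) →
      sumOver (allVecsOf (list E) (suc n)) f ≡ ∑ E (λ a → sumOver (allVecsOf (list E) n) (λ v → f (a ∷ v)))
    sumOver-vectors n f = trans (sumOver-concatMap _ (list E) f)
      (∑-cong E (λ a → sumOver-map (a ∷_) (allVecsOf (list E) n) f))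

    _≟ⱽ_ : ∀ {n} → DecidableEquality (Vec A n)
    _≟ⱽ_ = Vecₚ.≡-dec (_≟_ E)

    vectors-complete : ∀ n (v : Vec A n) → v ∈ allVecsOf (list E) n
    vectors-complete zero [] = here refl
    vectors-complete (suc n) (a ∷ v) =
      ∈-concatMap⁺ _ {xs = list E} (lose (complete E a) (∈-map⁺ (a ∷_) (vectors-complete n v)))

    vectors-sift : ∀ n (v : Vec A n) g → sumOver (allVecsOf (list E) n) (λ x → 𝟙 (x ≟ⱽ v) * g x) ≡ g v
    vectors-sift zero [] g = trans (+-identityʳ _) (*-identityˡ _)
    vectors-sift (suc n) (a ∷ v) g = begin
      sumOver (allVecsOf (list E) (suc n)) (λ x → 𝟙 (x ≟ⱽ (a ∷ v)) * g x)
        ≡⟨ sumOver-vectors n _ ⟩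
      ∑ E (λ b → sumOver (allVecsOf (list E) n) (λ x → 𝟙 ((b ∷ x) ≟ⱽ (a ∷ v)) * g (b ∷ x)))
        ≡⟨ ∑-cong E (λ b → trans (sumOver-cong (allVecsOf (list E) n) (λ x → trans
             (cong (_* g (b ∷ x)) (trans
               (𝟙-cong ((b ∷ x) ≟ⱽ (a ∷ v)) ((_≟_ E b a) ×-dec (x ≟ⱽ v)) Vecₚ.∷-injective (λ (p , q) → cong₂ _∷_ p q))
               (𝟙-× (_≟_ E b a) (x ≟ⱽ v))))
             (*-assoc _ _ _)))
           (sumOver-*ˡ (allVecsOf (list E) n) _ _)) ⟩
      ∑ E (λ b → 𝟙 (_≟_ E b a) * sumOver (allVecsOf (list E) n) (λ x → 𝟙 (x ≟ⱽ v) * g (b ∷ x)))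
        ≡⟨ sift E a _ ⟩
      sumOver (allVecsOf (list E) n) (λ x → 𝟙 (x ≟ⱽ v) * g (a ∷ x))
        ≡⟨ vectors-sift n v (λ x → g (a ∷ x)) ⟩
      g (a ∷ v) ∎

    vectors : ∀ n → Enumeration (Vec A n)
    vectors n = record
      { list = allVecsOf (list E) n ; _≟_ = _≟ⱽ_
      ; complete = vectors-complete n ; sift = vectors-sift n }

-- Vectors, matrices and bilinear forms over the finite field.

module LinearAlgebra (F : FiniteField) where

  open FiniteField F public
    using (0≢1; inverse; size; enum)
    renaming (Carrier to 𝔽; _+_ to infixl 6 _+ᶠ_; _*_ to infixl 7 _*ᶠ_; -_ to infix 8 ⊖_;
              0# to 0ᶠ; 1# to 1ᶠ; _≟_ to infix 4 _≟ᶠ_)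

  ringᶠ : CommutativeRing 0ℓ 0ℓ
  ringᶠ = record { isCommutativeRing = FiniteField.isCommutativeRing F }

  private
    module R = CommutativeRing ringᶠ
  open IntegerSolver ringᶠ
  open ≡-Reasoning

  infixl 6 _-ᶠ_
  _-ᶠ_ : 𝔽 → 𝔽 → 𝔽
  x -ᶠ y = x +ᶠ ⊖ y

  *ᶠ-cancelˡ : ∀ {a x y} → a ≢ 0ᶠ → a *ᶠ x ≡ a *ᶠ y → x ≡ y
  *ᶠ-cancelˡ {a} {x} {y} a≢0 e with inverse a a≢0
  ... | b , ab = trans (sym (unit x)) (trans (cong (b *ᶠ_) e) (unit y))
    where
    unit : ∀ z → b *ᶠ (a *ᶠ z) ≡ z
    unit z = trans (solve 3 (λ a b z → b :* (a :* z) := (a :* b) :* z) refl a b z)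
                   (trans (cong (_*ᶠ z) ab) (R.*-identityˡ z))

  integralᶠ : ∀ {a b} → a ≢ 0ᶠ → a *ᶠ b ≡ 0ᶠ → b ≡ 0ᶠ
  integralᶠ {a} a≢0 e = *ᶠ-cancelˡ a≢0 (trans e (sym (R.zeroʳ a)))

  -ᶠ≡0 : ∀ {x y} → x -ᶠ y ≡ 0ᶠ → x ≡ y
  -ᶠ≡0 {x} {y} e = begin
    x ≡⟨ solve 2 (λ x y → x := (x :- y) :+ y) refl x y ⟩
    (x -ᶠ y) +ᶠ y ≡⟨ cong (_+ᶠ y) e ⟩
    0ᶠ +ᶠ y ≡⟨ R.+-identityˡ y ⟩
    y               ∎

  infixl 6 _+ᵛ_ _-ᵛ_ _+ᴹ_ _-ᴹ_
  infixr 7 _*ᵛ_ _*ᴹ_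
  infix 7 _∙_ _⊗_
  infix 8 _⋆_
  infix 9 _ᵀ

  𝕍 : ℕ → Set
  𝕍 = Vec 𝔽

  -- The subtraction repeats the lambda inside `_-M_`, so that `_-ᴹ_` and `_-M_` agree by
  -- computation.
  _+ᵛ_ _-ᵛ_ : ∀ {n} → 𝕍 n → 𝕍 n → 𝕍 n
  _+ᵛ_ = Vec.zipWith _+ᶠ_
  _-ᵛ_ = Vec.zipWith (λ u v → u +ᶠ (⊖ v))

  _*ᵛ_ : ∀ {n} → 𝔽 → 𝕍 n → 𝕍 n
  c *ᵛ v = Vec.map (c *ᶠ_) v

  0ᵛ : ∀ {n} → 𝕍 n
  0ᵛ = Vec.replicate _ 0ᶠ

  _∙_ : ∀ {n} → 𝕍 n → 𝕍 n → 𝔽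
  [] ∙ [] = 0ᶠ
  (x ∷ u) ∙ (y ∷ v) = x *ᶠ y +ᶠ u ∙ v

  ∙-comm : ∀ {n} (u v : 𝕍 n) → u ∙ v ≡ v ∙ u
  ∙-comm [] [] = refl
  ∙-comm (x ∷ u) (y ∷ v) = cong₂ _+ᶠ_ (R.*-comm x y) (∙-comm u v)

  ∙-+ʳ : ∀ {n} (a u v : 𝕍 n) → a ∙ (u +ᵛ v) ≡ a ∙ u +ᶠ a ∙ v
  ∙-+ʳ [] [] [] = sym (R.+-identityˡ _)
  ∙-+ʳ (a ∷ as) (u ∷ us) (v ∷ vs) = trans (cong (a *ᶠ (u +ᶠ v) +ᶠ_) (∙-+ʳ as us vs))
    (solve 5 (λ a u v p q → a :* (u :+ v) :+ (p :+ q) := (a :* u :+ p) :+ (a :* v :+ q)) refl a u v _ _)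

  ∙--ʳ : ∀ {n} (a u v : 𝕍 n) → a ∙ (u -ᵛ v) ≡ a ∙ u -ᶠ a ∙ v
  ∙--ʳ [] [] [] = sym (R.-‿inverseʳ 0ᶠ)
  ∙--ʳ (a ∷ as) (u ∷ us) (v ∷ vs) = trans (cong (a *ᶠ (u +ᶠ ⊖ v) +ᶠ_) (∙--ʳ as us vs))
    (solve 5 (λ a u v p q → a :* (u :- v) :+ (p :- q) := (a :* u :+ p) :- (a :* v :+ q)) refl a u v _ _)

  ∙-*ʳ : ∀ {n} (a : 𝕍 n) c u → a ∙ (c *ᵛ u) ≡ c *ᶠ (a ∙ u)
  ∙-*ʳ [] c [] = sym (R.zeroʳ c)
  ∙-*ʳ (a ∷ as) c (u ∷ us) = trans (cong (a *ᶠ (c *ᶠ u) +ᶠ_) (∙-*ʳ as c us))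
    (solve 4 (λ a c u p → a :* (c :* u) :+ c :* p := c :* (a :* u :+ p)) refl a c u _)

  ∙-0ʳ : ∀ {n} (a : 𝕍 n) → a ∙ 0ᵛ ≡ 0ᶠ
  ∙-0ʳ [] = refl
  ∙-0ʳ (a ∷ as) = trans (cong₂ _+ᶠ_ (R.zeroʳ a) (∙-0ʳ as)) (R.+-identityˡ _)

  ∙-+ˡ : ∀ {n} (u v a : 𝕍 n) → (u +ᵛ v) ∙ a ≡ u ∙ a +ᶠ v ∙ a
  ∙-+ˡ u v a = trans (∙-comm _ a) (trans (∙-+ʳ a u v) (cong₂ _+ᶠ_ (∙-comm a u) (∙-comm a v)))

  ∙--ˡ : ∀ {n} (u v a : 𝕍 n) → (u -ᵛ v) ∙ a ≡ u ∙ a -ᶠ v ∙ a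
  ∙--ˡ u v a = trans (∙-comm _ a) (trans (∙--ʳ a u v) (cong₂ _-ᶠ_ (∙-comm a u) (∙-comm a v)))

  ∙-*ˡ : ∀ {n} c (u a : 𝕍 n) → (c *ᵛ u) ∙ a ≡ c *ᶠ (u ∙ a)
  ∙-*ˡ c u a = trans (∙-comm _ a) (trans (∙-*ʳ a c u) (cong (c *ᶠ_) (∙-comm a u)))

  ∙-0ˡ : ∀ {n} (a : 𝕍 n) → 0ᵛ ∙ a ≡ 0ᶠ
  ∙-0ˡ a = trans (∙-comm 0ᵛ a) (∙-0ʳ a)

  -- Pairing with every vector turns an identity of vectors into one of scalars, which the ring
  -- solver can settle; unit vectors recover the coordinates.
  ∙-ext : ∀ {n} {u v : 𝕍 n} → (∀ a → a ∙ u ≡ a ∙ v) → u ≡ v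
  ∙-ext {u = []} {[]} e = refl
  ∙-ext {u = x ∷ u} {y ∷ v} e = cong₂ _∷_
    (trans (sym (first x u)) (trans (e (1ᶠ ∷ 0ᵛ)) (first y v)))
    (∙-ext (λ a → trans (sym (rest a x u)) (trans (e (0ᶠ ∷ a)) (rest a y v))))
    where
    first : ∀ {n} x (u : 𝕍 n) → (1ᶠ ∷ 0ᵛ) ∙ (x ∷ u) ≡ x
    first x u = trans (cong₂ _+ᶠ_ (R.*-identityˡ x) (∙-0ˡ u)) (R.+-identityʳ x)
    rest : ∀ {n} (a : 𝕍 n) x u → (0ᶠ ∷ a) ∙ (x ∷ u) ≡ a ∙ u
    rest a x u = trans (cong (_+ᶠ a ∙ u) (R.zeroˡ x)) (R.+-identityˡ _)

  *ᵛ-0 : ∀ {n} (v : 𝕍 n) → 0ᶠ *ᵛ v ≡ 0ᵛ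
  *ᵛ-0 v = ∙-ext (λ a → trans (∙-*ʳ a 0ᶠ v) (trans (R.zeroˡ _) (sym (∙-0ʳ a))))

  *ᵛ-zeroʳ : ∀ {n} c → c *ᵛ 0ᵛ {n} ≡ 0ᵛ
  *ᵛ-zeroʳ c = ∙-ext (λ a → trans (∙-*ʳ a c 0ᵛ) (trans (cong (c *ᶠ_) (∙-0ʳ a)) (trans (R.zeroʳ c) (sym (∙-0ʳ a)))))

  *ᵛ-1 : ∀ {n} (v : 𝕍 n) → 1ᶠ *ᵛ v ≡ v
  *ᵛ-1 v = ∙-ext (λ a → trans (∙-*ʳ a 1ᶠ v) (R.*-identityˡ _))

  *ᵛ-assoc : ∀ {n} c e (v : 𝕍 n) → c *ᵛ e *ᵛ v ≡ (c *ᶠ e) *ᵛ v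
  *ᵛ-assoc c e v = ∙-ext (λ a → trans (∙-*ʳ a c _) (trans (cong (c *ᶠ_) (∙-*ʳ a e v))
    (trans (sym (R.*-assoc c e _)) (sym (∙-*ʳ a _ v)))))

  -ᵛ≡0 : ∀ {n} {u v : 𝕍 n} → u -ᵛ v ≡ 0ᵛ → u ≡ v
  -ᵛ≡0 {u = u} {v} e = ∙-ext (λ a → -ᶠ≡0 (trans (sym (∙--ʳ a u v)) (trans (cong (a ∙_) e) (∙-0ʳ a))))

  -ᵛ-self : ∀ {n} (u : 𝕍 n) → u -ᵛ u ≡ 0ᵛ
  -ᵛ-self u = ∙-ext (λ a → trans (∙--ʳ a u u) (trans (R.-‿inverseʳ _) (sym (∙-0ʳ a))))

  -- Stands in for completing `v` to a basis: translating along `a` shifts the pairing with `v` by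
  -- any prescribed amount.
  dual : ∀ {n} (v : 𝕍 n) → v ≢ 0ᵛ → ∃ λ a → a ∙ v ≡ 1ᶠ
  dual [] v≢0 = contradiction refl v≢0
  dual (x ∷ v) v≢0 with x ≟ᶠ 0ᶠ
  ... | no x≢0 with inverse x x≢0
  ...   | y , xy = y ∷ 0ᵛ , trans (cong₂ _+ᶠ_ (trans (R.*-comm y x) xy) (∙-0ˡ v)) (R.+-identityʳ 1ᶠ)
  dual (x ∷ v) v≢0 | yes refl with dual v (λ e → v≢0 (cong (0ᶠ ∷_) e))
  ...   | a , e = 0ᶠ ∷ a , trans (cong₂ _+ᶠ_ (R.zeroˡ x) e) (R.+-identityˡ 1ᶠ)

  ∙≡1⇒≢0 : ∀ {n} {a v : 𝕍 n} → a ∙ v ≡ 1ᶠ → v ≢ 0ᵛ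
  ∙≡1⇒≢0 {a = a} e refl = 0≢1 (trans (sym (∙-0ʳ a)) e)

  *ᵛ-≢0 : ∀ {n c} {v : 𝕍 n} → c ≢ 0ᶠ → v ≢ 0ᵛ → c *ᵛ v ≢ 0ᵛ
  *ᵛ-≢0 {c = c} {v} c≢0 v≢0 e with dual v v≢0
  ... | a , av = c≢0 (begin
    c ≡⟨ sym (R.*-identityʳ c) ⟩
    c *ᶠ 1ᶠ ≡⟨ cong (c *ᶠ_) (sym av) ⟩
    c *ᶠ (a ∙ v) ≡⟨ sym (∙-*ʳ a c v) ⟩
    a ∙ (c *ᵛ v) ≡⟨ cong (a ∙_) e ⟩
    a ∙ 0ᵛ ≡⟨ ∙-0ʳ a ⟩
    0ᶠ             ∎)

  Mat : ℕ → ℕ → Set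
  Mat m n = Vec (𝕍 n) m

  _+ᴹ_ _-ᴹ_ : ∀ {m n} → Mat m n → Mat m n → Mat m n
  _+ᴹ_ = Vec.zipWith _+ᵛ_
  _-ᴹ_ = Vec.zipWith _-ᵛ_

  _*ᴹ_ : ∀ {m n} → 𝔽 → Mat m n → Mat m n
  c *ᴹ d = Vec.map (c *ᵛ_) d

  0ᴹ : ∀ {m n} → Mat m n
  0ᴹ = Vec.replicate _ 0ᵛ

  _⋆_ : ∀ {m n} → Mat m n → 𝕍 n → 𝕍 m
  d ⋆ b = Vec.map (_∙ b) d

  _⊗_ : ∀ {m n} → 𝕍 m → 𝕍 n → Mat m n
  s ⊗ t = Vec.map (_*ᵛ t) s

  _ᵀ : ∀ {m n} → Mat m n → Mat n m
  [] ᵀ = Vec.replicate _ []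
  (r ∷ d) ᵀ = Vec.zipWith _∷_ r (d ᵀ)

  bil : ∀ {m n} → 𝕍 m → Mat m n → 𝕍 n → 𝔽
  bil a d b = a ∙ (d ⋆ b)

  ⋆-+ʳ : ∀ {m n} (d : Mat m n) u v → d ⋆ (u +ᵛ v) ≡ d ⋆ u +ᵛ d ⋆ v
  ⋆-+ʳ [] u v = refl
  ⋆-+ʳ (r ∷ d) u v = cong₂ _∷_ (∙-+ʳ r u v) (⋆-+ʳ d u v)

  ⋆--ʳ : ∀ {m n} (d : Mat m n) u v → d ⋆ (u -ᵛ v) ≡ d ⋆ u -ᵛ d ⋆ v
  ⋆--ʳ [] u v = refl
  ⋆--ʳ (r ∷ d) u v = cong₂ _∷_ (∙--ʳ r u v) (⋆--ʳ d u v)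

  ⋆-*ʳ : ∀ {m n} (d : Mat m n) c u → d ⋆ (c *ᵛ u) ≡ c *ᵛ d ⋆ u
  ⋆-*ʳ [] c u = refl
  ⋆-*ʳ (r ∷ d) c u = cong₂ _∷_ (∙-*ʳ r c u) (⋆-*ʳ d c u)

  ⋆-0ʳ : ∀ {m n} (d : Mat m n) → d ⋆ 0ᵛ ≡ 0ᵛ
  ⋆-0ʳ [] = refl
  ⋆-0ʳ (r ∷ d) = cong₂ _∷_ (∙-0ʳ r) (⋆-0ʳ d)

  ⋆-+ˡ : ∀ {m n} (d e : Mat m n) b → (d +ᴹ e) ⋆ b ≡ d ⋆ b +ᵛ e ⋆ b
  ⋆-+ˡ [] [] b = refl
  ⋆-+ˡ (r ∷ d) (p ∷ e) b = cong₂ _∷_ (∙-+ˡ r p b) (⋆-+ˡ d e b)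

  ⋆--ˡ : ∀ {m n} (d e : Mat m n) b → (d -ᴹ e) ⋆ b ≡ d ⋆ b -ᵛ e ⋆ b
  ⋆--ˡ [] [] b = refl
  ⋆--ˡ (r ∷ d) (p ∷ e) b = cong₂ _∷_ (∙--ˡ r p b) (⋆--ˡ d e b)

  ⋆-*ˡ : ∀ {m n} c (d : Mat m n) b → (c *ᴹ d) ⋆ b ≡ c *ᵛ d ⋆ b
  ⋆-*ˡ c [] b = refl
  ⋆-*ˡ c (r ∷ d) b = cong₂ _∷_ (∙-*ˡ c r b) (⋆-*ˡ c d b)

  ⋆-0ˡ : ∀ {m n} (b : 𝕍 n) → 0ᴹ {m} ⋆ b ≡ 0ᵛ
  ⋆-0ˡ {zero} b = refl
  ⋆-0ˡ {suc m} b = cong₂ _∷_ (∙-0ˡ b) (⋆-0ˡ {m} b)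

  ⋆-⊗ : ∀ {m n} (s : 𝕍 m) (t b : 𝕍 n) → (s ⊗ t) ⋆ b ≡ (t ∙ b) *ᵛ s
  ⋆-⊗ [] t b = refl
  ⋆-⊗ (x ∷ s) t b = cong₂ _∷_ (trans (∙-*ˡ x t b) (R.*-comm x _)) (⋆-⊗ s t b)

  ⋆-ext : ∀ {m n} {d e : Mat m n} → (∀ b → d ⋆ b ≡ e ⋆ b) → d ≡ e
  ⋆-ext {d = []} {[]} h = refl
  ⋆-ext {d = r ∷ d} {p ∷ e} h = cong₂ _∷_
    (∙-ext (λ b → trans (∙-comm b r) (trans (cong Vec.head (h b)) (∙-comm p b))))
    (⋆-ext (λ b → cong Vec.tail (h b)))

  bil-ext : ∀ {m n} {d e : Mat m n} → (∀ a b → bil a d b ≡ bil a e b) → d ≡ e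
  bil-ext h = ⋆-ext (λ b → ∙-ext (λ a → h a b))

  bil-+ : ∀ {m n} a (d e : Mat m n) b → bil a (d +ᴹ e) b ≡ bil a d b +ᶠ bil a e b
  bil-+ a d e b = trans (cong (a ∙_) (⋆-+ˡ d e b)) (∙-+ʳ a _ _)

  bil-- : ∀ {m n} a (d e : Mat m n) b → bil a (d -ᴹ e) b ≡ bil a d b -ᶠ bil a e b
  bil-- a d e b = trans (cong (a ∙_) (⋆--ˡ d e b)) (∙--ʳ a _ _)

  bil-* : ∀ {m n} a c (d : Mat m n) b → bil a (c *ᴹ d) b ≡ c *ᶠ bil a d b
  bil-* a c d b = trans (cong (a ∙_) (⋆-*ˡ c d b)) (∙-*ʳ a c _)

  bil-0 : ∀ {m n} (a : 𝕍 m) (b : 𝕍 n) → bil a 0ᴹ b ≡ 0ᶠ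
  bil-0 a b = trans (cong (a ∙_) (⋆-0ˡ b)) (∙-0ʳ a)

  bil-⊗ : ∀ {m n} a (s : 𝕍 m) (t b : 𝕍 n) → bil a (s ⊗ t) b ≡ (a ∙ s) *ᶠ (t ∙ b)
  bil-⊗ a s t b = trans (cong (a ∙_) (⋆-⊗ s t b)) (trans (∙-*ʳ a _ s) (R.*-comm _ _))

  infixl 6 _⊞_ _⊟_
  infixr 7 _⊠_
  infix 7 _⊡_

  -- Reified matrix expressions for `matrix-identity`. Evaluating the bilinear form on both sides
  -- leaves an equation between field elements, to be closed by the ring solver.
  data Expr (m n : ℕ) : Set where
    ⌈_⌉ : Mat m n → Expr m n
    _⊡_ : 𝕍 m → 𝕍 n → Expr m n
    _⊞_ _⊟_ : Expr m n → Expr m n → Expr m n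
    _⊠_ : 𝔽 → Expr m n → Expr m n

  ⟦_⟧ : ∀ {m n} → Expr m n → Mat m n
  ⟦ ⌈ d ⌉ ⟧ = d
  ⟦ s ⊡ t ⟧ = s ⊗ t
  ⟦ d ⊞ e ⟧ = ⟦ d ⟧ +ᴹ ⟦ e ⟧
  ⟦ d ⊟ e ⟧ = ⟦ d ⟧ -ᴹ ⟦ e ⟧
  ⟦ c ⊠ d ⟧ = c *ᴹ ⟦ d ⟧

  value : ∀ {m n} → 𝕍 m → Expr m n → 𝕍 n → 𝔽
  value a ⌈ d ⌉ b = bil a d b
  value a (s ⊡ t) b = (a ∙ s) *ᶠ (t ∙ b)
  value a (d ⊞ e) b = value a d b +ᶠ value a e b
  value a (d ⊟ e) b = value a d b -ᶠ value a e b
  value a (c ⊠ d) b = c *ᶠ value a d b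

  bil-value : ∀ {m n} a (d : Expr m n) b → bil a ⟦ d ⟧ b ≡ value a d b
  bil-value a ⌈ d ⌉ b = refl
  bil-value a (s ⊡ t) b = bil-⊗ a s t b
  bil-value a (d ⊞ e) b = trans (bil-+ a ⟦ d ⟧ ⟦ e ⟧ b) (cong₂ _+ᶠ_ (bil-value a d b) (bil-value a e b))
  bil-value a (d ⊟ e) b = trans (bil-- a ⟦ d ⟧ ⟦ e ⟧ b) (cong₂ _-ᶠ_ (bil-value a d b) (bil-value a e b))
  bil-value a (c ⊠ d) b = trans (bil-* a c ⟦ d ⟧ b) (cong (c *ᶠ_) (bil-value a d b))

  matrix-identity : ∀ {m n} (d e : Expr m n) → (∀ a b → value a d b ≡ value a e b) → ⟦ d ⟧ ≡ ⟦ e ⟧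
  matrix-identity d e h = bil-ext (λ a b → trans (bil-value a d b) (trans (h a b) (sym (bil-value a e b))))

  bil-+ʳ : ∀ {m n} a (d : Mat m n) u v → bil a d (u +ᵛ v) ≡ bil a d u +ᶠ bil a d v
  bil-+ʳ a d u v = trans (cong (a ∙_) (⋆-+ʳ d u v)) (∙-+ʳ a _ _)

  bil-*ʳ : ∀ {m n} a (d : Mat m n) c u → bil a d (c *ᵛ u) ≡ c *ᶠ bil a d u
  bil-*ʳ a d c u = trans (cong (a ∙_) (⋆-*ʳ d c u)) (∙-*ʳ a c _)

  bil-ᵀ : ∀ {m n} a (d : Mat m n) b → bil b (d ᵀ) a ≡ bil a d b
  bil-ᵀ [] [] b = trans (cong (b ∙_) (empty b)) (∙-0ʳ b)
    where
    empty : ∀ {n} (b : 𝕍 n) → Vec.replicate n [] ⋆ [] ≡ 0ᵛ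
    empty [] = refl
    empty (_ ∷ b) = cong (0ᶠ ∷_) (empty b)
  bil-ᵀ (x ∷ a) (r ∷ d) b = begin
    b ∙ (Vec.zipWith _∷_ r (d ᵀ) ⋆ (x ∷ a)) ≡⟨ cong (b ∙_) (step r (d ᵀ)) ⟩
    b ∙ (x *ᵛ r +ᵛ d ᵀ ⋆ a) ≡⟨ ∙-+ʳ b _ _ ⟩
    b ∙ (x *ᵛ r) +ᶠ bil b (d ᵀ) a ≡⟨ cong₂ _+ᶠ_ (trans (∙-*ʳ b x r) (cong (x *ᶠ_) (∙-comm b r))) (bil-ᵀ a d b) ⟩
    x *ᶠ (r ∙ b) +ᶠ bil a d b                  ∎
    where
    step : ∀ {k} (r : 𝕍 k) (e : Mat k _) → Vec.zipWith _∷_ r e ⋆ (x ∷ a) ≡ x *ᵛ r +ᵛ e ⋆ a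
    step [] [] = refl
    step (y ∷ r) (p ∷ e) = cong₂ _∷_ (cong (_+ᶠ p ∙ a) (R.*-comm y x)) (step r e)

  ᵀ⋆-∙ : ∀ {m n} (d : Mat m n) a b → (d ᵀ ⋆ a) ∙ b ≡ bil a d b
  ᵀ⋆-∙ d a b = trans (∙-comm _ b) (bil-ᵀ a d b)

  ᵀ-involutive : ∀ {m n} (d : Mat m n) → d ᵀ ᵀ ≡ d
  ᵀ-involutive d = bil-ext (λ a b → trans (bil-ᵀ b (d ᵀ) a) (bil-ᵀ a d b))

  ᵀ-dyad : ∀ {m n} (d : Mat m n) s t → (d -ᴹ s ⊗ t) ᵀ ≡ d ᵀ -ᴹ t ⊗ s
  ᵀ-dyad d s t = bil-ext λ b a → begin
    bil b ((d -ᴹ s ⊗ t) ᵀ) a ≡⟨ bil-ᵀ a _ b ⟩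
    bil a (d -ᴹ s ⊗ t) b ≡⟨ bil-- a d _ b ⟩
    bil a d b -ᶠ bil a (s ⊗ t) b ≡⟨ cong₂ _-ᶠ_ (sym (bil-ᵀ a d b)) (flip a b) ⟩
    bil b (d ᵀ) a -ᶠ bil b (t ⊗ s) a ≡⟨ sym (bil-- b (d ᵀ) _ a) ⟩
    bil b (d ᵀ -ᴹ t ⊗ s) a                  ∎
    where
    flip : ∀ a b → bil a (s ⊗ t) b ≡ bil b (t ⊗ s) a
    flip a b = begin
      bil a (s ⊗ t) b ≡⟨ bil-⊗ a s t b ⟩
      (a ∙ s) *ᶠ (t ∙ b) ≡⟨ R.*-comm _ _ ⟩
      (t ∙ b) *ᶠ (a ∙ s) ≡⟨ cong₂ _*ᶠ_ (∙-comm t b) (∙-comm a s) ⟩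
      (b ∙ t) *ᶠ (s ∙ a) ≡⟨ sym (bil-⊗ b t s a) ⟩
      bil b (t ⊗ s) a        ∎

  -- The trace form tr(Bᵗ d), through which matrices index the additive characters of the matrix
  -- space.
  ⟪_,_⟫ : ∀ {m n} → Mat m n → Mat m n → 𝔽
  ⟪ [] , [] ⟫ = 0ᶠ
  ⟪ r ∷ B , s ∷ d ⟫ = r ∙ s +ᶠ ⟪ B , d ⟫

  ⟪⟫-comm : ∀ {m n} (B d : Mat m n) → ⟪ B , d ⟫ ≡ ⟪ d , B ⟫
  ⟪⟫-comm [] [] = refl
  ⟪⟫-comm (r ∷ B) (s ∷ d) = cong₂ _+ᶠ_ (∙-comm r s) (⟪⟫-comm B d)

  ⟪⟫-+ : ∀ {m n} (B d e : Mat m n) → ⟪ B , d +ᴹ e ⟫ ≡ ⟪ B , d ⟫ +ᶠ ⟪ B , e ⟫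
  ⟪⟫-+ [] [] [] = sym (R.+-identityˡ _)
  ⟪⟫-+ (r ∷ B) (s ∷ d) (u ∷ e) = trans (cong₂ _+ᶠ_ (∙-+ʳ r s u) (⟪⟫-+ B d e))
    (solve 4 (λ a b c d → (a :+ b) :+ (c :+ d) := (a :+ c) :+ (b :+ d)) refl _ _ _ _)

  ⟪⟫-- : ∀ {m n} (B d e : Mat m n) → ⟪ B , d -ᴹ e ⟫ ≡ ⟪ B , d ⟫ -ᶠ ⟪ B , e ⟫
  ⟪⟫-- [] [] [] = sym (R.-‿inverseʳ 0ᶠ)
  ⟪⟫-- (r ∷ B) (s ∷ d) (u ∷ e) = trans (cong₂ _+ᶠ_ (∙--ʳ r s u) (⟪⟫-- B d e))
    (solve 4 (λ a b c d → (a :- b) :+ (c :- d) := (a :+ c) :- (b :+ d)) refl _ _ _ _)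

  ⟪⟫-* : ∀ {m n} (B : Mat m n) c d → ⟪ B , c *ᴹ d ⟫ ≡ c *ᶠ ⟪ B , d ⟫
  ⟪⟫-* [] c [] = sym (R.zeroʳ c)
  ⟪⟫-* (r ∷ B) c (s ∷ d) = trans (cong₂ _+ᶠ_ (∙-*ʳ r c s) (⟪⟫-* B c d)) (sym (R.distribˡ c _ _))

  ⟪⟫-⊗ : ∀ {m n} (B : Mat m n) s t → ⟪ B , s ⊗ t ⟫ ≡ bil s B t
  ⟪⟫-⊗ [] [] t = refl
  ⟪⟫-⊗ (r ∷ B) (x ∷ s) t = cong₂ _+ᶠ_ (∙-*ʳ r x t) (⟪⟫-⊗ B s t)

-- Equidistribution of linear functionals and orthogonality of characters.

module Equidistribution (K : CharacteristicZeroDomain) (F : FiniteField) where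

  open Summation K public
  open LinearAlgebra F public
  open Enumeration public hiding (_≟_)
  open ≡-Reasoning

  private
    module Rᶠ = CommutativeRing ringᶠ
    module S = IntegerSolver ringᶠ

    sumOver-tabulate : {A : Set} → ∀ n (h : Fin n → A) f i → (∀ j → j ≢ i → f (h j) ≡ 0#) →
      sumOver (List.tabulate h) f ≡ f (h i)
    sumOver-tabulate (suc n) h f Fin.zero off =
      trans (cong (f (h Fin.zero) +_) (vanishing n (h ∘ Fin.suc) (λ j → off (Fin.suc j) λ ()))) (+-identityʳ _)
      where
      vanishing : ∀ n (h : Fin n → _) → (∀ j → f (h j) ≡ 0#) → sumOver (List.tabulate h) f ≡ 0#
      vanishing zero h e = refl
      vanishing (suc n) h e = trans (cong₂ _+_ (e Fin.zero) (vanishing n (h ∘ Fin.suc) (e ∘ Fin.suc))) (+-identityˡ 0#)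
    sumOver-tabulate (suc n) h f (Fin.suc i) off =
      trans (cong₂ _+_ (off Fin.zero λ ())
              (sumOver-tabulate n (h ∘ Fin.suc) f i (λ j j≢i → off (Fin.suc j) λ { refl → j≢i refl })))
            (+-identityˡ _)

  -- The list is the one called `allF` in the definitions, so sums over `𝕞 D M` run over `allX` by
  -- computation.
  𝕗 : Enumeration 𝔽
  𝕗 = record
    { list = List.map (Inverse.to enum) (List.allFin size)
    ; _≟_ = _≟ᶠ_
    ; complete = λ a → subst (_∈ List.map (Inverse.to enum) (List.allFin size))
        (Inverse.strictlyInverseˡ enum a) (∈-map⁺ (Inverse.to enum) (∈-allFin (Inverse.from enum a)))
    ; sift = sift-𝔽 }
    where
    sift-𝔽 : ∀ a (g : 𝔽 → Carrier) →
      sumOver (List.map (Inverse.to enum) (List.allFin size)) (λ x → 𝟙 (x ≟ᶠ a) * g x) ≡ g a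
    sift-𝔽 a g = begin
      sumOver (List.map (Inverse.to enum) (List.allFin size)) h
        ≡⟨ sumOver-map (Inverse.to enum) (List.allFin size) h ⟩
      sumOver (List.allFin size) (h ∘ Inverse.to enum)
        ≡⟨ sumOver-tabulate size id (h ∘ Inverse.to enum) i off ⟩
      h (Inverse.to enum i)
        ≡⟨ cong h (Inverse.strictlyInverseˡ enum a) ⟩
      𝟙 (a ≟ᶠ a) * g a
        ≡⟨ trans (cong (_* g a) (𝟙-yes (a ≟ᶠ a) refl)) (*-identityˡ _) ⟩
      g a ∎
      where
      h = λ x → 𝟙 (x ≟ᶠ a) * g x
      i = Inverse.from enum a
      off : ∀ j → j ≢ i → h (Inverse.to enum j) ≡ 0#
      off j j≢i = trans (cong (_* _) (𝟙-no (_ ≟ᶠ a) (λ e → j≢i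
        (trans (sym (Inverse.strictlyInverseʳ enum j)) (cong (Inverse.from enum) e))))) (zeroˡ _)

  𝕧 : ∀ n → Enumeration (𝕍 n)
  𝕧 = vectors 𝕗

  𝕞 : ∀ m n → Enumeration (Mat m n)
  𝕞 m n = vectors (𝕧 n) m

  infix 4 _≟ᵛ_ _≟ᴹ_
  _≟ᵛ_ : ∀ {n} → DecidableEquality (𝕍 n)
  _≟ᵛ_ = _≟ⱽ_ 𝕗

  _≟ᴹ_ : ∀ {m n} → DecidableEquality (Mat m n)
  _≟ᴹ_ {n = n} = _≟ⱽ_ (𝕧 n)

  2≤size : 2 ℕ.≤ size
  2≤size = go size (Inverse.from enum) (λ {a} {b} e → trans (sym (Inverse.strictlyInverseˡ enum a))
      (trans (cong (Inverse.to enum) e) (Inverse.strictlyInverseˡ enum b)))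
    where
    go : ∀ n (f : 𝔽 → Fin n) → (∀ {a b} → f a ≡ f b → a ≡ b) → 2 ℕ.≤ n
    go zero f inj with f 0ᶠ
    ... | ()
    go (suc zero) f inj = contradiction (inj (single (f 0ᶠ) (f 1ᶠ))) 0≢1
      where
      single : ∀ (i j : Fin 1) → i ≡ j
      single Fin.zero Fin.zero = refl
    go (suc (suc n)) f inj = ℕ.s≤s (ℕ.s≤s ℕ.z≤n)

  opaque
    Q : Carrier
    Q = fromℕ size

    pw : ℕ → Carrier
    pw n = fromℕ (size ℕ.^ n)

    Q-def : Q ≡ fromℕ size
    Q-def = refl

    fromℕ-pw : ∀ n → fromℕ (size ℕ.^ n) ≡ pw n
    fromℕ-pw n = refl

    pw-0 : pw 0 ≡ 1#
    pw-0 = +-identityʳ 1#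

    pw-suc : ∀ n → pw (suc n) ≡ Q * pw n
    pw-suc n = ×1-homo-* size (size ℕ.^ n)

    pw-+ : ∀ m n → pw (m ℕ.+ n) ≡ pw m * pw n
    pw-+ m n = trans (cong fromℕ (ℕₚ.^-distribˡ-+-* size m n)) (×1-homo-* (size ℕ.^ m) (size ℕ.^ n))

    pw-injective : ∀ {m n} → pw m ≡ pw n → m ≡ n
    pw-injective {m} {n} e = ℕₚ.≤-antisym (half m n (fromℕ-injective e)) (half n m (sym (fromℕ-injective e)))
      where
      half : ∀ m n → size ℕ.^ m ≡ size ℕ.^ n → m ℕ.≤ n
      half m n e with m ℕ.≤? n
      ... | yes m≤n = m≤n
      ... | no m≰n = contradiction (sym e) (ℕₚ.<⇒≢ (ℕₚ.^-monoʳ-< size 2≤size (ℕₚ.≰⇒> m≰n)))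

    pw≢0 : ∀ n → pw n ≢ 0#
    pw≢0 n e with ℕₚ.m^n≡0⇒m≡0 size n (fromℕ-injective {size ℕ.^ n} {0} e)
    ... | size≡0 with subst (2 ℕ.≤_) size≡0 2≤size
    ...   | ()

    ∑1-𝔽 : ∑ 𝕗 (λ _ → 1#) ≡ Q
    ∑1-𝔽 = trans (count (list 𝕗)) (cong fromℕ (trans (Listₚ.length-map (Inverse.to enum) (List.allFin size)) (Listₚ.length-tabulate {n = size} id)))
      where
      count : ∀ (xs : List 𝔽) → sumOver xs (λ _ → 1#) ≡ fromℕ (List.length xs)
      count [] = refl
      count (x ∷ xs) = cong (1# +_) (count xs)

  ∑1-𝕍 : ∀ n → ∑ (𝕧 n) (λ _ → 1#) ≡ pw n
  ∑1-𝕍 zero = trans (+-identityʳ 1#) (sym pw-0)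
  ∑1-𝕍 (suc n) = begin
    ∑ (𝕧 (suc n)) (λ _ → 1#) ≡⟨ sumOver-vectors 𝕗 n _ ⟩
    ∑ 𝕗 (λ _ → ∑ (𝕧 n) (λ _ → 1#)) ≡⟨ ∑-cong 𝕗 (λ _ → ∑1-𝕍 n) ⟩
    ∑ 𝕗 (λ _ → pw n) ≡⟨ ∑-const 𝕗 (pw n) ⟩
    ∑ 𝕗 (λ _ → 1#) * pw n ≡⟨ cong (_* pw n) ∑1-𝔽 ⟩
    Q * pw n ≡⟨ sym (pw-suc n) ⟩
    pw (suc n)                            ∎

  Q-1≢0 : Q - 1# ≢ 0#
  Q-1≢0 e = contradiction (pw-injective {1} {0} (begin
    pw 1 ≡⟨ pw-suc 0 ⟩
    Q * pw 0 ≡⟨ cong (Q *_) pw-0 ⟩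
    Q * 1# ≡⟨ solve 1 (λ q → q :* :1 := (q :- :1) :+ :1) refl Q ⟩
    (Q - 1#) + 1# ≡⟨ cong (_+ 1#) e ⟩
    0# + 1# ≡⟨ +-identityˡ 1# ⟩
    1# ≡⟨ sym pw-0 ⟩
    pw 0            ∎)) λ ()

  module _ {A : Set} (E : Enumeration A) (f : A → Carrier) (φ : A → 𝔽) (τ : 𝔽 → A → A)
    (τ-inverse : ∀ c a → τ (⊖ c) (τ c a) ≡ a)
    (f-invariant : ∀ c a → f (τ c a) ≡ f a)
    (φ-shift : ∀ c a → φ (τ c a) ≡ φ a +ᶠ c) where

    -- τ c permutes A, keeps the weight f and raises φ by c, so all Q fibres of φ have the same
    -- weight. The other composite of τ c and τ (⊖ c) is the hypothesis at ⊖ c.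
    equidistributed : ∀ c → Q * ∑ E (λ a → 𝟙 (φ a ≟ᶠ c) * f a) ≡ ∑ E f
    equidistributed c = begin
      Q * fibre c ≡⟨ cong (Q *_) (fibre-0 c) ⟩
      Q * fibre 0ᶠ ≡⟨ cong (_* fibre 0ᶠ) (sym ∑1-𝔽) ⟩
      ∑ 𝕗 (λ _ → 1#) * fibre 0ᶠ ≡⟨ sym (∑-const 𝕗 (fibre 0ᶠ)) ⟩
      ∑ 𝕗 (λ _ → fibre 0ᶠ) ≡⟨ ∑-cong 𝕗 (λ c → sym (fibre-0 c)) ⟩
      ∑ 𝕗 fibre ≡⟨ sym (∑-fibres E 𝕗 φ f) ⟩
      ∑ E f                                           ∎
      where
      fibre : 𝔽 → Carrier
      fibre c = ∑ E (λ a → 𝟙 (φ a ≟ᶠ c) * f a)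
      neg-neg : ∀ c → ⊖ (⊖ c) ≡ c
      neg-neg c = S.solve 1 (λ c → S.:- (S.:- c) S.:= c) refl c
      shift⇒ : ∀ {x c} → x +ᶠ c ≡ c → x ≡ 0ᶠ
      shift⇒ {x} {c} e = trans (S.solve 2 (λ x c → x S.:= (x S.:+ c) S.:- c) refl x c)
        (trans (cong (_-ᶠ c) e) (Rᶠ.-‿inverseʳ c))
      fibre-0 : ∀ c → fibre c ≡ fibre 0ᶠ
      fibre-0 c = begin
        fibre c
          ≡⟨ sym (∑-reindex E E (τ c) (τ (⊖ c)) (τ-inverse c)
               (λ a → trans (cong (λ x → τ x (τ (⊖ c) a)) (sym (neg-neg c))) (τ-inverse (⊖ c) a)) _) ⟩
        ∑ E (λ a → 𝟙 (φ (τ c a) ≟ᶠ c) * f (τ c a))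
          ≡⟨ ∑-cong E (λ a → cong₂ _*_
               (𝟙-cong (φ (τ c a) ≟ᶠ c) (φ a ≟ᶠ 0ᶠ)
                 (λ e → shift⇒ (trans (sym (φ-shift c a)) e))
                 (λ e → trans (φ-shift c a) (trans (cong (_+ᶠ c) e) (Rᶠ.+-identityˡ c))))
               (f-invariant c a)) ⟩
        fibre 0ᶠ ∎

  opaque
    -- χ c is the sum of ψ c over the nontrivial additive characters ψ of the field.
    χ : 𝔽 → Carrier
    χ c = Q * 𝟙 (c ≟ᶠ 0ᶠ) - 1#

    χ-def : ∀ c → χ c ≡ Q * 𝟙 (c ≟ᶠ 0ᶠ) - 1#
    χ-def c = refl

    χ-0 : χ 0ᶠ ≡ Q - 1#
    χ-0 = trans (cong (λ x → Q * x - 1#) (𝟙-yes (0ᶠ ≟ᶠ 0ᶠ) refl)) (cong (_- 1#) (*-identityʳ Q))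

    χ-cong : ∀ {x y} → (x ≡ 0ᶠ → y ≡ 0ᶠ) → (y ≡ 0ᶠ → x ≡ 0ᶠ) → χ x ≡ χ y
    χ-cong {x} {y} f g = cong (λ z → Q * z - 1#) (𝟙-cong (x ≟ᶠ 0ᶠ) (y ≟ᶠ 0ᶠ) f g)

    -- Orthogonality for a nontrivial character: Q times the number of a with φ a = c is the size of
    -- A, by equidistribution, and the constant -1 in `χ` removes exactly that.
    ∑-χ-affine : {A : Set} (E : Enumeration A) (φ : A → 𝔽) (τ : 𝔽 → A → A) →
      (∀ c a → τ (⊖ c) (τ c a) ≡ a) → (∀ c a → φ (τ c a) ≡ φ a +ᶠ c) →
      ∀ c → ∑ E (λ a → χ (c -ᶠ φ a)) ≡ 0#
    ∑-χ-affine E φ τ inv shift c = begin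
      ∑ E (λ a → χ (c -ᶠ φ a))
        ≡⟨ ∑-- E _ _ ⟩
      ∑ E (λ a → Q * 𝟙 (c -ᶠ φ a ≟ᶠ 0ᶠ)) - ∑ E (λ _ → 1#)
        ≡⟨ cong (_- _) (∑-*ˡ E Q _) ⟩
      Q * ∑ E (λ a → 𝟙 (c -ᶠ φ a ≟ᶠ 0ᶠ)) - ∑ E (λ _ → 1#)
        ≡⟨ cong (λ z → Q * z - ∑ E (λ _ → 1#)) (∑-cong E (λ a → trans
             (𝟙-cong (c -ᶠ φ a ≟ᶠ 0ᶠ) (φ a ≟ᶠ c) (λ e → sym (-ᶠ≡0 e))
               (λ e → trans (cong (c -ᶠ_) e) (Rᶠ.-‿inverseʳ c)))
             (sym (*-identityʳ _)))) ⟩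
      Q * ∑ E (λ a → 𝟙 (φ a ≟ᶠ c) * 1#) - ∑ E (λ _ → 1#)
        ≡⟨ cong (_- ∑ E (λ _ → 1#)) (equidistributed E (λ _ → 1#) φ τ inv (λ _ _ → refl) shift c) ⟩
      ∑ E (λ _ → 1#) - ∑ E (λ _ → 1#)
        ≡⟨ -‿inverseʳ _ ⟩
      0# ∎

  private
    cancel-shift : ∀ x c y → (x +ᶠ c *ᶠ y) +ᶠ (⊖ c) *ᶠ y ≡ x
    cancel-shift = S.solve 3 (λ x c y → (x S.:+ c S.:* y) S.:+ (S.:- c) S.:* y S.:= x) refl

    ∑-χ-0 : {A : Set} (E : Enumeration A) (φ : A → 𝔽) → (∀ a → φ a ≡ 0ᶠ) →
      ∀ c → ∑ E (λ a → χ (c -ᶠ φ a)) ≡ ∑ E (λ _ → 1#) * χ c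
    ∑-χ-0 E φ φ≡0 c = trans (∑-cong E (λ a → cong χ (trans (cong (c -ᶠ_) (φ≡0 a)) (minus-0 c)))) (∑-const E (χ c))
      where
      minus-0 : ∀ c → c -ᶠ 0ᶠ ≡ c
      minus-0 = S.solve 1 (λ c → c S.:- S.:0 S.:= c) refl

  shift-inverse : ∀ {n} (e : 𝕍 n) c s → (s +ᵛ c *ᵛ e) +ᵛ (⊖ c) *ᵛ e ≡ s
  shift-inverse e c s = ∙-ext (λ a → begin
    a ∙ ((s +ᵛ c *ᵛ e) +ᵛ (⊖ c) *ᵛ e)
      ≡⟨ ∙-+ʳ a _ _ ⟩
    a ∙ (s +ᵛ c *ᵛ e) +ᶠ a ∙ ((⊖ c) *ᵛ e)
      ≡⟨ cong₂ _+ᶠ_ (trans (∙-+ʳ a _ _) (cong (a ∙ s +ᶠ_) (∙-*ʳ a c e))) (∙-*ʳ a _ e) ⟩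
    (a ∙ s +ᶠ c *ᶠ (a ∙ e)) +ᶠ (⊖ c) *ᶠ (a ∙ e)
      ≡⟨ cancel-shift _ c _ ⟩
    a ∙ s ∎)

  -- For v ≠ 0 the vectors s are translated along some e with e ∙ v = 1; for v = 0 every summand is
  -- χ c.
  ∑-χ-∙ : ∀ {n} (v : 𝕍 n) c →
    ∑ (𝕧 n) (λ s → χ (c -ᶠ s ∙ v)) ≡ 𝟙 (v ≟ᵛ 0ᵛ) * (pw n * χ c)
  ∑-χ-∙ {n} v c = decide (v ≟ᵛ 0ᵛ)
    where
    decide : (p : Dec (v ≡ 0ᵛ)) → ∑ (𝕧 n) (λ s → χ (c -ᶠ s ∙ v)) ≡ 𝟙 p * (pw n * χ c)
    decide (yes refl) = trans (∑-χ-0 (𝕧 n) (_∙ v) ∙-0ʳ c)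
      (trans (cong (_* χ c) (∑1-𝕍 n)) (sym (*-identityˡ _)))
    decide (no v≢0) with dual v v≢0
    ... | e , ev = trans (∑-χ-affine (𝕧 n) (_∙ v) (λ c s → s +ᵛ c *ᵛ e) (shift-inverse e)
        (λ c s → trans (∙-+ˡ s _ v) (cong (s ∙ v +ᶠ_) (trans (∙-*ˡ c e v)
          (trans (cong (c *ᶠ_) ev) (Rᶠ.*-identityʳ c))))) c) (sym (zeroˡ _))

  nonzero-bil : ∀ {m n} (d : Mat m n) → d ≢ 0ᴹ → ∃₂ λ a b → bil a d b ≡ 1ᶠ
  nonzero-bil {m} {n} d d≢0 with search (𝕧 n) (λ b → ¬? (d ⋆ b ≟ᵛ 0ᵛ))
  ... | yes (b , db≢0) with dual (d ⋆ b) db≢0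
  ...   | a , e = a , b , e
  nonzero-bil {m} {n} d d≢0 | no none = contradiction
    (⋆-ext (λ b → trans (decidable-stable (d ⋆ b ≟ᵛ 0ᵛ) (λ db≢0 → none (b , db≢0))) (sym (⋆-0ˡ b)))) d≢0

  -- For d ≠ 0 the matrices B are translated along a dyad s ⊗ t with sᵗ d t = 1, which shifts the
  -- trace form by the chosen scalar.
  ∑-χ-⟪⟫ : ∀ {m n} (d : Mat m n) c →
    ∑ (𝕞 m n) (λ B → χ (c -ᶠ ⟪ d , B ⟫)) ≡ 𝟙 (d ≟ᴹ 0ᴹ) * (∑ (𝕞 m n) (λ _ → 1#) * χ c)
  ∑-χ-⟪⟫ {m} {n} d c = decide (d ≟ᴹ 0ᴹ)
    where
    decide : (p : Dec (d ≡ 0ᴹ)) →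
      ∑ (𝕞 m n) (λ B → χ (c -ᶠ ⟪ d , B ⟫)) ≡ 𝟙 p * (∑ (𝕞 m n) (λ _ → 1#) * χ c)
    decide (yes refl) = trans (∑-χ-0 (𝕞 m n) (λ B → ⟪ 0ᴹ , B ⟫) (λ B → ⟪0⟫ B) c) (sym (*-identityˡ _))
      where
      ⟪0⟫ : ∀ {m} (B : Mat m n) → ⟪ 0ᴹ , B ⟫ ≡ 0ᶠ
      ⟪0⟫ [] = refl
      ⟪0⟫ (r ∷ B) = trans (cong₂ _+ᶠ_ (∙-0ˡ r) (⟪0⟫ B)) (Rᶠ.+-identityˡ _)
    decide (no d≢0) with nonzero-bil d d≢0
    ... | s , t , e = trans (∑-χ-affine (𝕞 m n) (λ B → ⟪ d , B ⟫) (λ c B → B +ᴹ c *ᴹ (s ⊗ t))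
        (λ c B → bil-ext (λ a b → begin
          bil a ((B +ᴹ c *ᴹ (s ⊗ t)) +ᴹ (⊖ c) *ᴹ (s ⊗ t)) b
            ≡⟨ bil-+ a _ _ b ⟩
          bil a (B +ᴹ c *ᴹ (s ⊗ t)) b +ᶠ bil a ((⊖ c) *ᴹ (s ⊗ t)) b
            ≡⟨ cong₂ _+ᶠ_ (trans (bil-+ a B _ b) (cong (bil a B b +ᶠ_) (bil-* a c _ b))) (bil-* a _ _ b) ⟩
          (bil a B b +ᶠ c *ᶠ bil a (s ⊗ t) b) +ᶠ (⊖ c) *ᶠ bil a (s ⊗ t) b
            ≡⟨ cancel-shift _ c _ ⟩
          bil a B b ∎))
        (λ c B → trans (⟪⟫-+ d B _) (cong (⟪ d , B ⟫ +ᶠ_) (begin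
          ⟪ d , c *ᴹ (s ⊗ t) ⟫ ≡⟨ ⟪⟫-* d c _ ⟩
          c *ᶠ ⟪ d , s ⊗ t ⟫ ≡⟨ cong (c *ᶠ_) (trans (⟪⟫-⊗ d s t) e) ⟩
          c *ᶠ 1ᶠ ≡⟨ Rᶠ.*-identityʳ c ⟩
          c                        ∎))) c) (sym (zeroˡ _))

-- Rank through the size of the kernel, and its change under subtraction of a dyad.

module Rank (K : CharacteristicZeroDomain) (F : FiniteField) where

  open Equidistribution K F public
  open ≡-Reasoning

  private
    module Rᶠ = CommutativeRing ringᶠ
    module S = IntegerSolver ringᶠ

  opaque
    κ : ∀ {m n} → Mat m n → Carrier
    κ {n = n} d = ∑ (𝕧 n) (λ b → 𝟙 (d ⋆ b ≟ᵛ 0ᵛ))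

    κ-def : ∀ {m n} (d : Mat m n) → κ d ≡ ∑ (𝕧 n) (λ b → 𝟙 (d ⋆ b ≟ᵛ 0ᵛ))
    κ-def d = refl

    κ≢0 : ∀ {m n} (d : Mat m n) → κ d ≢ 0#
    κ≢0 {n = n} d = ∑-count≢0 (𝕧 n) (λ b → d ⋆ b ≟ᵛ 0ᵛ) (0ᵛ , ⋆-0ʳ d)

    κ-cong : ∀ {m m′ n} (d : Mat m n) (e : Mat m′ n) →
      (∀ b → d ⋆ b ≡ 0ᵛ → e ⋆ b ≡ 0ᵛ) → (∀ b → e ⋆ b ≡ 0ᵛ → d ⋆ b ≡ 0ᵛ) → κ d ≡ κ e
    κ-cong {n = n} d e f g = ∑-cong (𝕧 n) (λ b → 𝟙-cong (d ⋆ b ≟ᵛ 0ᵛ) (e ⋆ b ≟ᵛ 0ᵛ) (f b) (g b))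

    κ-0 : ∀ {m n} → κ (0ᴹ {m} {n}) ≡ pw n
    κ-0 {m} {n} = trans (∑-cong (𝕧 n) (λ b → 𝟙-yes (0ᴹ ⋆ b ≟ᵛ 0ᵛ) (⋆-0ˡ {m} b))) (∑1-𝕍 n)

  -- t is not in the row space of d.
  Free : ∀ {m n} → 𝕍 n → Mat m n → Set
  Free t d = ∃ λ b → d ⋆ b ≡ 0ᵛ × t ∙ b ≡ 1ᶠ

  Dependent : ∀ {m n} → 𝕍 n → Mat m n → Set
  Dependent t d = ∀ b → d ⋆ b ≡ 0ᵛ → t ∙ b ≡ 0ᶠ

  free⊎dependent : ∀ {m n} (t : 𝕍 n) (d : Mat m n) → Free t d ⊎ Dependent t d
  free⊎dependent {n = n} t d with search (𝕧 n) (λ b → (d ⋆ b ≟ᵛ 0ᵛ) ×-dec (t ∙ b ≟ᶠ 1ᶠ))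
  ... | yes free = inj₁ free
  ... | no none = inj₂ λ b db → decide b db (t ∙ b ≟ᶠ 0ᶠ)
    where
    decide : ∀ b → d ⋆ b ≡ 0ᵛ → Dec (t ∙ b ≡ 0ᶠ) → t ∙ b ≡ 0ᶠ
    decide b db (yes e) = e
    decide b db (no tb≢0) with inverse (t ∙ b) tb≢0
    ... | c , tbc = contradiction (c *ᵛ b ,
      trans (⋆-*ʳ d c b) (trans (cong (c *ᵛ_) db) (*ᵛ-zeroʳ c)) ,
      trans (∙-*ʳ t c b) (trans (Rᶠ.*-comm c _) tbc)) none

  -- On the kernel of d the functional t is equidistributed, because translation along the witness e
  -- stays in the kernel and shifts t. Its zero fibre is the kernel of `t ∷ d`.
  κ-free : ∀ {m n} {t : 𝕍 n} {d : Mat m n} → Free t d → κ d ≡ Q * κ (t ∷ d)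
  κ-free {n = n} {t} {d} (e , de , te) = sym (begin
    Q * κ (t ∷ d)
      ≡⟨ cong (Q *_) (trans (κ-def (t ∷ d)) (∑-cong (𝕧 n) (λ b → trans
           (𝟙-cong (t ∙ b ∷ d ⋆ b ≟ᵛ 0ᵛ) ((t ∙ b ≟ᶠ 0ᶠ) ×-dec (d ⋆ b ≟ᵛ 0ᵛ)) Vecₚ.∷-injective (λ (p , q) → cong₂ _∷_ p q))
           (𝟙-× (t ∙ b ≟ᶠ 0ᶠ) (d ⋆ b ≟ᵛ 0ᵛ))))) ⟩
    Q * ∑ (𝕧 n) (λ b → 𝟙 (t ∙ b ≟ᶠ 0ᶠ) * 𝟙 (d ⋆ b ≟ᵛ 0ᵛ))
      ≡⟨ equidistributed (𝕧 n) (λ b → 𝟙 (d ⋆ b ≟ᵛ 0ᵛ)) (t ∙_) (λ c b → b +ᵛ c *ᵛ e) (shift-inverse e)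
           (λ c b → 𝟙-cong (d ⋆ (b +ᵛ c *ᵛ e) ≟ᵛ 0ᵛ) (d ⋆ b ≟ᵛ 0ᵛ) (trans (sym (shift c b))) (trans (shift c b)))
           (λ c b → trans (∙-+ʳ t b _) (cong (t ∙ b +ᶠ_) (trans (∙-*ʳ t c e) (trans (cong (c *ᶠ_) te) (Rᶠ.*-identityʳ c)))))
           0ᶠ ⟩
    ∑ (𝕧 n) (λ b → 𝟙 (d ⋆ b ≟ᵛ 0ᵛ))
      ≡⟨ sym (κ-def d) ⟩
    κ d ∎)
    where
    shift : ∀ c b → d ⋆ (b +ᵛ c *ᵛ e) ≡ d ⋆ b
    shift c b = ∙-ext (λ a → begin
      a ∙ (d ⋆ (b +ᵛ c *ᵛ e)) ≡⟨ bil-+ʳ a d b _ ⟩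
      bil a d b +ᶠ bil a d (c *ᵛ e) ≡⟨ cong (bil a d b +ᶠ_) (trans (bil-*ʳ a d c e)
                                              (trans (cong (c *ᶠ_) (trans (cong (a ∙_) de) (∙-0ʳ a))) (Rᶠ.zeroʳ c))) ⟩
      bil a d b +ᶠ 0ᶠ ≡⟨ Rᶠ.+-identityʳ _ ⟩
      bil a d b                          ∎)

  κ-dependent : ∀ {m n} {t : 𝕍 n} {d : Mat m n} → Dependent t d → κ d ≡ κ (t ∷ d)
  κ-dependent {t = t} {d} dep = κ-cong d (t ∷ d) (λ b db → cong₂ _∷_ (dep b db) db) (λ b e → cong Vec.tail e)

  -- Each new row divides the kernel by Q when it is free over the later rows and leaves it alone
  -- otherwise, so r counts the free rows.
  κ-rank-exists : ∀ {m n} (d : Mat m n) → ∃ λ r → r ℕ.≤ m × κ d * pw r ≡ pw n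
  κ-rank-exists {n = n} [] = 0 , ℕ.z≤n , trans (cong (κ [] *_) pw-0) (trans (*-identityʳ _) (κ-0 {0}))
  κ-rank-exists {n = n} (t ∷ d) with κ-rank-exists d | free⊎dependent t d
  ... | r , r≤m , e | inj₂ dep = r , ℕₚ.m≤n⇒m≤1+n r≤m , trans (cong (_* pw r) (sym (κ-dependent dep))) e
  ... | r , r≤m , e | inj₁ free = suc r , ℕ.s≤s r≤m , (begin
    κ (t ∷ d) * pw (suc r) ≡⟨ cong (κ (t ∷ d) *_) (pw-suc r) ⟩
    κ (t ∷ d) * (Q * pw r) ≡⟨ solve 3 (λ k q p → k :* (q :* p) := (q :* k) :* p) refl _ Q _ ⟩
    (Q * κ (t ∷ d)) * pw r ≡⟨ cong (_* pw r) (sym (κ-free free)) ⟩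
    κ d * pw r ≡⟨ e ⟩
    pw n                     ∎)

  opaque
    rank : ∀ {m n} → Mat m n → ℕ
    rank d = proj₁ (κ-rank-exists d)

    rank≤ : ∀ {m n} (d : Mat m n) → rank d ℕ.≤ m
    rank≤ d = proj₁ (proj₂ (κ-rank-exists d))

    κ-rank : ∀ {m n} (d : Mat m n) → κ d * pw (rank d) ≡ pw n
    κ-rank d = proj₂ (proj₂ (κ-rank-exists d))

  rank-unique : ∀ {m n} (d : Mat m n) {r} → κ d * pw r ≡ pw n → rank d ≡ r
  rank-unique d e = pw-injective (*-cancelˡ (κ d) (κ≢0 d) (trans (κ-rank d) (sym e)))

  rank-cong : ∀ {m m′ n} (d : Mat m n) (e : Mat m′ n) → κ d ≡ κ e → rank d ≡ rank e
  rank-cong d e h = rank-unique d (trans (cong (_* pw (rank e)) h) (κ-rank e))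

  rank-suc : ∀ {m m′ n} (d : Mat m n) (e : Mat m′ n) → κ e ≡ Q * κ d → rank d ≡ suc (rank e)
  rank-suc d e h = rank-unique d (begin
    κ d * pw (suc (rank e)) ≡⟨ cong (κ d *_) (pw-suc _) ⟩
    κ d * (Q * pw (rank e)) ≡⟨ solve 3 (λ k q p → k :* (q :* p) := (q :* k) :* p) refl _ Q _ ⟩
    (Q * κ d) * pw (rank e) ≡⟨ cong (_* pw (rank e)) (sym h) ⟩
    κ e * pw (rank e) ≡⟨ κ-rank e ⟩
    pw _                       ∎)

  rank-0 : ∀ {m n} → rank (0ᴹ {m} {n}) ≡ 0
  rank-0 {m} = rank-unique (0ᴹ {m}) (trans (cong₂ _*_ (κ-0 {m}) pw-0) (*-identityʳ _))

  -- Row rank equals column rank: χ(-aᵗ d b) is summed over a and b in both orders. The inner sum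
  -- survives only when b is in the kernel of d, respectively a in the kernel of dᵗ.
  κ-ᵀ : ∀ {m n} (d : Mat m n) → pw m * κ d ≡ pw n * κ (d ᵀ)
  κ-ᵀ {m} {n} d = *-cancelˡ (Q - 1#) Q-1≢0 (begin
    (Q - 1#) * (pw m * κ d)
      ≡⟨ cong (λ k → (Q - 1#) * (pw m * k)) (κ-def d) ⟩
    (Q - 1#) * (pw m * ∑ (𝕧 n) (λ b → 𝟙 (d ⋆ b ≟ᵛ 0ᵛ)))
      ≡⟨ sym (half m n (λ b → d ⋆ b)) ⟩
    ∑ (𝕧 n) (λ b → ∑ (𝕧 m) (λ a → χ (0ᶠ -ᶠ bil a d b)))
      ≡⟨ ∑-swap (𝕧 n) (𝕧 m) _ ⟩
    ∑ (𝕧 m) (λ a → ∑ (𝕧 n) (λ b → χ (0ᶠ -ᶠ bil a d b)))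
      ≡⟨ ∑-cong (𝕧 m) (λ a → ∑-cong (𝕧 n) (λ b → cong (λ x → χ (0ᶠ -ᶠ x)) (sym (bil-ᵀ a d b)))) ⟩
    ∑ (𝕧 m) (λ a → ∑ (𝕧 n) (λ b → χ (0ᶠ -ᶠ bil b (d ᵀ) a)))
      ≡⟨ half n m (λ a → d ᵀ ⋆ a) ⟩
    (Q - 1#) * (pw n * ∑ (𝕧 m) (λ a → 𝟙 (d ᵀ ⋆ a ≟ᵛ 0ᵛ)))
      ≡⟨ cong (λ k → (Q - 1#) * (pw n * k)) (sym (κ-def (d ᵀ))) ⟩
    (Q - 1#) * (pw n * κ (d ᵀ)) ∎)
    where
    half : ∀ m n (h : 𝕍 n → 𝕍 m) → ∑ (𝕧 n) (λ b → ∑ (𝕧 m) (λ a → χ (0ᶠ -ᶠ a ∙ h b))) ≡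
           (Q - 1#) * (pw m * ∑ (𝕧 n) (λ b → 𝟙 (h b ≟ᵛ 0ᵛ)))
    half m n h = begin
      ∑ (𝕧 n) (λ b → ∑ (𝕧 m) (λ a → χ (0ᶠ -ᶠ a ∙ h b)))
        ≡⟨ ∑-cong (𝕧 n) (λ b → ∑-χ-∙ (h b) 0ᶠ) ⟩
      ∑ (𝕧 n) (λ b → 𝟙 (h b ≟ᵛ 0ᵛ) * (pw m * χ 0ᶠ))
        ≡⟨ ∑-*ʳ (𝕧 n) _ _ ⟩
      ∑ (𝕧 n) (λ b → 𝟙 (h b ≟ᵛ 0ᵛ)) * (pw m * χ 0ᶠ)
        ≡⟨ cong (λ x → ∑ (𝕧 n) (λ b → 𝟙 (h b ≟ᵛ 0ᵛ)) * (pw m * x)) χ-0 ⟩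
      ∑ (𝕧 n) (λ b → 𝟙 (h b ≟ᵛ 0ᵛ)) * (pw m * (Q - 1#))
        ≡⟨ solve 3 (λ k p q → k :* (p :* q) := q :* (p :* k)) refl _ (pw m) (Q - 1#) ⟩
      (Q - 1#) * (pw m * ∑ (𝕧 n) (λ b → 𝟙 (h b ≟ᵛ 0ᵛ))) ∎

  rank-ᵀ : ∀ {m n} (d : Mat m n) → rank (d ᵀ) ≡ rank d
  rank-ᵀ {m} {n} d = rank-unique (d ᵀ) (*-cancelˡ (pw n) (pw≢0 n) (begin
    pw n * (κ (d ᵀ) * pw (rank d)) ≡⟨ sym (*-assoc _ _ _) ⟩
    (pw n * κ (d ᵀ)) * pw (rank d) ≡⟨ cong (_* pw (rank d)) (sym (κ-ᵀ d)) ⟩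
    (pw m * κ d) * pw (rank d) ≡⟨ *-assoc _ _ _ ⟩
    pw m * (κ d * pw (rank d)) ≡⟨ cong (pw m *_) (κ-rank d) ⟩
    pw m * pw n ≡⟨ *-comm _ _ ⟩
    pw n * pw m                      ∎))

  ⋆-dyad : ∀ {m n} (d : Mat m n) s t b {c} → t ∙ b ≡ c → (d -ᴹ s ⊗ t) ⋆ b ≡ d ⋆ b -ᵛ c *ᵛ s
  ⋆-dyad d s t b refl = trans (⋆--ˡ d (s ⊗ t) b) (cong (d ⋆ b -ᵛ_) (⋆-⊗ s t b))

  -ᵛ-0 : ∀ {n} (u : 𝕍 n) → u -ᵛ 0ᵛ ≡ u
  -ᵛ-0 u = ∙-ext (λ a → trans (∙--ʳ a u 0ᵛ) (trans (cong (a ∙ u -ᶠ_) (∙-0ʳ a)) (minus-0 (a ∙ u))))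
    where
    minus-0 : ∀ c → c -ᶠ 0ᶠ ≡ c
    minus-0 = S.solve 1 (λ c → c S.:- S.:0 S.:= c) refl

  ⋆-dyad-0 : ∀ {m n} (d : Mat m n) s t b → t ∙ b ≡ 0ᶠ → (d -ᴹ s ⊗ t) ⋆ b ≡ d ⋆ b
  ⋆-dyad-0 d s t b tb = trans (⋆-dyad d s t b tb) (trans (cong (d ⋆ b -ᵛ_) (*ᵛ-0 s)) (-ᵛ-0 _))

  -- On the hyperplane t ∙ b = 0 the dyad vanishes. The effect of subtracting it on the rank thus
  -- depends only on whether t is free or dependent over each of the two matrices.
  κ-cons-dyad : ∀ {m n} (d : Mat m n) s t → κ (t ∷ (d -ᴹ s ⊗ t)) ≡ κ (t ∷ d)
  κ-cons-dyad d s t = κ-cong (t ∷ (d -ᴹ s ⊗ t)) (t ∷ d)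
    (λ b e → cong₂ _∷_ (cong Vec.head e) (trans (sym (⋆-dyad-0 d s t b (cong Vec.head e))) (cong Vec.tail e)))
    (λ b e → cong₂ _∷_ (cong Vec.head e) (trans (⋆-dyad-0 d s t b (cong Vec.head e)) (cong Vec.tail e)))

  module _ {m n} (d : Mat m n) (s : 𝕍 m) (t : 𝕍 n) where

    private
      e = d -ᴹ s ⊗ t

    κ-free-dependent : Free t e → Dependent t d → κ e ≡ Q * κ d
    κ-free-dependent free dep = trans (κ-free free) (cong (Q *_) (trans (κ-cons-dyad d s t) (sym (κ-dependent dep))))

    κ-dependent-free : Dependent t e → Free t d → κ d ≡ Q * κ e
    κ-dependent-free dep free = trans (κ-free free) (cong (Q *_) (trans (sym (κ-cons-dyad d s t)) (sym (κ-dependent dep))))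

    κ-both-dependent : Dependent t e → Dependent t d → κ e ≡ κ d
    κ-both-dependent dep dep′ = trans (κ-dependent dep) (trans (κ-cons-dyad d s t) (sym (κ-dependent dep′)))

    κ-both-free : Free t e → Free t d → κ e ≡ κ d
    κ-both-free free free′ = trans (κ-free free) (trans (cong (Q *_) (κ-cons-dyad d s t)) (sym (κ-free free′)))

    rank-dyad-cases : rank e ≡ rank d ⊎ rank d ≡ suc (rank e) ⊎ rank e ≡ suc (rank d)
    rank-dyad-cases with free⊎dependent t e | free⊎dependent t d
    ... | inj₁ f | inj₁ f′ = inj₁ (rank-cong e d (κ-both-free f f′))
    ... | inj₁ f | inj₂ p = inj₂ (inj₁ (rank-suc d e (κ-free-dependent f p)))
    ... | inj₂ p | inj₁ f = inj₂ (inj₂ (rank-suc e d (κ-dependent-free p f)))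
    ... | inj₂ p | inj₂ p′ = inj₁ (rank-cong e d (κ-both-dependent p p′))

    rank-dyad-bound : rank d ℕ.≤ suc (rank e)
    rank-dyad-bound with rank-dyad-cases
    ... | inj₁ h = ℕₚ.m≤n⇒m≤1+n (ℕₚ.≤-reflexive (sym h))
    ... | inj₂ (inj₁ h) = ℕₚ.≤-reflexive h
    ... | inj₂ (inj₂ h) = ℕₚ.m≤n⇒m≤1+n (ℕₚ.≤-trans (ℕₚ.n≤1+n _) (ℕₚ.≤-reflexive (sym h)))

    lowered⇒free : rank d ≡ suc (rank e) → Free t e
    lowered⇒free h with free⊎dependent t e | free⊎dependent t d
    ... | inj₁ f | _ = f
    ... | inj₂ p | inj₁ f = contradiction (trans (rank-suc e d (κ-dependent-free p f)) (cong suc h)) (ℕₚ.m≢1+n+m _)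
    ... | inj₂ p | inj₂ p′ = contradiction (trans (rank-cong e d (κ-both-dependent p p′)) h) (ℕₚ.m≢1+n+m _ {0})

    raised⇒free : rank e ≡ suc (rank d) → Free t d
    raised⇒free h with free⊎dependent t d | free⊎dependent t e
    ... | inj₁ f | _ = f
    ... | inj₂ p | inj₁ f = contradiction (trans (rank-suc d e (κ-free-dependent f p)) (cong suc h)) (ℕₚ.m≢1+n+m _)
    ... | inj₂ p | inj₂ p′ = contradiction (trans (sym (rank-cong e d (κ-both-dependent p′ p))) h) (ℕₚ.m≢1+n+m _ {0})

  -- Wedderburn's rank-reducing pairs.
  Lowers : ∀ {m n} → Mat m n → 𝕍 m → 𝕍 n → Set
  Lowers d s t = ∃₂ λ w r → d ⋆ w ≡ s × d ᵀ ⋆ r ≡ t × t ∙ w ≡ 1ᶠ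

  -- s lies outside the column space of d and t outside its row space.
  Raises : ∀ {m n} → Mat m n → 𝕍 m → 𝕍 n → Set
  Raises d s t = Free t d × Free s (d ᵀ)

  Lowers-dependent : ∀ {m n} {d : Mat m n} {t r} → d ᵀ ⋆ r ≡ t → Dependent t d
  Lowers-dependent {d = d} {r = r} refl b db = trans (ᵀ⋆-∙ d r b) (trans (cong (r ∙_) db) (∙-0ʳ r))

  rank-dyad-ᵀ : ∀ {m n} (d : Mat m n) s t → rank (d ᵀ -ᴹ t ⊗ s) ≡ rank (d -ᴹ s ⊗ t)
  rank-dyad-ᵀ d s t = trans (cong rank (sym (ᵀ-dyad d s t))) (rank-ᵀ (d -ᴹ s ⊗ t))

  -- The vector w is killed by d - s ⊗ t although t ∙ w = 1, so t is free over the difference; over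
  -- d it is dependent, being dᵗ r.
  lowers⇒rank : ∀ {m n} {d : Mat m n} {s t} → Lowers d s t → rank d ≡ suc (rank (d -ᴹ s ⊗ t))
  lowers⇒rank {d = d} {s} {t} (w , r , dw , dr , tw) = rank-suc d _ (κ-free-dependent d s t
    (w , trans (⋆-dyad d s t w tw) (trans (cong₂ _-ᵛ_ dw (*ᵛ-1 s)) (-ᵛ-self s)) , tw)
    (Lowers-dependent dr))

  private
    half-lowers : ∀ {m n} (d : Mat m n) s t → rank d ≡ suc (rank (d -ᴹ s ⊗ t)) → ∃ λ w → d ⋆ w ≡ s × t ∙ w ≡ 1ᶠ
    half-lowers d s t h with lowered⇒free d s t h
    ... | w , ew , tw = w , trans (-ᵛ≡0 (trans (sym (⋆-dyad d s t w tw)) ew)) (*ᵛ-1 s) , tw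

  -- A drop in rank makes t free over d - s ⊗ t, and the witness w of freeness satisfies d w = s.
  -- The same argument for the transpose yields r.
  rank⇒lowers : ∀ {m n} (d : Mat m n) s t → rank d ≡ suc (rank (d -ᴹ s ⊗ t)) → Lowers d s t
  rank⇒lowers d s t h = combine (half-lowers d s t h)
    (half-lowers (d ᵀ) t s (trans (rank-ᵀ d) (trans h (cong suc (sym (rank-dyad-ᵀ d s t))))))
    where
    combine : (∃ λ w → d ⋆ w ≡ s × t ∙ w ≡ 1ᶠ) → (∃ λ r → d ᵀ ⋆ r ≡ t × s ∙ r ≡ 1ᶠ) → Lowers d s t
    combine (w , dw , tw) (r , dr , _) = w , r , dw , dr , tw

  -- Some a has aᵗ d = 0 and a ∙ s = 1. Pairing (d - s ⊗ t) b = 0 with it gives t ∙ b = 0, so t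
  -- becomes dependent after the subtraction.
  raises⇒rank : ∀ {m n} {d : Mat m n} {s t} → Raises d s t → rank (d -ᴹ s ⊗ t) ≡ suc (rank d)
  raises⇒rank {d = d} {s} {t} (free , (a , da , sa)) = rank-suc _ d (κ-dependent-free d s t dep free)
    where
    dep : Dependent t (d -ᴹ s ⊗ t)
    dep b eb = begin
      t ∙ b ≡⟨ sym (Rᶠ.*-identityˡ _) ⟩
      1ᶠ *ᶠ (t ∙ b) ≡⟨ cong (_*ᶠ (t ∙ b)) (sym (trans (∙-comm a s) sa)) ⟩
      (a ∙ s) *ᶠ (t ∙ b) ≡⟨ sym (bil-⊗ a s t b) ⟩
      bil a (s ⊗ t) b ≡⟨ sym (-ᶠ≡0 (trans (sym (bil-- a d _ b)) (trans (cong (a ∙_) eb) (∙-0ʳ a)))) ⟩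
      bil a d b ≡⟨ sym (ᵀ⋆-∙ d a b) ⟩
      (d ᵀ ⋆ a) ∙ b ≡⟨ trans (cong (_∙ b) da) (∙-0ˡ b) ⟩
      0ᶠ                               ∎

  rank⇒raises : ∀ {m n} (d : Mat m n) s t → rank (d -ᴹ s ⊗ t) ≡ suc (rank d) → Raises d s t
  rank⇒raises d s t h = raised⇒free d s t h ,
    raised⇒free (d ᵀ) t s (trans (rank-dyad-ᵀ d s t) (trans h (cong suc (sym (rank-ᵀ d)))))

  -- Since rᵗ d = tᵗ and r ∙ s = 1, pairing (d - μ s ⊗ t) b with r gives (1 - μ)(t ∙ b). For μ ≠ 1
  -- this keeps t dependent, as it is over d.
  lowers-scaled : ∀ {m n} {d : Mat m n} {s t} → Lowers d s t → ∀ {μ} → μ ≢ 1ᶠ →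
    rank (d -ᴹ (μ *ᵛ s) ⊗ t) ≡ rank d
  lowers-scaled {d = d} {s} {t} (w , r , dw , dr , tw) {μ} μ≢1 =
    rank-cong _ d (κ-both-dependent d (μ *ᵛ s) t dep (Lowers-dependent dr))
    where
    rs : r ∙ s ≡ 1ᶠ
    rs = trans (cong (r ∙_) (sym dw)) (trans (sym (ᵀ⋆-∙ d r w)) (trans (cong (_∙ w) dr) tw))
    dep : Dependent t (d -ᴹ (μ *ᵛ s) ⊗ t)
    dep b eb = integralᶠ (λ e → μ≢1 (-ᶠ≡0 e)) (begin
      (μ -ᶠ 1ᶠ) *ᶠ (t ∙ b)
        ≡⟨ S.solve 2 (λ m x → (m S.:- S.:1) S.:* x S.:= (m S.:* S.:1) S.:* x S.:- x) refl μ (t ∙ b) ⟩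
      (μ *ᶠ 1ᶠ) *ᶠ (t ∙ b) -ᶠ t ∙ b
        ≡⟨ cong₂ (λ x y → (μ *ᶠ x) *ᶠ (t ∙ b) -ᶠ y) (sym rs) (trans (cong (_∙ b) (sym dr)) (ᵀ⋆-∙ d r b)) ⟩
      (μ *ᶠ (r ∙ s)) *ᶠ (t ∙ b) -ᶠ bil r d b
        ≡⟨ cong (_-ᶠ bil r d b) (trans (cong (_*ᶠ (t ∙ b)) (sym (∙-*ʳ r μ s))) (sym (bil-⊗ r _ t b))) ⟩
      bil r ((μ *ᵛ s) ⊗ t) b -ᶠ bil r d b
        ≡⟨ cong (_-ᶠ bil r d b) (sym (-ᶠ≡0 (trans (sym (bil-- r d _ b)) (trans (cong (r ∙_) eb) (∙-0ʳ r))))) ⟩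
      bil r d b -ᶠ bil r d b
        ≡⟨ Rᶠ.-‿inverseʳ _ ⟩
      0ᶠ ∎)

  nonzero-lowers : ∀ {m n} (d : Mat m n) → d ≢ 0ᴹ → ∃₂ (Lowers d)
  nonzero-lowers d d≢0 with nonzero-bil d d≢0
  ... | r , w , e = d ⋆ w , d ᵀ ⋆ r , w , r , refl , refl , trans (ᵀ⋆-∙ d r w) e

  rank≡0⇒≡0 : ∀ {m n} (d : Mat m n) → rank d ≡ 0 → d ≡ 0ᴹ
  rank≡0⇒≡0 d h = decide (d ≟ᴹ 0ᴹ)
    where
    decide : Dec (d ≡ 0ᴹ) → d ≡ 0ᴹ
    decide (yes e) = e
    decide (no d≢0) with nonzero-lowers d d≢0
    ... | s , t , l = contradiction (trans (sym (lowers⇒rank l)) h) λ ()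

  -ᴹ-self : ∀ {m n} (d : Mat m n) → d -ᴹ d ≡ 0ᴹ
  -ᴹ-self d = ⋆-ext (λ b → trans (⋆--ˡ d d b) (trans (-ᵛ-self _) (sym (⋆-0ˡ b))))

  -ᴹ≡0 : ∀ {m n} {d e : Mat m n} → d -ᴹ e ≡ 0ᴹ → d ≡ e
  -ᴹ≡0 {d = d} {e} h = ⋆-ext (λ b → -ᵛ≡0 (trans (sym (⋆--ˡ d e b)) (trans (cong (_⋆ b) h) (⋆-0ˡ b))))

  rank-⊗ : ∀ {m n} {s : 𝕍 m} {t : 𝕍 n} → s ≢ 0ᵛ → t ≢ 0ᵛ → rank (s ⊗ t) ≡ 1
  rank-⊗ {m} {n} {s} {t} s≢0 t≢0 with dual s s≢0 | dual t t≢0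
  ... | a , as | b , bt = trans (lowers⇒rank {d = s ⊗ t} {s} {t}
      (b , a , trans (⋆-⊗ s t b) (trans (cong (_*ᵛ s) tb) (*ᵛ-1 s)) ,
       ∙-ext (λ v → begin
         v ∙ ((s ⊗ t) ᵀ ⋆ a) ≡⟨ bil-ᵀ a (s ⊗ t) v ⟩
         bil a (s ⊗ t) v ≡⟨ bil-⊗ a s t v ⟩
         (a ∙ s) *ᶠ (t ∙ v) ≡⟨ cong₂ _*ᶠ_ as (∙-comm t v) ⟩
         1ᶠ *ᶠ (v ∙ t) ≡⟨ Rᶠ.*-identityˡ _ ⟩
         v ∙ t                    ∎) , tb))
      (cong suc (trans (cong rank (-ᴹ-self (s ⊗ t))) (rank-0 {m} {n})))
    where
    tb = trans (∙-comm t b) bt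

  ⊗-0ˡ : ∀ {m n} (t : 𝕍 n) → 0ᵛ {m} ⊗ t ≡ 0ᴹ
  ⊗-0ˡ t = bil-ext (λ a b → trans (bil-⊗ a 0ᵛ t b) (trans (cong (_*ᶠ (t ∙ b)) (∙-0ʳ a)) (trans (Rᶠ.zeroˡ _) (sym (bil-0 a b)))))

  ⊗-0ʳ : ∀ {m n} (s : 𝕍 m) → s ⊗ 0ᵛ {n} ≡ 0ᴹ
  ⊗-0ʳ s = bil-ext (λ a b → trans (bil-⊗ a s 0ᵛ b) (trans (cong ((a ∙ s) *ᶠ_) (∙-0ˡ b)) (trans (Rᶠ.zeroʳ _) (sym (bil-0 a b)))))

  -- A normalised entry rᵗ d w = 1 gives the lowering dyad (d w)(rᵗ d); subtracting it leaves rank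
  -- 0, that is, the zero matrix.
  rank≡1⇒dyad : ∀ {m n} (d : Mat m n) → rank d ≡ 1 → ∃₂ λ s t → s ≢ 0ᵛ × t ≢ 0ᵛ × d ≡ s ⊗ t
  rank≡1⇒dyad {m} {n} d h = decide (d ≟ᴹ 0ᴹ)
    where
    d≢0 : d ≢ 0ᴹ
    d≢0 refl = contradiction (trans (sym (rank-0 {m} {n})) h) λ ()
    decide : Dec (d ≡ 0ᴹ) → ∃₂ λ s t → s ≢ 0ᵛ × t ≢ 0ᵛ × d ≡ s ⊗ t
    decide (yes d≡0) = contradiction d≡0 d≢0
    decide (no d≢0) with nonzero-lowers d d≢0
    ... | s , t , l@(w , r , dw , dr , tw) = s , t , s≢0 , t≢0 , d≡
      where
      d≡ : d ≡ s ⊗ t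
      d≡ = -ᴹ≡0 (rank≡0⇒≡0 _ (ℕₚ.suc-injective (trans (sym (lowers⇒rank l)) h)))
      s≢0 : s ≢ 0ᵛ
      s≢0 e = d≢0 (trans d≡ (trans (cong (_⊗ t) e) (⊗-0ˡ t)))
      t≢0 : t ≢ 0ᵛ
      t≢0 e = d≢0 (trans d≡ (trans (cong (s ⊗_) e) (⊗-0ʳ s)))

-- Counting dyad representations, character sums over dyads, and adjacency of dyads.

module Dyads (K : CharacteristicZeroDomain) (F : FiniteField) where

  open Rank K F public
  open ≡-Reasoning

  private
    module Rᶠ = CommutativeRing ringᶠ
    module S = IntegerSolver ringᶠ

  -- A rank-one matrix is a dyad in Q - 1 ways, the zero matrix in R ways.
  R : ℕ → ℕ → Carrier
  R m n = pw m + pw n - 1#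

  ⊗≡0 : ∀ {m n} {s : 𝕍 m} {t : 𝕍 n} → s ≢ 0ᵛ → s ⊗ t ≡ 0ᴹ → t ≡ 0ᵛ
  ⊗≡0 {s = s} {t} s≢0 e with dual s s≢0
  ... | a , as = ∙-ext (λ b → begin
    b ∙ t ≡⟨ ∙-comm b t ⟩
    t ∙ b ≡⟨ sym (Rᶠ.*-identityˡ _) ⟩
    1ᶠ *ᶠ (t ∙ b) ≡⟨ cong (_*ᶠ (t ∙ b)) (sym as) ⟩
    (a ∙ s) *ᶠ (t ∙ b) ≡⟨ sym (bil-⊗ a s t b) ⟩
    bil a (s ⊗ t) b ≡⟨ cong (λ d → bil a d b) e ⟩
    bil a 0ᴹ b ≡⟨ trans (bil-0 a b) (sym (∙-0ʳ b)) ⟩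
    b ∙ 0ᵛ                   ∎)

  scale-⊗ : ∀ {m n} c e (s : 𝕍 m) (t : 𝕍 n) → c *ᶠ e ≡ 1ᶠ → (c *ᵛ s) ⊗ (e *ᵛ t) ≡ s ⊗ t
  scale-⊗ c e s t ce = matrix-identity ((c *ᵛ s) ⊡ (e *ᵛ t)) (s ⊡ t) (λ a b → begin
    (a ∙ (c *ᵛ s)) *ᶠ ((e *ᵛ t) ∙ b) ≡⟨ cong₂ _*ᶠ_ (∙-*ʳ a c s) (∙-*ˡ e t b) ⟩
    (c *ᶠ (a ∙ s)) *ᶠ (e *ᶠ (t ∙ b)) ≡⟨ S.solve 4 (λ c e x y → (c S.:* x) S.:* (e S.:* y) S.:= (c S.:* e) S.:* (x S.:* y)) refl c e _ _ ⟩
    (c *ᶠ e) *ᶠ ((a ∙ s) *ᶠ (t ∙ b)) ≡⟨ trans (cong (_*ᶠ ((a ∙ s) *ᶠ (t ∙ b))) ce) (Rᶠ.*-identityˡ _) ⟩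
    (a ∙ s) *ᶠ (t ∙ b)                           ∎)

  ⊗-slide : ∀ {m n} μ (s : 𝕍 m) (t : 𝕍 n) → (μ *ᵛ s) ⊗ t ≡ s ⊗ (μ *ᵛ t)
  ⊗-slide μ s t = matrix-identity ((μ *ᵛ s) ⊡ t) (s ⊡ (μ *ᵛ t)) (λ a b → begin
    (a ∙ (μ *ᵛ s)) *ᶠ (t ∙ b) ≡⟨ cong (_*ᶠ (t ∙ b)) (∙-*ʳ a μ s) ⟩
    (μ *ᶠ (a ∙ s)) *ᶠ (t ∙ b) ≡⟨ S.solve 3 (λ m x y → (m S.:* x) S.:* y S.:= x S.:* (m S.:* y)) refl μ _ _ ⟩
    (a ∙ s) *ᶠ (μ *ᶠ (t ∙ b)) ≡⟨ cong ((a ∙ s) *ᶠ_) (sym (∙-*ˡ μ t b)) ⟩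
    (a ∙ s) *ᶠ ((μ *ᵛ t) ∙ b)            ∎)

  ⊗--ʳ : ∀ {m n} (s : 𝕍 m) (t t′ : 𝕍 n) → s ⊗ t -ᴹ s ⊗ t′ ≡ s ⊗ (t -ᵛ t′)
  ⊗--ʳ s t t′ = matrix-identity (s ⊡ t ⊟ s ⊡ t′) (s ⊡ (t -ᵛ t′)) (λ a b → trans
    (S.solve 3 (λ x y z → x S.:* y S.:- x S.:* z S.:= x S.:* (y S.:- z)) refl _ _ _) (cong ((a ∙ s) *ᶠ_) (sym (∙--ˡ t t′ b))))

  ⊗--ˡ : ∀ {m n} (s s′ : 𝕍 m) (t : 𝕍 n) → s ⊗ t -ᴹ s′ ⊗ t ≡ (s -ᵛ s′) ⊗ t
  ⊗--ˡ s s′ t = matrix-identity (s ⊡ t ⊟ s′ ⊡ t) ((s -ᵛ s′) ⊡ t) (λ a b → trans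
    (S.solve 3 (λ x z y → x S.:* y S.:- z S.:* y S.:= (x S.:- z) S.:* y) refl _ _ _) (cong (_*ᶠ (t ∙ b)) (sym (∙--ʳ a s s′))))

  *ᵛ-inverse : ∀ {n c e} {u v : 𝕍 n} → e *ᶠ c ≡ 1ᶠ → c *ᵛ u ≡ v → u ≡ e *ᵛ v
  *ᵛ-inverse {c = c} {e} {u} ec refl = sym (trans (*ᵛ-assoc e c u) (trans (cong (_*ᵛ u) ec) (*ᵛ-1 u)))

  module _ {m n : ℕ} where

    dyadCount : Mat m n → Carrier
    dyadCount w = ∑ (𝕧 m) (λ s → ∑ (𝕧 n) (λ t → 𝟙 (s ⊗ t ≟ᴹ w)))

    dyadCount-0 : dyadCount 0ᴹ ≡ R m n
    dyadCount-0 = begin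
      ∑ (𝕧 m) (λ s → ∑ (𝕧 n) (λ t → 𝟙 (s ⊗ t ≟ᴹ 0ᴹ)))
        ≡⟨ ∑-cong (𝕧 m) (λ s → trans (∑-cong (𝕧 n) (λ t → pointwise (s ≟ᵛ 0ᵛ) (t ≟ᵛ 0ᵛ)))
             (trans (∑-+ (𝕧 n) _ _) (cong₂ _+_
               (trans (∑-const (𝕧 n) _) (cong (_* 𝟙 (s ≟ᵛ 0ᵛ)) (∑1-𝕍 n)))
               (trans (∑-*ˡ (𝕧 n) _ _) (trans (cong ((1# - 𝟙 (s ≟ᵛ 0ᵛ)) *_) (∑-𝟙≡ (𝕧 n) 0ᵛ)) (*-identityʳ _)))))) ⟩
      ∑ (𝕧 m) (λ s → pw n * 𝟙 (s ≟ᵛ 0ᵛ) + (1# - 𝟙 (s ≟ᵛ 0ᵛ)))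
        ≡⟨ trans (∑-+ (𝕧 m) _ _) (cong₂ _+_
             (trans (∑-*ˡ (𝕧 m) _ _) (trans (cong (pw n *_) (∑-𝟙≡ (𝕧 m) 0ᵛ)) (*-identityʳ _)))
             (trans (∑-- (𝕧 m) _ _) (cong₂ _-_ (∑1-𝕍 m) (∑-𝟙≡ (𝕧 m) 0ᵛ)))) ⟩
      pw n + (pw m - 1#)
        ≡⟨ solve 2 (λ x y → y :+ (x :- :1) := (x :+ y) :- :1) refl (pw m) (pw n) ⟩
      R m n ∎
      where
      pointwise : ∀ {s t} (p : Dec (s ≡ 0ᵛ)) (r : Dec (t ≡ 0ᵛ)) →
        𝟙 (s ⊗ t ≟ᴹ 0ᴹ) ≡ 𝟙 p + (1# - 𝟙 p) * 𝟙 r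
      pointwise {t = t} (yes refl) r = trans (𝟙-yes (0ᵛ {m} ⊗ t ≟ᴹ 0ᴹ) (⊗-0ˡ t))
        (solve 1 (λ x → :1 := :1 :+ (:1 :- :1) :* x) refl (𝟙 r))
      pointwise {s} (no _) (yes refl) = trans (𝟙-yes (s ⊗ 0ᵛ {n} ≟ᴹ 0ᴹ) (⊗-0ʳ s))
        (solve 0 (:1 := :0 :+ (:1 :- :0) :* :1) refl)
      pointwise {s} {t} (no s≢0) (no t≢0) = trans (𝟙-no (s ⊗ t ≟ᴹ 0ᴹ) (λ e → t≢0 (⊗≡0 s≢0 e)))
        (solve 0 (:0 := :0 :+ (:1 :- :0) :* :0) refl)

    -- A representation s ⊗ t of s₀ ⊗ t₀ is determined by c = t ∙ b₀: the value 0 is impossible, and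
    -- every c ≠ 0 forces s = c⁻¹ s₀ and t = c t₀.
    dyadCount-⊗ : ∀ {s₀ t₀} → s₀ ≢ 0ᵛ → t₀ ≢ 0ᵛ → dyadCount (s₀ ⊗ t₀) ≡ Q - 1#
    dyadCount-⊗ {s₀} {t₀} s₀≢0 t₀≢0 with dual s₀ s₀≢0 | dual t₀ t₀≢0
    ... | a₀ , a₀s₀ | b₀ , b₀t₀ = begin
      ∑ (𝕧 m) (λ s → ∑ (𝕧 n) (λ t → 𝟙 (s ⊗ t ≟ᴹ s₀ ⊗ t₀)))
        ≡⟨ ∑-cong (𝕧 m) (λ s → ∑-fibres (𝕧 n) 𝕗 (_∙ b₀) _) ⟩
      ∑ (𝕧 m) (λ s → ∑ 𝕗 (λ c → ∑ (𝕧 n) (λ t → 𝟙 (t ∙ b₀ ≟ᶠ c) * 𝟙 (s ⊗ t ≟ᴹ s₀ ⊗ t₀))))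
        ≡⟨ ∑-swap (𝕧 m) 𝕗 _ ⟩
      ∑ 𝕗 (λ c → ∑ (𝕧 m) (λ s → ∑ (𝕧 n) (λ t → 𝟙 (t ∙ b₀ ≟ᶠ c) * 𝟙 (s ⊗ t ≟ᴹ s₀ ⊗ t₀))))
        ≡⟨ ∑-cong 𝕗 (λ c → fibre c (c ≟ᶠ 0ᶠ)) ⟩
      ∑ 𝕗 (λ c → 1# - 𝟙 (c ≟ᶠ 0ᶠ))
        ≡⟨ trans (∑-- 𝕗 _ _) (cong₂ _-_ ∑1-𝔽 (∑-𝟙≡ 𝕗 0ᶠ)) ⟩
      Q - 1# ∎
      where
      factor : ∀ {s t} → s ⊗ t ≡ s₀ ⊗ t₀ → (t ∙ b₀) *ᵛ s ≡ s₀
      factor {s} {t} e = begin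
        (t ∙ b₀) *ᵛ s ≡⟨ sym (⋆-⊗ s t b₀) ⟩
        (s ⊗ t) ⋆ b₀ ≡⟨ cong (_⋆ b₀) e ⟩
        (s₀ ⊗ t₀) ⋆ b₀ ≡⟨ ⋆-⊗ s₀ t₀ b₀ ⟩
        (t₀ ∙ b₀) *ᵛ s₀ ≡⟨ cong (_*ᵛ s₀) (trans (∙-comm t₀ b₀) b₀t₀) ⟩
        1ᶠ *ᵛ s₀ ≡⟨ *ᵛ-1 s₀ ⟩
        s₀                     ∎
      cofactor : ∀ {s t} → s ⊗ t ≡ s₀ ⊗ t₀ → (a₀ ∙ s) *ᵛ t ≡ t₀
      cofactor {s} {t} e = ∙-ext (λ b → begin
        b ∙ ((a₀ ∙ s) *ᵛ t) ≡⟨ trans (∙-*ʳ b _ t) (cong ((a₀ ∙ s) *ᶠ_) (∙-comm b t)) ⟩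
        (a₀ ∙ s) *ᶠ (t ∙ b) ≡⟨ sym (bil-⊗ a₀ s t b) ⟩
        bil a₀ (s ⊗ t) b ≡⟨ cong (λ d → bil a₀ d b) e ⟩
        bil a₀ (s₀ ⊗ t₀) b ≡⟨ bil-⊗ a₀ s₀ t₀ b ⟩
        (a₀ ∙ s₀) *ᶠ (t₀ ∙ b) ≡⟨ cong₂ _*ᶠ_ a₀s₀ (∙-comm t₀ b) ⟩
        1ᶠ *ᶠ (b ∙ t₀) ≡⟨ Rᶠ.*-identityˡ _ ⟩
        b ∙ t₀                         ∎)
      fibre : ∀ c (p : Dec (c ≡ 0ᶠ)) →
        ∑ (𝕧 m) (λ s → ∑ (𝕧 n) (λ t → 𝟙 (t ∙ b₀ ≟ᶠ c) * 𝟙 (s ⊗ t ≟ᴹ s₀ ⊗ t₀))) ≡ 1# - 𝟙 p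
      fibre c (yes refl) = trans (∑-vanish (𝕧 m) (λ s → ∑-vanish (𝕧 n) (λ t → trans
          (𝟙-guard (t ∙ b₀ ≟ᶠ 0ᶠ) (λ tb → 𝟙-no (s ⊗ t ≟ᴹ s₀ ⊗ t₀) (λ e → s₀≢0
            (trans (sym (factor e)) (trans (cong (_*ᵛ s) tb) (*ᵛ-0 s))))))
          (zeroʳ _))))
        (solve 0 (:0 := :1 :- :1) refl)
      fibre c (no c≢0) with inverse c c≢0
      ... | e , ce = begin
        ∑ (𝕧 m) (λ s → ∑ (𝕧 n) (λ t → 𝟙 (t ∙ b₀ ≟ᶠ c) * 𝟙 (s ⊗ t ≟ᴹ s₀ ⊗ t₀)))
          ≡⟨ ∑-cong (𝕧 m) (λ s → ∑-cong (𝕧 n) (λ t → trans (sym (𝟙-× (t ∙ b₀ ≟ᶠ c) (s ⊗ t ≟ᴹ s₀ ⊗ t₀)))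
               (trans (𝟙-cong ((t ∙ b₀ ≟ᶠ c) ×-dec (s ⊗ t ≟ᴹ s₀ ⊗ t₀)) ((s ≟ᵛ e *ᵛ s₀) ×-dec (t ≟ᵛ c *ᵛ t₀)) to from)
                 (𝟙-× (s ≟ᵛ e *ᵛ s₀) (t ≟ᵛ c *ᵛ t₀))))) ⟩
        ∑ (𝕧 m) (λ s → ∑ (𝕧 n) (λ t → 𝟙 (s ≟ᵛ e *ᵛ s₀) * 𝟙 (t ≟ᵛ c *ᵛ t₀)))
          ≡⟨ ∑-cong (𝕧 m) (λ s → trans (∑-*ˡ (𝕧 n) _ _) (cong (𝟙 (s ≟ᵛ e *ᵛ s₀) *_) (∑-𝟙≡ (𝕧 n) (c *ᵛ t₀)))) ⟩
        ∑ (𝕧 m) (λ s → 𝟙 (s ≟ᵛ e *ᵛ s₀) * 1#)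
          ≡⟨ sift (𝕧 m) (e *ᵛ s₀) (λ _ → 1#) ⟩
        1#
          ≡⟨ solve 0 (:1 := :1 :- :0) refl ⟩
        1# - 0# ∎
        where
        ec = trans (Rᶠ.*-comm e c) ce
        to : ∀ {s t} → (t ∙ b₀ ≡ c) × (s ⊗ t ≡ s₀ ⊗ t₀) → (s ≡ e *ᵛ s₀) × (t ≡ c *ᵛ t₀)
        to {s} {t} (tb , h) = s≡ , *ᵛ-inverse {c = e} {c} {t} {t₀} ce (trans (cong (_*ᵛ t) (sym as)) (cofactor h))
          where
          s≡ = *ᵛ-inverse {c = c} {e} {s} {s₀} ec (trans (cong (_*ᵛ s) (sym tb)) (factor h))
          as : a₀ ∙ s ≡ e
          as = trans (cong (a₀ ∙_) s≡) (trans (∙-*ʳ a₀ e s₀) (trans (cong (e *ᶠ_) a₀s₀) (Rᶠ.*-identityʳ e)))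
        from : ∀ {s t} → (s ≡ e *ᵛ s₀) × (t ≡ c *ᵛ t₀) → (t ∙ b₀ ≡ c) × (s ⊗ t ≡ s₀ ⊗ t₀)
        from (refl , refl) = trans (∙-*ˡ c t₀ b₀) (trans (cong (c *ᶠ_) (trans (∙-comm t₀ b₀) b₀t₀)) (Rᶠ.*-identityʳ c)) ,
          scale-⊗ e c s₀ t₀ ec

    dyadCount-≡ : ∀ w → dyadCount w ≡ (Q - 1#) * 𝟙 (rank w ℕ.≟ 1) + R m n * 𝟙 (w ≟ᴹ 0ᴹ)
    dyadCount-≡ w = decide (w ≟ᴹ 0ᴹ) (rank w ℕ.≟ 1)
      where
      decide : (p : Dec (w ≡ 0ᴹ)) (r : Dec (rank w ≡ 1)) → dyadCount w ≡ (Q - 1#) * 𝟙 r + R m n * 𝟙 p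
      decide (yes refl) (yes h) = contradiction (trans (sym (rank-0 {m} {n})) h) λ ()
      decide (yes refl) (no _) = trans dyadCount-0
        (solve 2 (λ q r → r := (q :- :1) :* :0 :+ r :* :1) refl Q (R m n))
      decide (no _) (yes h) with rank≡1⇒dyad w h
      ... | s , t , s≢0 , t≢0 , refl = trans (dyadCount-⊗ s≢0 t≢0)
        (solve 2 (λ q r → (q :- :1) := (q :- :1) :* :1 :+ r :* :0) refl Q (R m n))
      decide (no w≢0) (no h) = trans
        (∑-vanish (𝕧 m) (λ s → ∑-vanish (𝕧 n) (λ t → 𝟙-no (s ⊗ t ≟ᴹ w) (λ e → h (trans (cong rank (sym e))
          (rank-⊗ (λ s≡0 → w≢0 (trans (sym e) (trans (cong (_⊗ t) s≡0) (⊗-0ˡ t))))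
                  (λ t≡0 → w≢0 (trans (sym e) (trans (cong (s ⊗_) t≡0) (⊗-0ʳ s))))))))))
        (solve 2 (λ q r → :0 := (q :- :1) :* :0 :+ r :* :0) refl Q (R m n))

    -- Trades a sum over matrices of rank one for an unrestricted sum over pairs of vectors, where
    -- orthogonality applies one vector at a time.
    ∑∑-⊗ : ∀ (g : Mat m n → Carrier) → ∑ (𝕧 m) (λ s → ∑ (𝕧 n) (λ t → g (s ⊗ t))) ≡
      (Q - 1#) * ∑ (𝕞 m n) (λ w → 𝟙 (rank w ℕ.≟ 1) * g w) + R m n * g 0ᴹ
    ∑∑-⊗ g = begin
      ∑ (𝕧 m) (λ s → ∑ (𝕧 n) (λ t → g (s ⊗ t)))
        ≡⟨ ∑-cong (𝕧 m) (λ s → ∑-cong (𝕧 n) (λ t → sym (sift′ (𝕞 m n) (s ⊗ t) g))) ⟩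
      ∑ (𝕧 m) (λ s → ∑ (𝕧 n) (λ t → ∑ (𝕞 m n) (λ w → 𝟙 (s ⊗ t ≟ᴹ w) * g w)))
        ≡⟨ ∑-cong (𝕧 m) (λ s → ∑-swap (𝕧 n) (𝕞 m n) _) ⟩
      ∑ (𝕧 m) (λ s → ∑ (𝕞 m n) (λ w → ∑ (𝕧 n) (λ t → 𝟙 (s ⊗ t ≟ᴹ w) * g w)))
        ≡⟨ ∑-swap (𝕧 m) (𝕞 m n) _ ⟩
      ∑ (𝕞 m n) (λ w → ∑ (𝕧 m) (λ s → ∑ (𝕧 n) (λ t → 𝟙 (s ⊗ t ≟ᴹ w) * g w)))
        ≡⟨ ∑-cong (𝕞 m n) (λ w → trans (∑-cong (𝕧 m) (λ s → ∑-*ʳ (𝕧 n) _ (g w))) (∑-*ʳ (𝕧 m) _ (g w))) ⟩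
      ∑ (𝕞 m n) (λ w → dyadCount w * g w)
        ≡⟨ ∑-cong (𝕞 m n) (λ w → trans (cong (_* g w) (dyadCount-≡ w))
             (solve 5 (λ q i r j g → (q :* i :+ r :* j) :* g := q :* (i :* g) :+ r :* (j :* g)) refl (Q - 1#) _ (R m n) _ (g w))) ⟩
      ∑ (𝕞 m n) (λ w → (Q - 1#) * (𝟙 (rank w ℕ.≟ 1) * g w) + R m n * (𝟙 (w ≟ᴹ 0ᴹ) * g w))
        ≡⟨ trans (∑-+ (𝕞 m n) _ _) (cong₂ _+_ (∑-*ˡ (𝕞 m n) _ _)
             (trans (∑-*ˡ (𝕞 m n) _ _) (cong (R m n *_) (sift (𝕞 m n) 0ᴹ g)))) ⟩
      (Q - 1#) * ∑ (𝕞 m n) (λ w → 𝟙 (rank w ℕ.≟ 1) * g w) + R m n * g 0ᴹ ∎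

    -- The sum over s vanishes unless t is in the kernel of d. This evaluates both the eigenvalues,
    -- with B as d, and the entries of E.
    ∑∑-χ : ∀ (d : Mat m n) c → ∑ (𝕧 m) (λ s → ∑ (𝕧 n) (λ t → χ (c -ᶠ bil s d t))) ≡ (pw m * κ d) * χ c
    ∑∑-χ d c = begin
      ∑ (𝕧 m) (λ s → ∑ (𝕧 n) (λ t → χ (c -ᶠ bil s d t))) ≡⟨ ∑-swap (𝕧 m) (𝕧 n) _ ⟩
      ∑ (𝕧 n) (λ t → ∑ (𝕧 m) (λ s → χ (c -ᶠ bil s d t))) ≡⟨ ∑-cong (𝕧 n) (λ t → ∑-χ-∙ (d ⋆ t) c) ⟩
      ∑ (𝕧 n) (λ t → 𝟙 (d ⋆ t ≟ᵛ 0ᵛ) * (pw m * χ c)) ≡⟨ ∑-*ʳ (𝕧 n) _ _ ⟩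
      ∑ (𝕧 n) (λ t → 𝟙 (d ⋆ t ≟ᵛ 0ᵛ)) * (pw m * χ c) ≡⟨ cong (_* (pw m * χ c)) (sym (κ-def d)) ⟩
      κ d * (pw m * χ c) ≡⟨ solve 3 (λ k p x → k :* (p :* x) := (p :* k) :* x) refl (κ d) (pw m) (χ c) ⟩
      (pw m * κ d) * χ c                                    ∎

    -- The scalar may be zero, which admits s′ = 0 or t′ = 0.
    Shares : 𝕍 m → 𝕍 n → 𝕍 m → 𝕍 n → Set
    Shares s t s′ t′ = (∃ λ c → s′ ≡ c *ᵛ s) ⊎ (∃ λ c → t′ ≡ c *ᵛ t)

    rank-⊗≤1 : ∀ (s : 𝕍 m) (t : 𝕍 n) → rank (s ⊗ t) ℕ.≤ 1
    rank-⊗≤1 s t = decide (s ≟ᵛ 0ᵛ) (t ≟ᵛ 0ᵛ)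
      where
      zero≤ : s ⊗ t ≡ 0ᴹ → rank (s ⊗ t) ℕ.≤ 1
      zero≤ e = ℕₚ.≤-trans (ℕₚ.≤-reflexive (trans (cong rank e) (rank-0 {m} {n}))) ℕ.z≤n
      decide : Dec (s ≡ 0ᵛ) → Dec (t ≡ 0ᵛ) → rank (s ⊗ t) ℕ.≤ 1
      decide (yes e) _ = zero≤ (trans (cong (_⊗ t) e) (⊗-0ˡ t))
      decide (no _) (yes e) = zero≤ (trans (cong (s ⊗_) e) (⊗-0ʳ s))
      decide (no p) (no r) = ℕₚ.≤-reflexive (rank-⊗ p r)

    rank≤1⇒dyad : ∀ (d : Mat m n) → rank d ℕ.≤ 1 → ∃₂ λ p u → d ≡ p ⊗ u
    rank≤1⇒dyad d h with rank d in e
    ... | 0 = 0ᵛ , 0ᵛ , trans (rank≡0⇒≡0 d e) (sym (⊗-0ˡ 0ᵛ))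
    ... | 1 = let (p , u , _ , _ , eq) = rank≡1⇒dyad d e in p , u , eq
    ... | suc (suc _) = contradiction h λ { (ℕ.s≤s ()) }

    module _ {s s′ : 𝕍 m} {t t′ : 𝕍 n} where

      private
        bil-diff : ∀ a b → bil a (s ⊗ t -ᴹ s′ ⊗ t′) b ≡ (a ∙ s) *ᶠ (t ∙ b) -ᶠ (a ∙ s′) *ᶠ (t′ ∙ b)
        bil-diff a b = trans (bil-- a _ _ b) (cong₂ _-ᶠ_ (bil-⊗ a s t b) (bil-⊗ a s′ t′ b))

      shares⇒rank≤1 : Shares s t s′ t′ → rank (s ⊗ t -ᴹ s′ ⊗ t′) ℕ.≤ 1
      shares⇒rank≤1 (inj₁ (c , refl)) = subst (λ d → rank d ℕ.≤ 1)
        (sym (trans (cong (s ⊗ t -ᴹ_) (⊗-slide c s t′)) (⊗--ʳ s t (c *ᵛ t′)))) (rank-⊗≤1 s (t -ᵛ c *ᵛ t′))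
      shares⇒rank≤1 (inj₂ (c , refl)) = subst (λ d → rank d ℕ.≤ 1)
        (sym (trans (cong (s ⊗ t -ᴹ_) (sym (⊗-slide c s′ t))) (⊗--ˡ s (c *ᵛ s′) t))) (rank-⊗≤1 (s -ᵛ c *ᵛ s′) t)

      -- If s and s′ are independent then a 2×2 minor of s ⊗ t - s′ ⊗ t′ is, up to sign, a 2×2 minor of t and t′.
      rank≤1⇒shares : s ≢ 0ᵛ → t ≢ 0ᵛ → rank (s ⊗ t -ᴹ s′ ⊗ t′) ℕ.≤ 1 → Shares s t s′ t′
      rank≤1⇒shares s≢0 t≢0 h = combine (dual s s≢0) (dual t t≢0) (rank≤1⇒dyad (s ⊗ t -ᴹ s′ ⊗ t′) h)
        where
        combine : (∃ λ a → a ∙ s ≡ 1ᶠ) → (∃ λ b → b ∙ t ≡ 1ᶠ) →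
          (∃₂ λ p u → s ⊗ t -ᴹ s′ ⊗ t′ ≡ p ⊗ u) → Shares s t s′ t′
        combine (a , as) (b , bt) (p , u , e) = decide (s′ -ᵛ (a ∙ s′) *ᵛ s ≟ᵛ 0ᵛ)
          where
          entry : ∀ a b → (a ∙ s) *ᶠ (t ∙ b) -ᶠ (a ∙ s′) *ᶠ (t′ ∙ b) ≡ (a ∙ p) *ᶠ (u ∙ b)
          entry a b = trans (sym (bil-diff a b)) (trans (cong (λ d → bil a d b) e) (bil-⊗ a p u b))
          decide : Dec (s′ -ᵛ (a ∙ s′) *ᵛ s ≡ 0ᵛ) → Shares s t s′ t′
          decide (yes z) = inj₁ (a ∙ s′ , -ᵛ≡0 z)
          decide (no z) with dual _ z
          ... | a′ , a′z = inj₂ (t′ ∙ b , ∙-ext (λ b′ → begin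
            b′ ∙ t′
              ≡⟨ ∙-comm b′ t′ ⟩
            t′ ∙ b′
              ≡⟨ -ᶠ≡0 (minor b′) ⟩
            (t′ ∙ b) *ᶠ (t ∙ b′)
              ≡⟨ cong ((t′ ∙ b) *ᶠ_) (∙-comm t b′) ⟩
            (t′ ∙ b) *ᶠ (b′ ∙ t)
              ≡⟨ sym (∙-*ʳ b′ _ t) ⟩
            b′ ∙ ((t′ ∙ b) *ᵛ t) ∎))
            where
            -- The minor of s and s′ in the directions a and a′ is normalised to 1. The solver
            -- identity below is the Cauchy-Binet formula for the directions a, a′ and b, b′; the
            -- minor of the dyad p ⊗ u vanishes.
            α : a′ ∙ s′ -ᶠ (a ∙ s′) *ᶠ (a′ ∙ s) ≡ 1ᶠ
            α = trans (sym (trans (∙--ʳ a′ s′ _) (cong (a′ ∙ s′ -ᶠ_) (∙-*ʳ a′ _ s)))) a′z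
            minor : ∀ b′ → t′ ∙ b′ -ᶠ (t′ ∙ b) *ᶠ (t ∙ b′) ≡ 0ᶠ
            minor b′ = begin
              t′ ∙ b′ -ᶠ (t′ ∙ b) *ᶠ (t ∙ b′)
                ≡⟨ sym (Rᶠ.*-identityˡ _) ⟩
              1ᶠ *ᶠ (t′ ∙ b′ -ᶠ (t′ ∙ b) *ᶠ (t ∙ b′))
                ≡⟨ cong (_*ᶠ (t′ ∙ b′ -ᶠ (t′ ∙ b) *ᶠ (t ∙ b′))) (sym α) ⟩
              (a′ ∙ s′ -ᶠ (a ∙ s′) *ᶠ (a′ ∙ s)) *ᶠ (t′ ∙ b′ -ᶠ (t′ ∙ b) *ᶠ (t ∙ b′))
                ≡⟨ S.solve 6 (λ x′ y x v′ v w →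
                     (x′ S.:- y S.:* x) S.:* (v′ S.:- v S.:* w) S.:=
                     (S.:1 S.:* w S.:- y S.:* v′) S.:* (x S.:* S.:1 S.:- x′ S.:* v)
                       S.:- (S.:1 S.:* S.:1 S.:- y S.:* v) S.:* (x S.:* w S.:- x′ S.:* v′))
                   refl (a′ ∙ s′) (a ∙ s′) (a′ ∙ s) (t′ ∙ b′) (t′ ∙ b) (t ∙ b′) ⟩
              (1ᶠ *ᶠ (t ∙ b′) -ᶠ (a ∙ s′) *ᶠ (t′ ∙ b′)) *ᶠ ((a′ ∙ s) *ᶠ 1ᶠ -ᶠ (a′ ∙ s′) *ᶠ (t′ ∙ b))
                -ᶠ (1ᶠ *ᶠ 1ᶠ -ᶠ (a ∙ s′) *ᶠ (t′ ∙ b)) *ᶠ ((a′ ∙ s) *ᶠ (t ∙ b′) -ᶠ (a′ ∙ s′) *ᶠ (t′ ∙ b′))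
                ≡⟨ cong₂ (λ x y → (x *ᶠ (t ∙ b′) -ᶠ (a ∙ s′) *ᶠ (t′ ∙ b′)) *ᶠ ((a′ ∙ s) *ᶠ y -ᶠ (a′ ∙ s′) *ᶠ (t′ ∙ b))
                     -ᶠ (x *ᶠ y -ᶠ (a ∙ s′) *ᶠ (t′ ∙ b)) *ᶠ ((a′ ∙ s) *ᶠ (t ∙ b′) -ᶠ (a′ ∙ s′) *ᶠ (t′ ∙ b′)))
                     (sym as) (trans (sym bt) (∙-comm b t)) ⟩
              ((a ∙ s) *ᶠ (t ∙ b′) -ᶠ (a ∙ s′) *ᶠ (t′ ∙ b′)) *ᶠ ((a′ ∙ s) *ᶠ (t ∙ b) -ᶠ (a′ ∙ s′) *ᶠ (t′ ∙ b))
                -ᶠ ((a ∙ s) *ᶠ (t ∙ b) -ᶠ (a ∙ s′) *ᶠ (t′ ∙ b)) *ᶠ ((a′ ∙ s) *ᶠ (t ∙ b′) -ᶠ (a′ ∙ s′) *ᶠ (t′ ∙ b′))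
                ≡⟨ cong₂ _-ᶠ_ (cong₂ _*ᶠ_ (entry a b′) (entry a′ b)) (cong₂ _*ᶠ_ (entry a b) (entry a′ b′)) ⟩
              ((a ∙ p) *ᶠ (u ∙ b′)) *ᶠ ((a′ ∙ p) *ᶠ (u ∙ b)) -ᶠ ((a ∙ p) *ᶠ (u ∙ b)) *ᶠ ((a′ ∙ p) *ᶠ (u ∙ b′))
                ≡⟨ S.solve 4 (λ x y z w → (x S.:* y) S.:* (z S.:* w) S.:- (x S.:* w) S.:* (z S.:* y) S.:= S.:0) refl (a ∙ p) (u ∙ b′) (a′ ∙ p) (u ∙ b) ⟩
              0ᶠ ∎

-- Eigenvectors of the adjacency matrix and the entries of the idempotent.

module Spectrum (K : CharacteristicZeroDomain) (F : FiniteField) where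

  open Dyads K F public
  open ≡-Reasoning

  private
    module Rᶠ = CommutativeRing ringᶠ
    module S = IntegerSolver ringᶠ

  χ-neg : ∀ x → χ (0ᶠ -ᶠ x) ≡ χ x
  χ-neg x = χ-cong (λ e → sym (-ᶠ≡0 e)) (λ { refl → Rᶠ.-‿inverseʳ 0ᶠ })

  ⟪⟫-0ʳ : ∀ {m n} (B : Mat m n) → ⟪ B , 0ᴹ ⟫ ≡ 0ᶠ
  ⟪⟫-0ʳ B = trans (cong (λ d → ⟪ B , d ⟫) (sym (-ᴹ-self 0ᴹ))) (trans (⟪⟫-- B 0ᴹ 0ᴹ) (Rᶠ.-‿inverseʳ _))

  -ᴹ-involutive : ∀ {m n} (u z : Mat m n) → u -ᴹ (u -ᴹ z) ≡ z
  -ᴹ-involutive u z = matrix-identity (⌈ u ⌉ ⊟ (⌈ u ⌉ ⊟ ⌈ z ⌉)) ⌈ z ⌉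
    (λ a b → S.solve 2 (λ u z → u S.:- (u S.:- z) S.:= z) refl (bil a u b) (bil a z b))

  module _ {m n : ℕ} where

    pw-κ : ∀ (d : Mat m n) → pw m * κ d ≡ pw (m ℕ.+ n ℕ.∸ rank d)
    pw-κ d = *-cancelˡ (pw r) (pw≢0 r) (begin
      pw r * (pw m * κ d) ≡⟨ solve 3 (λ r m k → r :* (m :* k) := m :* (k :* r)) refl (pw r) (pw m) (κ d) ⟩
      pw m * (κ d * pw r) ≡⟨ cong (pw m *_) (κ-rank d) ⟩
      pw m * pw n ≡⟨ sym (pw-+ m n) ⟩
      pw (m ℕ.+ n) ≡⟨ cong pw (sym (ℕₚ.m+[n∸m]≡n (ℕₚ.≤-trans (rank≤ d) (ℕₚ.m≤m+n m n)))) ⟩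
      pw (r ℕ.+ (m ℕ.+ n ℕ.∸ r)) ≡⟨ pw-+ r _ ⟩
      pw r * pw (m ℕ.+ n ℕ.∸ r)        ∎)
      where r = rank d

    infix 4 _∼?_
    _∼?_ : (u w : Mat m n) → Dec (rank (u -ᴹ w) ≡ 1)
    u ∼? w = rank (u -ᴹ w) ℕ.≟ 1

    -- The neighbours of u are the u - z with z of rank one. Summing over dyads instead counts each
    -- of them Q - 1 times and adds R copies of z = 0, which are subtracted again.
    ∑-neighbours-χ : ∀ (B x u : Mat m n) →
      (Q - 1#) * ∑ (𝕞 m n) (λ w → 𝟙 (u ∼? w) * χ ⟪ B , w -ᴹ x ⟫)
        ≡ (pw m * κ B - R m n) * χ ⟪ B , u -ᴹ x ⟫
    ∑-neighbours-χ B x u = begin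
      (Q - 1#) * ∑ (𝕞 m n) (λ w → 𝟙 (u ∼? w) * χ ⟪ B , w -ᴹ x ⟫)
        ≡⟨ cong ((Q - 1#) *_) (sym (∑-reindex (𝕞 m n) (𝕞 m n) (u -ᴹ_) (u -ᴹ_) (-ᴹ-involutive u) (-ᴹ-involutive u) _)) ⟩
      (Q - 1#) * ∑ (𝕞 m n) (λ z → 𝟙 (u ∼? (u -ᴹ z)) * χ ⟪ B , (u -ᴹ z) -ᴹ x ⟫)
        ≡⟨ cong ((Q - 1#) *_) (∑-cong (𝕞 m n) (λ z → cong₂ _*_
             (cong (λ d → 𝟙 (rank d ℕ.≟ 1)) (-ᴹ-involutive u z)) (cong χ (shift z)))) ⟩
      (Q - 1#) * ∑ (𝕞 m n) (λ z → 𝟙 (rank z ℕ.≟ 1) * χ (c -ᶠ ⟪ B , z ⟫))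
        ≡⟨ solve 2 (λ s r → s := (s :+ r) :- r) refl _ (R m n * χ (c -ᶠ ⟪ B , 0ᴹ ⟫)) ⟩
      ((Q - 1#) * ∑ (𝕞 m n) (λ z → 𝟙 (rank z ℕ.≟ 1) * χ (c -ᶠ ⟪ B , z ⟫)) + R m n * χ (c -ᶠ ⟪ B , 0ᴹ ⟫))
        - R m n * χ (c -ᶠ ⟪ B , 0ᴹ ⟫)
        ≡⟨ cong₂ _-_ (trans (sym (∑∑-⊗ (λ z → χ (c -ᶠ ⟪ B , z ⟫))))
             (trans (∑-cong (𝕧 m) (λ s → ∑-cong (𝕧 n) (λ t → cong (λ y → χ (c -ᶠ y)) (⟪⟫-⊗ B s t)))) (∑∑-χ B c)))
             (cong (λ y → R m n * χ y) (trans (cong (c -ᶠ_) (⟪⟫-0ʳ B)) (S.solve 1 (λ c → c S.:- S.:0 S.:= c) refl c))) ⟩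
      (pw m * κ B) * χ c - R m n * χ c
        ≡⟨ solve 3 (λ p r x → p :* x :- r :* x := (p :- r) :* x) refl (pw m * κ B) (R m n) (χ c) ⟩
      (pw m * κ B - R m n) * χ c ∎
      where
      c = ⟪ B , u -ᴹ x ⟫
      shift : ∀ z → ⟪ B , (u -ᴹ z) -ᴹ x ⟫ ≡ c -ᶠ ⟪ B , z ⟫
      shift z = begin
        ⟪ B , (u -ᴹ z) -ᴹ x ⟫ ≡⟨ trans (⟪⟫-- B _ x) (cong (_-ᶠ ⟪ B , x ⟫) (⟪⟫-- B u z)) ⟩
        (⟪ B , u ⟫ -ᶠ ⟪ B , z ⟫) -ᶠ ⟪ B , x ⟫ ≡⟨ S.solve 3 (λ u z x → (u S.:- z) S.:- x S.:= (u S.:- x) S.:- z) refl ⟪ B , u ⟫ ⟪ B , z ⟫ ⟪ B , x ⟫ ⟩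
        (⟪ B , u ⟫ -ᶠ ⟪ B , x ⟫) -ᶠ ⟪ B , z ⟫ ≡⟨ cong (_-ᶠ ⟪ B , z ⟫) (sym (⟪⟫-- B u x)) ⟩
        c -ᶠ ⟪ B , z ⟫                              ∎

    -- The eigenvalue computation with the two arguments of the trace form exchanged: the scheme is
    -- self-dual. The right side is the entry of E at difference d, up to the factor |X| (Q - 1).
    ∑-rank1-χ : ∀ (d : Mat m n) →
      ∑ (𝕞 m n) (λ B → 𝟙 (rank B ℕ.≟ 1) * χ ⟪ B , d ⟫) ≡ pw m * κ d - R m n
    ∑-rank1-χ d = *-cancelˡ (Q - 1#) Q-1≢0 (begin
      (Q - 1#) * S₁
        ≡⟨ solve 2 (λ s r → s := (s :+ r) :- r) refl _ (R m n * χ ⟪ 0ᴹ , d ⟫) ⟩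
      ((Q - 1#) * S₁ + R m n * χ ⟪ 0ᴹ , d ⟫) - R m n * χ ⟪ 0ᴹ , d ⟫
        ≡⟨ cong₂ _-_ (trans (sym (∑∑-⊗ (λ B → χ ⟪ B , d ⟫)))
             (trans (∑-cong (𝕧 m) (λ s → ∑-cong (𝕧 n) (λ t → trans
               (cong χ (trans (⟪⟫-comm (s ⊗ t) d) (⟪⟫-⊗ d s t))) (sym (χ-neg _))))) (∑∑-χ d 0ᶠ)))
             (cong (λ y → R m n * χ y) (trans (⟪⟫-comm 0ᴹ d) (⟪⟫-0ʳ d))) ⟩
      (pw m * κ d) * χ 0ᶠ - R m n * χ 0ᶠ
        ≡⟨ cong (λ x → (pw m * κ d) * x - R m n * x) χ-0 ⟩
      (pw m * κ d) * (Q - 1#) - R m n * (Q - 1#)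
        ≡⟨ solve 3 (λ p r x → p :* x :- r :* x := x :* (p :- r)) refl (pw m * κ d) (R m n) (Q - 1#) ⟩
      (Q - 1#) * (pw m * κ d - R m n) ∎)
      where
      S₁ = ∑ (𝕞 m n) (λ B → 𝟙 (rank B ℕ.≟ 1) * χ ⟪ B , d ⟫)

    |X| : Carrier
    |X| = ∑ (𝕞 m n) (λ _ → 1#)

    |X|≢0 : |X| ≢ 0#
    |X|≢0 = ∑-count≢0 (𝕞 m n) (λ _ → yes tt) (0ᴹ , tt)

    ∑-χ-δ : ∀ (u x : Mat m n) → ∑ (𝕞 m n) (λ B → χ ⟪ B , u -ᴹ x ⟫) ≡ 𝟙 (x ≟ᴹ u) * (|X| * (Q - 1#))
    ∑-χ-δ u x = begin
      ∑ (𝕞 m n) (λ B → χ ⟪ B , u -ᴹ x ⟫)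
        ≡⟨ ∑-cong (𝕞 m n) (λ B → trans (cong χ (⟪⟫-comm B _)) (sym (χ-neg _))) ⟩
      ∑ (𝕞 m n) (λ B → χ (0ᶠ -ᶠ ⟪ u -ᴹ x , B ⟫))
        ≡⟨ ∑-χ-⟪⟫ (u -ᴹ x) 0ᶠ ⟩
      𝟙 (u -ᴹ x ≟ᴹ 0ᴹ) * (|X| * χ 0ᶠ)
        ≡⟨ cong₂ (λ i y → i * (|X| * y))
             (𝟙-cong (u -ᴹ x ≟ᴹ 0ᴹ) (x ≟ᴹ u) (λ e → sym (-ᴹ≡0 e)) (λ e → trans (cong (u -ᴹ_) e) (-ᴹ-self u))) χ-0 ⟩
      𝟙 (x ≟ᴹ u) * (|X| * (Q - 1#)) ∎

    module _ (θ : ℕ → Carrier) (θ-def : ∀ r → (Q - 1#) * θ r ≡ pw (m ℕ.+ n ℕ.∸ r) - R m n) where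

      χ-eigenvector : ∀ (B x u : Mat m n) →
        ∑ (𝕞 m n) (λ w → 𝟙 (u ∼? w) * χ ⟪ B , w -ᴹ x ⟫) ≡ θ (rank B) * χ ⟪ B , u -ᴹ x ⟫
      χ-eigenvector B x u = *-cancelˡ (Q - 1#) Q-1≢0 (begin
        (Q - 1#) * ∑ (𝕞 m n) (λ w → 𝟙 (u ∼? w) * χ ⟪ B , w -ᴹ x ⟫)
          ≡⟨ ∑-neighbours-χ B x u ⟩
        (pw m * κ B - R m n) * χ ⟪ B , u -ᴹ x ⟫
          ≡⟨ cong (λ y → (y - R m n) * χ ⟪ B , u -ᴹ x ⟫) (pw-κ B) ⟩
        (pw (m ℕ.+ n ℕ.∸ r) - R m n) * χ ⟪ B , u -ᴹ x ⟫
          ≡⟨ cong (_* χ ⟪ B , u -ᴹ x ⟫) (sym (θ-def r)) ⟩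
        ((Q - 1#) * θ r) * χ ⟪ B , u -ᴹ x ⟫
          ≡⟨ *-assoc _ _ _ ⟩
        (Q - 1#) * (θ r * χ ⟪ B , u -ᴹ x ⟫) ∎)
        where r = rank B

      module _ (E : Mat m n → Mat m n → Carrier)
        (E-spectral : ∀ r → r ℕ.≤ m → (v : Mat m n → Carrier) →
          (∀ u → ∑ (𝕞 m n) (λ w → 𝟙 (u ∼? w) * v w) ≡ θ r * v u) →
          ∀ u → ∑ (𝕞 m n) (λ w → E u w * v w) ≡ 𝟙 (r ℕ.≟ 1) * v u) where

        -- v is a combination of the eigenvectors w ↦ χ ⟪ B , w - x ⟫, of which E keeps those with rank B = 1.
        apply-idempotent : ∀ (v : Mat m n → Carrier) u →
          (|X| * (Q - 1#)) * ∑ (𝕞 m n) (λ w → E u w * v w) ≡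
          ∑ (𝕞 m n) (λ x → v x * (pw m * κ (u -ᴹ x) - R m n))
        apply-idempotent v u = begin
          C₀ * ∑ X (λ w → E u w * v w)
            ≡⟨ sym (∑-*ˡ X C₀ _) ⟩
          ∑ X (λ w → C₀ * (E u w * v w))
            ≡⟨ ∑-cong X (λ w → trans (solve 3 (λ c e x → c :* (e :* x) := e :* (x :* c)) refl C₀ (E u w) (v w))
                 (trans (cong (E u w *_) (sym (sift X w (λ x → v x * C₀)))) (sym (∑-*ˡ X (E u w) _)))) ⟩
          ∑ X (λ w → ∑ X (λ x → E u w * (𝟙 (x ≟ᴹ w) * (v x * C₀))))
            ≡⟨ ∑-cong X (λ w → ∑-cong X (λ x → trans
                 (solve 4 (λ e i x c → e :* (i :* (x :* c)) := x :* (e :* (i :* c))) refl (E u w) (𝟙 (x ≟ᴹ w)) (v x) C₀)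
                 (cong (v x *_) (trans (cong (E u w *_) (sym (∑-χ-δ w x))) (sym (∑-*ˡ X (E u w) _)))))) ⟩
          ∑ X (λ w → ∑ X (λ x → v x * ∑ X (λ B → E u w * χ ⟪ B , w -ᴹ x ⟫)))
            ≡⟨ ∑-swap X X _ ⟩
          ∑ X (λ x → ∑ X (λ w → v x * ∑ X (λ B → E u w * χ ⟪ B , w -ᴹ x ⟫)))
            ≡⟨ ∑-cong X (λ x → trans (∑-*ˡ X (v x) _) (cong (v x *_) (∑-swap X X _))) ⟩
          ∑ X (λ x → v x * ∑ X (λ B → ∑ X (λ w → E u w * χ ⟪ B , w -ᴹ x ⟫)))
            ≡⟨ ∑-cong X (λ x → cong (v x *_) (trans
                 (∑-cong X (λ B → E-spectral (rank B) (rank≤ B) (λ w → χ ⟪ B , w -ᴹ x ⟫) (χ-eigenvector B x) u))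
                 (∑-rank1-χ (u -ᴹ x)))) ⟩
          ∑ X (λ x → v x * (pw m * κ (u -ᴹ x) - R m n)) ∎
          where
          X = 𝕞 m n
          C₀ = |X| * (Q - 1#)

-- Rank-preserving maps and the stabilizer of a matrix.

module Isometries (K : CharacteristicZeroDomain) (F : FiniteField) where

  open Spectrum K F public
  open ≡-Reasoning

  private
    module Rᶠ = CommutativeRing ringᶠ
    module S = IntegerSolver ringᶠ

  bil-+ˡ : ∀ {m n} a a′ (d : Mat m n) b → bil (a +ᵛ a′) d b ≡ bil a d b +ᶠ bil a′ d b
  bil-+ˡ a a′ d b = ∙-+ˡ a a′ (d ⋆ b)

  bil-*ˡ : ∀ {m n} c a (d : Mat m n) b → bil (c *ᵛ a) d b ≡ c *ᶠ bil a d b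
  bil-*ˡ c a d b = ∙-*ˡ c a (d ⋆ b)

  -- Compatibility with subtraction turns preservation of rank into preservation of distance and
  -- fixes `0ᴹ`; it remains to ask that a given Y be fixed.
  record LinearIsometry (m n : ℕ) : Set where
    field
      to from : Mat m n → Mat m n
      from-to : ∀ z → from (to z) ≡ z
      to-from : ∀ z → to (from z) ≡ z
      to-- : ∀ d e → to (d -ᴹ e) ≡ to d -ᴹ to e
      rank-to : ∀ d → rank (to d) ≡ rank d

  open LinearIsometry public

  infixr 9 _⊚_
  _⊚_ : ∀ {m n} → LinearIsometry m n → LinearIsometry m n → LinearIsometry m n
  σ ⊚ τ = record
    { to = λ z → to σ (to τ z)
    ; from = λ z → from τ (from σ z)
    ; from-to = λ z → trans (cong (from τ) (from-to σ _)) (from-to τ z)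
    ; to-from = λ z → trans (cong (to σ) (to-from τ _)) (to-from σ z)
    ; to-- = λ d e → trans (cong (to σ) (to-- τ d e)) (to-- σ _ _)
    ; rank-to = λ d → trans (rank-to σ _) (rank-to τ d) }

  -- Conjugation by transposition produces the right multiplications from the left ones.
  transposed : ∀ {m n} → LinearIsometry n m → LinearIsometry m n
  transposed τ = record
    { to = λ z → to τ (z ᵀ) ᵀ
    ; from = λ z → from τ (z ᵀ) ᵀ
    ; from-to = λ z → trans (cong (λ y → from τ y ᵀ) (ᵀ-involutive _)) (trans (cong _ᵀ (from-to τ _)) (ᵀ-involutive z))
    ; to-from = λ z → trans (cong (λ y → to τ y ᵀ) (ᵀ-involutive _)) (trans (cong _ᵀ (to-from τ _)) (ᵀ-involutive z))
    ; to-- = λ d e → trans (cong (λ y → to τ y ᵀ) (ᵀ-- d e)) (trans (cong _ᵀ (to-- τ _ _)) (ᵀ-- (to τ (d ᵀ)) (to τ (e ᵀ))))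
    ; rank-to = λ d → trans (rank-ᵀ (to τ (d ᵀ))) (trans (rank-to τ (d ᵀ)) (rank-ᵀ d)) }
    where
    ᵀ-- : ∀ {m n} (d e : Mat m n) → (d -ᴹ e) ᵀ ≡ d ᵀ -ᴹ e ᵀ
    ᵀ-- d e = bil-ext (λ b a → trans (bil-ᵀ a _ b) (trans (bil-- a d e b)
      (trans (cong₂ _-ᶠ_ (sym (bil-ᵀ a d b)) (sym (bil-ᵀ a e b))) (sym (bil-- b _ _ a)))))

  -- Left multiplication by the elementary matrix I + p aᵗ.
  mulˡ : ∀ {m n} → 𝕍 m → 𝕍 m → Mat m n → Mat m n
  mulˡ p a z = z +ᴹ p ⊗ (z ᵀ ⋆ a)

  bil-mulˡ : ∀ {m n} p a a′ (z : Mat m n) b → bil a′ (mulˡ p a z) b ≡ bil a′ z b +ᶠ (a′ ∙ p) *ᶠ bil a z b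
  bil-mulˡ p a a′ z b = trans (bil-+ a′ z _ b) (cong (bil a′ z b +ᶠ_)
    (trans (bil-⊗ a′ p _ b) (cong ((a′ ∙ p) *ᶠ_) (ᵀ⋆-∙ z a b))))

  -- The inverse of I + p aᵗ is I - c p aᵗ with c the inverse of 1 + a ∙ p (Sherman-Morrison). The
  -- kernel is unchanged: if (I + p aᵗ) d b = 0, then pairing with a gives aᵗ d b = 0 and hence d b
  -- = 0.
  elementaryˡ : ∀ {m n} (p a : 𝕍 m) c → (1ᶠ +ᶠ a ∙ p) *ᶠ c ≡ 1ᶠ → LinearIsometry m n
  elementaryˡ {m} {n} p a c h = record
    { to = mulˡ p a
    ; from = mulˡ (⊖ c *ᵛ p) a
    ; from-to = inverseˡ p (⊖ c *ᵛ p) (λ a′ → begin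
        a′ ∙ p +ᶠ (a′ ∙ (⊖ c *ᵛ p)) *ᶠ (1ᶠ +ᶠ a ∙ p)
          ≡⟨ cong (λ x → a′ ∙ p +ᶠ x *ᶠ (1ᶠ +ᶠ a ∙ p)) (∙-*ʳ a′ (⊖ c) p) ⟩
        a′ ∙ p +ᶠ (⊖ c *ᶠ (a′ ∙ p)) *ᶠ (1ᶠ +ᶠ a ∙ p)
          ≡⟨ S.solve 3 (λ x y c → x S.:+ (S.:- c S.:* x) S.:* y S.:= x S.:* (S.:1 S.:- y S.:* c)) refl _ _ c ⟩
        (a′ ∙ p) *ᶠ (1ᶠ -ᶠ (1ᶠ +ᶠ a ∙ p) *ᶠ c)
          ≡⟨ trans (cong (λ x → (a′ ∙ p) *ᶠ (1ᶠ -ᶠ x)) h) (trans (cong ((a′ ∙ p) *ᶠ_) (Rᶠ.-‿inverseʳ 1ᶠ)) (Rᶠ.zeroʳ _)) ⟩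
        0ᶠ ∎)
    ; to-from = inverseˡ (⊖ c *ᵛ p) p (λ a′ → begin
        a′ ∙ (⊖ c *ᵛ p) +ᶠ (a′ ∙ p) *ᶠ (1ᶠ +ᶠ a ∙ (⊖ c *ᵛ p))
          ≡⟨ cong₂ (λ x y → x +ᶠ (a′ ∙ p) *ᶠ (1ᶠ +ᶠ y)) (∙-*ʳ a′ (⊖ c) p) (∙-*ʳ a (⊖ c) p) ⟩
        (⊖ c *ᶠ (a′ ∙ p)) +ᶠ (a′ ∙ p) *ᶠ (1ᶠ +ᶠ ⊖ c *ᶠ (a ∙ p))
          ≡⟨ S.solve 3 (λ x y c → (S.:- c S.:* x) S.:+ x S.:* (S.:1 S.:+ S.:- c S.:* y) S.:= x S.:* (S.:1 S.:- (S.:1 S.:+ y) S.:* c)) refl _ _ c ⟩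
        (a′ ∙ p) *ᶠ (1ᶠ -ᶠ (1ᶠ +ᶠ a ∙ p) *ᶠ c)
          ≡⟨ trans (cong (λ x → (a′ ∙ p) *ᶠ (1ᶠ -ᶠ x)) h) (trans (cong ((a′ ∙ p) *ᶠ_) (Rᶠ.-‿inverseʳ 1ᶠ)) (Rᶠ.zeroʳ _)) ⟩
        0ᶠ ∎)
    ; to-- = λ d e → bil-ext (λ a′ b → begin
        bil a′ (mulˡ p a (d -ᴹ e)) b
          ≡⟨ trans (bil-mulˡ p a a′ _ b) (cong₂ (λ x y → x +ᶠ (a′ ∙ p) *ᶠ y) (bil-- a′ d e b) (bil-- a d e b)) ⟩
        (bil a′ d b -ᶠ bil a′ e b) +ᶠ (a′ ∙ p) *ᶠ (bil a d b -ᶠ bil a e b)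
          ≡⟨ S.solve 5 (λ x y p u v → (x S.:- y) S.:+ p S.:* (u S.:- v) S.:= (x S.:+ p S.:* u) S.:- (y S.:+ p S.:* v)) refl _ _ (a′ ∙ p) _ _ ⟩
        (bil a′ d b +ᶠ (a′ ∙ p) *ᶠ bil a d b) -ᶠ (bil a′ e b +ᶠ (a′ ∙ p) *ᶠ bil a e b)
          ≡⟨ cong₂ _-ᶠ_ (sym (bil-mulˡ p a a′ d b)) (sym (bil-mulˡ p a a′ e b)) ⟩
        bil a′ (mulˡ p a d) b -ᶠ bil a′ (mulˡ p a e) b
          ≡⟨ sym (bil-- a′ _ _ b) ⟩
        bil a′ (mulˡ p a d -ᴹ mulˡ p a e) b ∎)
    ; rank-to = λ d → rank-cong _ d (κ-cong (mulˡ p a d) d (kernel d) (λ b db → ∙-ext (λ a′ → begin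
        bil a′ (mulˡ p a d) b
          ≡⟨ bil-mulˡ p a a′ d b ⟩
        bil a′ d b +ᶠ (a′ ∙ p) *ᶠ bil a d b
          ≡⟨ cong₂ (λ x y → x +ᶠ (a′ ∙ p) *ᶠ y) (killed d b db a′) (killed d b db a) ⟩
        0ᶠ +ᶠ (a′ ∙ p) *ᶠ 0ᶠ
          ≡⟨ S.solve 1 (λ x → S.:0 S.:+ x S.:* S.:0 S.:= S.:0) refl (a′ ∙ p) ⟩
        0ᶠ
          ≡⟨ sym (∙-0ʳ a′) ⟩
        a′ ∙ 0ᵛ ∎))) }
    where
    killed : ∀ (d : Mat m n) b → d ⋆ b ≡ 0ᵛ → ∀ a → bil a d b ≡ 0ᶠ
    killed d b db a = trans (cong (a ∙_) db) (∙-0ʳ a)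
    kernel : ∀ (d : Mat m n) b → mulˡ p a d ⋆ b ≡ 0ᵛ → d ⋆ b ≡ 0ᵛ
    kernel d b e = ∙-ext (λ a′ → begin
      bil a′ d b
        ≡⟨ S.solve 2 (λ x y → x S.:= (x S.:+ y S.:* S.:0)) refl _ (a′ ∙ p) ⟩
      bil a′ d b +ᶠ (a′ ∙ p) *ᶠ 0ᶠ
        ≡⟨ cong (λ y → bil a′ d b +ᶠ (a′ ∙ p) *ᶠ y) (sym adb) ⟩
      bil a′ d b +ᶠ (a′ ∙ p) *ᶠ bil a d b
        ≡⟨ image a′ ⟩
      0ᶠ
        ≡⟨ sym (∙-0ʳ a′) ⟩
      a′ ∙ 0ᵛ ∎)
      where
      image : ∀ a′ → bil a′ d b +ᶠ (a′ ∙ p) *ᶠ bil a d b ≡ 0ᶠ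
      image a′ = trans (sym (bil-mulˡ p a a′ d b)) (trans (cong (a′ ∙_) e) (∙-0ʳ a′))
      adb : bil a d b ≡ 0ᶠ
      adb = begin
        bil a d b
          ≡⟨ sym (Rᶠ.*-identityˡ _) ⟩
        1ᶠ *ᶠ bil a d b
          ≡⟨ cong (_*ᶠ bil a d b) (sym h) ⟩
        ((1ᶠ +ᶠ a ∙ p) *ᶠ c) *ᶠ bil a d b
          ≡⟨ S.solve 3 (λ y c x → ((S.:1 S.:+ y) S.:* c) S.:* x S.:= c S.:* (x S.:+ y S.:* x)) refl (a ∙ p) c _ ⟩
        c *ᶠ (bil a d b +ᶠ (a ∙ p) *ᶠ bil a d b)
          ≡⟨ trans (cong (c *ᶠ_) (image a)) (Rᶠ.zeroʳ c) ⟩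
        0ᶠ ∎
    inverseˡ : ∀ p p′ → (∀ a′ → a′ ∙ p +ᶠ (a′ ∙ p′) *ᶠ (1ᶠ +ᶠ a ∙ p) ≡ 0ᶠ) → ∀ z → mulˡ p′ a (mulˡ p a z) ≡ z
    inverseˡ p p′ h z = bil-ext (λ a′ b → begin
      bil a′ (mulˡ p′ a (mulˡ p a z)) b
        ≡⟨ trans (bil-mulˡ p′ a a′ _ b) (cong₂ (λ x y → x +ᶠ (a′ ∙ p′) *ᶠ y) (bil-mulˡ p a a′ z b) (bil-mulˡ p a a z b)) ⟩
      (bil a′ z b +ᶠ (a′ ∙ p) *ᶠ bil a z b) +ᶠ (a′ ∙ p′) *ᶠ (bil a z b +ᶠ (a ∙ p) *ᶠ bil a z b)
        ≡⟨ S.solve 5 (λ x y u v w → (x S.:+ y S.:* u) S.:+ v S.:* (u S.:+ w S.:* u) S.:= x S.:+ (y S.:+ v S.:* (S.:1 S.:+ w)) S.:* u) refl _ _ _ _ _ ⟩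
      bil a′ z b +ᶠ (a′ ∙ p +ᶠ (a′ ∙ p′) *ᶠ (1ᶠ +ᶠ a ∙ p)) *ᶠ bil a z b
        ≡⟨ cong (λ x → bil a′ z b +ᶠ x *ᶠ bil a z b) (h a′) ⟩
      bil a′ z b +ᶠ 0ᶠ *ᶠ bil a z b
        ≡⟨ S.solve 2 (λ x y → x S.:+ S.:0 S.:* y S.:= x) refl _ _ ⟩
      bil a′ z b ∎)

  -- z ↦ (I + α Y v aᵗ) z (I + β v aᵗ Y) fixes Y when α + β + α β (aᵗ Y v) = 0.
  module Stabilizer {m n} (Y : Mat m n) (a : 𝕍 m) (v : 𝕍 n) (α β : 𝔽)
    (fix : α +ᶠ β +ᶠ α *ᶠ β *ᶠ bil a Y v ≡ 0ᶠ) where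

    private
      e = bil a Y v
      p = α *ᵛ (Y ⋆ v)
      q = β *ᵛ (Y ᵀ ⋆ a)

      a′p : ∀ a′ → a′ ∙ p ≡ α *ᶠ bil a′ Y v
      a′p a′ = ∙-*ʳ a′ α _

      qb : ∀ b → b ∙ q ≡ β *ᶠ bil a Y b
      qb b = trans (∙-*ʳ b β _) (cong (β *ᶠ_) (bil-ᵀ a Y b))

      -- The product is 1 + e (α + β + α β e), so by `fix` the units required by the left and the
      -- right factor are inverse to each other, and each supplies the inverse for the other.
      units : (1ᶠ +ᶠ α *ᶠ e) *ᶠ (1ᶠ +ᶠ β *ᶠ e) ≡ 1ᶠ
      units = trans
        (S.solve 3 (λ x y e → (S.:1 S.:+ x S.:* e) S.:* (S.:1 S.:+ y S.:* e) S.:= S.:1 S.:+ e S.:* (x S.:+ y S.:+ x S.:* y S.:* e)) refl α β e)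
        (trans (cong (λ x → 1ᶠ +ᶠ e *ᶠ x) fix) (S.solve 1 (λ e → S.:1 S.:+ e S.:* S.:0 S.:= S.:1) refl e))

    stabilizer : LinearIsometry m n
    stabilizer = transposed (elementaryˡ q v (1ᶠ +ᶠ α *ᶠ e)
                   (trans (cong (λ x → (1ᶠ +ᶠ x) *ᶠ (1ᶠ +ᶠ α *ᶠ e)) (qb v)) (trans (Rᶠ.*-comm _ _) units)))
      ⊚ elementaryˡ p a (1ᶠ +ᶠ β *ᶠ e) (trans (cong (λ x → (1ᶠ +ᶠ x) *ᶠ (1ᶠ +ᶠ β *ᶠ e)) (a′p a)) units)

    bil-stabilizer : ∀ a′ z b′ → bil a′ (to stabilizer z) b′ ≡
      (bil a′ z b′ +ᶠ (α *ᶠ bil a′ Y v) *ᶠ bil a z b′) +ᶠ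
      (β *ᶠ bil a Y b′) *ᶠ (bil a′ z v +ᶠ (α *ᶠ bil a′ Y v) *ᶠ bil a z v)
    bil-stabilizer a′ z b′ = begin
      bil a′ (mulˡ q v (L ᵀ) ᵀ) b′
        ≡⟨ bil-ᵀ b′ (mulˡ q v (L ᵀ)) a′ ⟩
      bil b′ (mulˡ q v (L ᵀ)) a′
        ≡⟨ bil-mulˡ q v b′ (L ᵀ) a′ ⟩
      bil b′ (L ᵀ) a′ +ᶠ (b′ ∙ q) *ᶠ bil v (L ᵀ) a′
        ≡⟨ cong₂ (λ x y → x +ᶠ (b′ ∙ q) *ᶠ y) (bil-L b′) (bil-L v) ⟩
      (bil a′ z b′ +ᶠ (α *ᶠ bil a′ Y v) *ᶠ bil a z b′) +ᶠ
      (b′ ∙ q) *ᶠ (bil a′ z v +ᶠ (α *ᶠ bil a′ Y v) *ᶠ bil a z v)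
        ≡⟨ cong (λ x → (bil a′ z b′ +ᶠ (α *ᶠ bil a′ Y v) *ᶠ bil a z b′) +ᶠ x *ᶠ (bil a′ z v +ᶠ (α *ᶠ bil a′ Y v) *ᶠ bil a z v)) (qb b′) ⟩
      _ ∎
      where
      L = mulˡ p a z
      bil-L : ∀ b → bil b (L ᵀ) a′ ≡ bil a′ z b +ᶠ (α *ᶠ bil a′ Y v) *ᶠ bil a z b
      bil-L b = trans (bil-ᵀ a′ L b) (trans (bil-mulˡ p a a′ z b) (cong (λ x → bil a′ z b +ᶠ x *ᶠ bil a z b) (a′p a′)))

    stabilizer-fixes : to stabilizer Y ≡ Y
    stabilizer-fixes = bil-ext (λ a′ b′ → begin
      bil a′ (to stabilizer Y) b′
        ≡⟨ bil-stabilizer a′ Y b′ ⟩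
      (bil a′ Y b′ +ᶠ (α *ᶠ bil a′ Y v) *ᶠ bil a Y b′) +ᶠ (β *ᶠ bil a Y b′) *ᶠ (bil a′ Y v +ᶠ (α *ᶠ bil a′ Y v) *ᶠ e)
        ≡⟨ S.solve 6 (λ w x u y z e → (w S.:+ (x S.:* u) S.:* y) S.:+ (z S.:* y) S.:* (u S.:+ (x S.:* u) S.:* e) S.:=
             w S.:+ (x S.:+ z S.:+ x S.:* z S.:* e) S.:* (u S.:* y)) refl _ α _ _ β e ⟩
      bil a′ Y b′ +ᶠ (α +ᶠ β +ᶠ α *ᶠ β *ᶠ e) *ᶠ (bil a′ Y v *ᶠ bil a Y b′)
        ≡⟨ cong (λ x → bil a′ Y b′ +ᶠ x *ᶠ (bil a′ Y v *ᶠ bil a Y b′)) fix ⟩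
      bil a′ Y b′ +ᶠ 0ᶠ *ᶠ (bil a′ Y v *ᶠ bil a Y b′)
        ≡⟨ S.solve 2 (λ x y → x S.:+ S.:0 S.:* y S.:= x) refl _ _ ⟩
      bil a′ Y b′ ∎)

-- From the symmetries of h(a, b, c) to the identity for kernel counts.

module Balance (K : CharacteristicZeroDomain) (F : FiniteField) where

  open Isometries K F public
  open ≡-Reasoning

  private
    module Rᶠ = CommutativeRing ringᶠ
    module S = IntegerSolver ringᶠ

  1≢0 : 1ᶠ ≢ 0ᶠ
  1≢0 = ≢-sym 0≢1

  unit≢0 : ∀ {x y} → x *ᶠ y ≡ 1ᶠ → x ≢ 0ᶠ
  unit≢0 {y = y} e refl = 0≢1 (trans (sym (Rᶠ.zeroˡ y)) e)

  scale-scale : ∀ {m n c e} (z : Mat m n) → c *ᶠ e ≡ 1ᶠ → c *ᴹ (e *ᴹ z) ≡ z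
  scale-scale {c = c} {e} z ce = bil-ext (λ a b → begin
    bil a (c *ᴹ (e *ᴹ z)) b ≡⟨ trans (bil-* a c _ b) (cong (c *ᶠ_) (bil-* a e z b)) ⟩
    c *ᶠ (e *ᶠ bil a z b) ≡⟨ sym (Rᶠ.*-assoc c e _) ⟩
    (c *ᶠ e) *ᶠ bil a z b ≡⟨ trans (cong (_*ᶠ bil a z b) ce) (Rᶠ.*-identityˡ _) ⟩
    bil a z b                     ∎)

  module _ {m n : ℕ} where

    private
      X = 𝕞 m n

    opaque
      -- For f the indicator of O₍ᵢ₎ this is the number h(a, b, c) of the overview.
      fibre : (Mat m n → Carrier) → 𝕍 m → 𝕍 n → 𝔽 → Carrier
      fibre f a b c = ∑ X (λ z → 𝟙 (bil a z b ≟ᶠ c) * f z)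

      fibre-def : ∀ f a b c → fibre f a b c ≡ ∑ X (λ z → 𝟙 (bil a z b ≟ᶠ c) * f z)
      fibre-def f a b c = refl

      fibre-cong : ∀ f a b c a′ b′ c′ → (∀ z → bil a z b ≡ c → bil a′ z b′ ≡ c′) →
        (∀ z → bil a′ z b′ ≡ c′ → bil a z b ≡ c) → fibre f a b c ≡ fibre f a′ b′ c′
      fibre-cong f a b c a′ b′ c′ g h =
        ∑-cong X (λ z → cong (_* f z) (𝟙-cong (bil a z b ≟ᶠ c) (bil a′ z b′ ≟ᶠ c′) (g z) (h z)))

      -- Invariance of f is asked only where aᵗ z b = c: the maps used for O₁ preserve that set on
      -- one such slice and not everywhere.
      fibre-reindex : ∀ f a b c a′ b′ c′ (τ σ : Mat m n → Mat m n) → (∀ z → σ (τ z) ≡ z) → (∀ z → τ (σ z) ≡ z) →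
        (∀ z → bil a z b ≡ c → f (τ z) ≡ f z) →
        (∀ z → bil a z b ≡ c → bil a′ (τ z) b′ ≡ c′) → (∀ z → bil a′ (τ z) b′ ≡ c′ → bil a z b ≡ c) →
        fibre f a b c ≡ fibre f a′ b′ c′
      fibre-reindex f a b c a′ b′ c′ τ σ στ τσ inv g h = begin
        ∑ X (λ z → 𝟙 (bil a z b ≟ᶠ c) * f z)
          ≡⟨ ∑-cong X (λ z → trans (𝟙-guard (bil a z b ≟ᶠ c) (λ e → sym (inv z e)))
               (cong (_* f (τ z)) (𝟙-cong (bil a z b ≟ᶠ c) (bil a′ (τ z) b′ ≟ᶠ c′) (g z) (h z)))) ⟩
        ∑ X (λ z → 𝟙 (bil a′ (τ z) b′ ≟ᶠ c′) * f (τ z))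
          ≡⟨ ∑-reindex X X τ σ στ τσ (λ z → 𝟙 (bil a′ z b′ ≟ᶠ c′) * f z) ⟩
        ∑ X (λ z → 𝟙 (bil a′ z b′ ≟ᶠ c′) * f z) ∎

    fibre-scaleˡ : ∀ f a b c {μ} → μ ≢ 0ᶠ → fibre f (μ *ᵛ a) b (μ *ᶠ c) ≡ fibre f a b c
    fibre-scaleˡ f a b c {μ} μ≢0 = fibre-cong f _ b _ a b c
      (λ z e → *ᶠ-cancelˡ μ≢0 (trans (sym (bil-*ˡ μ a z b)) e))
      (λ z e → trans (bil-*ˡ μ a z b) (cong (μ *ᶠ_) e))

    fibre-scaleʳ : ∀ f a b c {μ} → μ ≢ 0ᶠ → fibre f a (μ *ᵛ b) (μ *ᶠ c) ≡ fibre f a b c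
    fibre-scaleʳ f a b c {μ} μ≢0 = fibre-cong f a _ _ a b c
      (λ z e → *ᶠ-cancelˡ μ≢0 (trans (sym (bil-*ʳ a z μ b)) e))
      (λ z e → trans (bil-*ʳ a z μ b) (cong (μ *ᶠ_) e))

    module _ (Y : Mat m n) where

      Stable : (Mat m n → Carrier) → Set
      Stable f = ∀ (τ : LinearIsometry m n) → to τ Y ≡ Y → ∀ z → f (to τ z) ≡ f z

      Homogeneous : (Mat m n → Carrier) → Set
      Homogeneous f = ∀ μ → μ ≢ 0ᶠ → ∀ z → f (μ *ᴹ z) ≡ f z

      -- Conditions (2), here, and (1), in `Even`, for a weight f in place of an indicator.
      Symmetric : (Mat m n → Carrier) → Set
      Symmetric f = ∀ a b c → bil a Y b ≡ 1ᶠ → c ≢ 0ᶠ → c ≢ 1ᶠ → fibre f a b c ≡ fibre f a b (1ᶠ -ᶠ c)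

      Even : (Mat m n → Carrier) → Set
      Even f = ∀ a b c → bil a Y b ≡ 0ᶠ → fibre f a b c ≡ fibre f a b (⊖ c)

      Balanced : (Mat m n → Carrier) → Set
      Balanced f = ∃ λ l → ∀ u →
        ∑ X (λ z → f z * (κ (u -ᴹ z) - κ (u -ᴹ (Y -ᴹ z)))) ≡ l * (κ u - κ (u -ᴹ Y))

      homogeneous-fibre : ∀ {f} → Homogeneous f → ∀ a b c μ → μ ≢ 0ᶠ → fibre f a b c ≡ fibre f a b (μ *ᶠ c)
      homogeneous-fibre {f} hom a b c μ μ≢0 with inverse μ μ≢0
      ... | ν , μν = fibre-reindex f a b c a b (μ *ᶠ c) (μ *ᴹ_) (ν *ᴹ_)
        (λ z → scale-scale z (trans (Rᶠ.*-comm ν μ) μν)) (λ z → scale-scale z μν)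
        (λ z _ → hom μ μ≢0 z)
        (λ z e → trans (bil-* a μ z b) (cong (μ *ᶠ_) e))
        (λ z e → *ᶠ-cancelˡ μ≢0 (trans (sym (bil-* a μ z b)) e))

      homogeneous⇒symmetric : ∀ {f} → Homogeneous f → Symmetric f
      homogeneous⇒symmetric {f} hom a b c _ c≢0 c≢1 with inverse c c≢0
      ... | ν , cν = trans (homogeneous-fibre hom a b c μ μ≢0) (cong (fibre f a b) μc)
        where
        μ = (1ᶠ -ᶠ c) *ᶠ ν
        μc : μ *ᶠ c ≡ 1ᶠ -ᶠ c
        μc = trans (S.solve 3 (λ x v c → (x S.:* v) S.:* c S.:= (c S.:* v) S.:* x) refl (1ᶠ -ᶠ c) ν c)
          (trans (cong (_*ᶠ (1ᶠ -ᶠ c)) cν) (Rᶠ.*-identityˡ _))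
        μ≢0 : μ ≢ 0ᶠ
        μ≢0 e = c≢1 (sym (-ᶠ≡0 (trans (sym μc) (trans (cong (_*ᶠ c) e) (Rᶠ.zeroˡ c)))))

      ⊖1≢0 : ⊖ 1ᶠ ≢ 0ᶠ
      ⊖1≢0 = unit≢0 {y = ⊖ 1ᶠ} (S.solve 0 (S.:- S.:1 S.:* S.:- S.:1 S.:= S.:1) refl)

      homogeneous⇒even : ∀ {f} → Homogeneous f → Even f
      homogeneous⇒even {f} hom a b c _ = trans (homogeneous-fibre hom a b c (⊖ 1ᶠ) ⊖1≢0)
        (cong (fibre f a b) (S.solve 1 (λ c → S.:- S.:1 S.:* c S.:= S.:- c) refl c))

      stable-fibre : ∀ {f} → Stable f → (τ : LinearIsometry m n) → to τ Y ≡ Y → ∀ a b a′ b′ c →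
        (∀ z → bil a (to τ z) b ≡ bil a′ z b′) → fibre f a b c ≡ fibre f a′ b′ c
      stable-fibre {f} st τ fix a b a′ b′ c h = sym (fibre-reindex f a′ b′ c a b c (to τ) (from τ) (from-to τ) (to-from τ)
        (λ z _ → st τ fix z) (λ z e → trans (h z) e) (λ z e → trans (sym (h z)) e))

      -- Scaling by -1 along Y v on the left and along v on the right fixes Y and negates aᵗ z b.
      stable-even : ∀ {f} → Stable f → ∀ a b c v → bil a Y v ≡ 1ᶠ → bil a Y b ≡ 0ᶠ → fibre f a b c ≡ fibre f a b (⊖ c)
      stable-even {f} st a b c v av ab = begin
        fibre f a b c
          ≡⟨ stable-fibre st stabilizer stabilizer-fixes a b (⊖ 1ᶠ *ᵛ a) b c (λ z → begin
               bil a (to stabilizer z) b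
                 ≡⟨ bil-stabilizer a z b ⟩
               _
                 ≡⟨ cong₂ (λ x y → (bil a z b +ᶠ (-2ᶠ *ᶠ x) *ᶠ bil a z b) +ᶠ (-2ᶠ *ᶠ y) *ᶠ (bil a z v +ᶠ (-2ᶠ *ᶠ x) *ᶠ bil a z v)) av ab ⟩
               (bil a z b +ᶠ (-2ᶠ *ᶠ 1ᶠ) *ᶠ bil a z b) +ᶠ (-2ᶠ *ᶠ 0ᶠ) *ᶠ (bil a z v +ᶠ (-2ᶠ *ᶠ 1ᶠ) *ᶠ bil a z v)
                 ≡⟨ S.solve 2 (λ x y → let t = S.:- (S.:1 S.:+ S.:1) in
                      (x S.:+ (t S.:* S.:1) S.:* x) S.:+ (t S.:* S.:0) S.:* (y S.:+ (t S.:* S.:1) S.:* y) S.:= S.:- S.:1 S.:* x) refl (bil a z b) (bil a z v) ⟩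
               ⊖ 1ᶠ *ᶠ bil a z b
                 ≡⟨ sym (bil-*ˡ (⊖ 1ᶠ) a z b) ⟩
               bil (⊖ 1ᶠ *ᵛ a) z b ∎) ⟩
        fibre f (⊖ 1ᶠ *ᵛ a) b c
          ≡⟨ cong (fibre f (⊖ 1ᶠ *ᵛ a) b) (S.solve 1 (λ c → c S.:= S.:- S.:1 S.:* S.:- c) refl c) ⟩
        fibre f (⊖ 1ᶠ *ᵛ a) b (⊖ 1ᶠ *ᶠ ⊖ c)
          ≡⟨ fibre-scaleˡ f a b (⊖ c) ⊖1≢0 ⟩
        fibre f a b (⊖ c) ∎
        where
        -- With e = aᵗ Y v = 1 both factors 1 + α e and 1 + β e are -1. In characteristic 2 the map
        -- is the identity, in agreement with -c = c.
        -2ᶠ = ⊖ (1ᶠ +ᶠ 1ᶠ)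
        fixes : -2ᶠ +ᶠ -2ᶠ +ᶠ -2ᶠ *ᶠ -2ᶠ *ᶠ bil a Y v ≡ 0ᶠ
        fixes = trans (cong (λ x → -2ᶠ +ᶠ -2ᶠ +ᶠ -2ᶠ *ᶠ -2ᶠ *ᶠ x) av)
          (S.solve 0 (let t = S.:- (S.:1 S.:+ S.:1) in t S.:+ t S.:+ t S.:* t S.:* S.:1 S.:= S.:0) refl)
        open Stabilizer Y a v -2ᶠ -2ᶠ fixes

      private
        zero-fix : ∀ α β {e} → α +ᶠ β ≡ 0ᶠ → e ≡ 0ᶠ → α +ᶠ β +ᶠ α *ᶠ β *ᶠ e ≡ 0ᶠ
        zero-fix α β h refl = trans (cong (_+ᶠ α *ᶠ β *ᶠ 0ᶠ) h) (S.solve 1 (λ x → S.:0 S.:+ x S.:* S.:0 S.:= S.:0) refl (α *ᶠ β))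

      -- For v = b′ - b one has aᵗ Y v = 0, so α = -1 and β = 1 fix Y. The right factor then sends b
      -- to b + (aᵗ Y b) v = b′, while aᵗ is unchanged by the left factor.
      stable-moveʳ : ∀ {f} → Stable f → ∀ a b b′ c → bil a Y b ≡ 1ᶠ → bil a Y b′ ≡ 1ᶠ → fibre f a b c ≡ fibre f a b′ c
      stable-moveʳ {f} st a b b′ c ab ab′ = stable-fibre st stabilizer stabilizer-fixes a b a b′ c (λ z → begin
        bil a (to stabilizer z) b
          ≡⟨ bil-stabilizer a z b ⟩
        _
          ≡⟨ cong₂ (λ x y → (bil a z b +ᶠ (⊖ 1ᶠ *ᶠ x) *ᶠ bil a z b) +ᶠ (1ᶠ *ᶠ y) *ᶠ (bil a z v +ᶠ (⊖ 1ᶠ *ᶠ x) *ᶠ bil a z v)) av ab ⟩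
        (bil a z b +ᶠ (⊖ 1ᶠ *ᶠ 0ᶠ) *ᶠ bil a z b) +ᶠ (1ᶠ *ᶠ 1ᶠ) *ᶠ (bil a z v +ᶠ (⊖ 1ᶠ *ᶠ 0ᶠ) *ᶠ bil a z v)
          ≡⟨ cong (λ y → (bil a z b +ᶠ (⊖ 1ᶠ *ᶠ 0ᶠ) *ᶠ bil a z b) +ᶠ (1ᶠ *ᶠ 1ᶠ) *ᶠ (y +ᶠ (⊖ 1ᶠ *ᶠ 0ᶠ) *ᶠ y)) (difference z) ⟩
        _
          ≡⟨ S.solve 2 (λ x y → (x S.:+ (S.:- S.:1 S.:* S.:0) S.:* x) S.:+ (S.:1 S.:* S.:1) S.:* ((y S.:- x) S.:+ (S.:- S.:1 S.:* S.:0) S.:* (y S.:- x)) S.:= y) refl (bil a z b) (bil a z b′) ⟩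
        bil a z b′ ∎)
        where
        v = b′ -ᵛ b
        difference : ∀ (z : Mat m n) → bil a z v ≡ bil a z b′ -ᶠ bil a z b
        difference z = trans (cong (a ∙_) (⋆--ʳ z b′ b)) (∙--ʳ a _ _)
        av : bil a Y v ≡ 0ᶠ
        av = trans (difference Y) (trans (cong₂ _-ᶠ_ ab′ ab) (Rᶠ.-‿inverseʳ 1ᶠ))
        open Stabilizer Y a v (⊖ 1ᶠ) 1ᶠ (zero-fix (⊖ 1ᶠ) 1ᶠ (Rᶠ.-‿inverseˡ 1ᶠ) av)

      -- The mirror image: w = a′ - a has wᵗ Y b = 0, and with α = 1 and β = -1 the left factor
      -- carries aᵗ to aᵗ + wᵗ.
      stable-moveˡ : ∀ {f} → Stable f → ∀ a a′ b c → bil a Y b ≡ 1ᶠ → bil a′ Y b ≡ 1ᶠ → fibre f a b c ≡ fibre f a′ b c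
      stable-moveˡ {f} st a a′ b c ab a′b = stable-fibre st stabilizer stabilizer-fixes a b a′ b c (λ z → begin
        bil a (to stabilizer z) b
          ≡⟨ bil-stabilizer a z b ⟩
        _
          ≡⟨ cong₂ (λ x y → (bil a z b +ᶠ (1ᶠ *ᶠ x) *ᶠ bil w z b) +ᶠ (⊖ 1ᶠ *ᶠ y) *ᶠ (bil a z b +ᶠ (1ᶠ *ᶠ x) *ᶠ bil w z b)) ab wb ⟩
        _
          ≡⟨ cong (λ y → (bil a z b +ᶠ (1ᶠ *ᶠ 1ᶠ) *ᶠ y) +ᶠ (⊖ 1ᶠ *ᶠ 0ᶠ) *ᶠ (bil a z b +ᶠ (1ᶠ *ᶠ 1ᶠ) *ᶠ y)) (∙--ˡ a′ a (z ⋆ b)) ⟩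
        _
          ≡⟨ S.solve 2 (λ x y → (x S.:+ (S.:1 S.:* S.:1) S.:* (y S.:- x)) S.:+ (S.:- S.:1 S.:* S.:0) S.:* (x S.:+ (S.:1 S.:* S.:1) S.:* (y S.:- x)) S.:= y) refl (bil a z b) (bil a′ z b) ⟩
        bil a′ z b ∎)
        where
        w = a′ -ᵛ a
        wb : bil w Y b ≡ 0ᶠ
        wb = trans (∙--ˡ a′ a (Y ⋆ b)) (trans (cong₂ _-ᶠ_ a′b ab) (Rᶠ.-‿inverseʳ 1ᶠ))
        open Stabilizer Y w b 1ᶠ (⊖ 1ᶠ) (zero-fix 1ᶠ (⊖ 1ᶠ) (Rᶠ.-‿inverseʳ 1ᶠ) wb)

      module _ {f : Mat m n → Carrier} (stable : Stable f) where

        gap : 𝕍 m → 𝕍 n → Carrier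
        gap a b = fibre f a b 0ᶠ - fibre f a b (bil a Y b)

        gap-scaleˡ : ∀ a b {μ} → μ ≢ 0ᶠ → gap (μ *ᵛ a) b ≡ gap a b
        gap-scaleˡ a b {μ} μ≢0 = cong₂ _-_
          (trans (cong (fibre f (μ *ᵛ a) b) (sym (Rᶠ.zeroʳ μ))) (fibre-scaleˡ f a b 0ᶠ μ≢0))
          (trans (cong (fibre f (μ *ᵛ a) b) (bil-*ˡ μ a Y b)) (fibre-scaleˡ f a b (bil a Y b) μ≢0))

        gap-scaleʳ : ∀ a b {μ} → μ ≢ 0ᶠ → gap a (μ *ᵛ b) ≡ gap a b
        gap-scaleʳ a b {μ} μ≢0 = cong₂ _-_
          (trans (cong (fibre f a (μ *ᵛ b)) (sym (Rᶠ.zeroʳ μ))) (fibre-scaleʳ f a b 0ᶠ μ≢0))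
          (trans (cong (fibre f a (μ *ᵛ b)) (bil-*ʳ a Y μ b)) (fibre-scaleʳ f a b (bil a Y b) μ≢0))

        gap-moveʳ : ∀ a b b′ → bil a Y b ≢ 0ᶠ → bil a Y b′ ≢ 0ᶠ → gap a b ≡ gap a b′
        gap-moveʳ a b b′ ab ab′ with inverse _ ab | inverse _ ab′
        ... | c , abc | c′ , abc′ = begin
          gap a b ≡⟨ sym (gap-scaleʳ a b (unit≢0 (trans (Rᶠ.*-comm c _) abc))) ⟩
          gap a (c *ᵛ b) ≡⟨ cong₂ _-_ (move 0ᶠ) (trans (cong (fibre f a (c *ᵛ b)) (trans unit (sym unit′))) (move _)) ⟩
          gap a (c′ *ᵛ b′) ≡⟨ gap-scaleʳ a b′ (unit≢0 (trans (Rᶠ.*-comm c′ _) abc′)) ⟩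
          gap a b′            ∎
          where
          unit = trans (bil-*ʳ a Y c b) (trans (Rᶠ.*-comm c _) abc)
          unit′ = trans (bil-*ʳ a Y c′ b′) (trans (Rᶠ.*-comm c′ _) abc′)
          move : ∀ x → fibre f a (c *ᵛ b) x ≡ fibre f a (c′ *ᵛ b′) x
          move x = stable-moveʳ stable a (c *ᵛ b) (c′ *ᵛ b′) x unit unit′

        gap-moveˡ : ∀ a a′ b → bil a Y b ≢ 0ᶠ → bil a′ Y b ≢ 0ᶠ → gap a b ≡ gap a′ b
        gap-moveˡ a a′ b ab a′b with inverse _ ab | inverse _ a′b
        ... | c , abc | c′ , abc′ = begin
          gap a b ≡⟨ sym (gap-scaleˡ a b (unit≢0 (trans (Rᶠ.*-comm c _) abc))) ⟩
          gap (c *ᵛ a) b ≡⟨ cong₂ _-_ (move 0ᶠ) (trans (cong (fibre f (c *ᵛ a) b) (trans unit (sym unit′))) (move _)) ⟩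
          gap (c′ *ᵛ a′) b ≡⟨ gap-scaleˡ a′ b (unit≢0 (trans (Rᶠ.*-comm c′ _) abc′)) ⟩
          gap a′ b            ∎
          where
          unit = trans (bil-*ˡ c a Y b) (trans (Rᶠ.*-comm c _) abc)
          unit′ = trans (bil-*ˡ c′ a′ Y b) (trans (Rᶠ.*-comm c′ _) abc′)
          move : ∀ x → fibre f (c *ᵛ a) b x ≡ fibre f (c′ *ᵛ a′) b x
          move x = stable-moveˡ stable (c *ᵛ a) (c′ *ᵛ a′) b x unit unit′

        -- One argument can be replaced while the other is kept. When aᵗ Y b′ and a′ᵗ Y b both
        -- vanish there is no direct route, but a + a′ pairs nontrivially with both b and b′ and
        -- serves as an intermediate point.
        gap-constant : ∀ a b a′ b′ → bil a Y b ≢ 0ᶠ → bil a′ Y b′ ≢ 0ᶠ → gap a b ≡ gap a′ b′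
        gap-constant a b a′ b′ ab a′b′ = decide (bil a Y b′ ≟ᶠ 0ᶠ) (bil a′ Y b ≟ᶠ 0ᶠ)
          where
          decide : Dec (bil a Y b′ ≡ 0ᶠ) → Dec (bil a′ Y b ≡ 0ᶠ) → gap a b ≡ gap a′ b′
          decide (no ab′) _ = trans (gap-moveʳ a b b′ ab ab′) (gap-moveˡ a a′ b′ ab′ a′b′)
          decide (yes _) (no a′b) = trans (gap-moveˡ a a′ b ab a′b) (gap-moveʳ a′ b b′ a′b a′b′)
          decide (yes ab′) (yes a′b) = begin
            gap a b ≡⟨ gap-moveˡ a a″ b ab a″b ⟩
            gap a″ b ≡⟨ gap-moveʳ a″ b b′ a″b a″b′ ⟩
            gap a″ b′ ≡⟨ gap-moveˡ a″ a′ b′ a″b′ a′b′ ⟩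
            gap a′ b′           ∎
            where
            a″ = a +ᵛ a′
            a″b : bil a″ Y b ≢ 0ᶠ
            a″b e = ab (trans (sym (trans (bil-+ˡ a a′ Y b) (trans (cong (bil a Y b +ᶠ_) a′b) (Rᶠ.+-identityʳ _)))) e)
            a″b′ : bil a″ Y b′ ≢ 0ᶠ
            a″b′ e = a′b′ (trans (sym (trans (bil-+ˡ a a′ Y b′) (trans (cong (_+ᶠ bil a′ Y b′) ab′) (Rᶠ.+-identityˡ _)))) e)

        module _ (symmetric : Symmetric f) (even : Even f) where

          -- With e = aᵗ Y b: for e = 0 evenness makes both sides zero; c = 0 and c = e give the gap
          -- with opposite signs; in the remaining case a is divided by e, and symmetry makes the
          -- two fibres equal.
          fibre-difference : ∀ l → (∀ a b → bil a Y b ≢ 0ᶠ → gap a b ≡ l) → ∀ a b c →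
            fibre f a b c - fibre f a b (bil a Y b -ᶠ c) ≡ l * (𝟙 (c ≟ᶠ 0ᶠ) - 𝟙 (c ≟ᶠ bil a Y b))
          fibre-difference l gap≡l a b c = decide (bil a Y b ≟ᶠ 0ᶠ) (c ≟ᶠ 0ᶠ) (c ≟ᶠ bil a Y b)
            where
            e = bil a Y b
            decide : Dec (e ≡ 0ᶠ) → (p : Dec (c ≡ 0ᶠ)) (r : Dec (c ≡ e)) →
              fibre f a b c - fibre f a b (e -ᶠ c) ≡ l * (𝟙 p - 𝟙 r)
            decide (yes e≡0) p r = begin
              fibre f a b c - fibre f a b (e -ᶠ c)
                ≡⟨ cong₂ _-_ (even a b c e≡0) (cong (fibre f a b) (trans (cong (_-ᶠ c) e≡0) (Rᶠ.+-identityˡ _))) ⟩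
              fibre f a b (⊖ c) - fibre f a b (⊖ c)
                ≡⟨ solve 3 (λ x l p → x :- x := l :* (p :- p)) refl _ l (𝟙 r) ⟩
              l * (𝟙 r - 𝟙 r)
                ≡⟨ cong (λ x → l * (x - 𝟙 r)) (𝟙-cong r p (λ h → trans h e≡0) (λ h → trans h (sym e≡0))) ⟩
              l * (𝟙 p - 𝟙 r) ∎
            decide (no e≢0) (yes refl) (yes h) = contradiction (sym h) e≢0
            decide (no e≢0) (yes refl) (no _) = begin
              fibre f a b 0ᶠ - fibre f a b (e -ᶠ 0ᶠ)
                ≡⟨ cong (λ x → fibre f a b 0ᶠ - fibre f a b x) (S.solve 1 (λ e → e S.:- S.:0 S.:= e) refl e) ⟩
              gap a b
                ≡⟨ gap≡l a b e≢0 ⟩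
              l
                ≡⟨ solve 1 (λ l → l := l :* (:1 :- :0)) refl l ⟩
              l * (1# - 0#) ∎
            decide (no e≢0) (no _) (yes h) = begin
              fibre f a b c - fibre f a b (e -ᶠ c)
                ≡⟨ cong₂ (λ x y → fibre f a b x - fibre f a b y) h (trans (cong (e -ᶠ_) h) (Rᶠ.-‿inverseʳ e)) ⟩
              fibre f a b e - fibre f a b 0ᶠ
                ≡⟨ solve 2 (λ x y → x :- y := (y :- x) :* (:0 :- :1)) refl _ _ ⟩
              gap a b * (0# - 1#)
                ≡⟨ cong (_* (0# - 1#)) (gap≡l a b e≢0) ⟩
              l * (0# - 1#) ∎
            decide (no e≢0) (no c≢0) (no c≢e) with inverse e e≢0
            ... | i , ei = begin
              fibre f a b c - fibre f a b (e -ᶠ c)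
                ≡⟨ cong₂ _-_ (sym (fibre-scaleˡ f a b c i≢0)) (sym (fibre-scaleˡ f a b (e -ᶠ c) i≢0)) ⟩
              fibre f a′ b (i *ᶠ c) - fibre f a′ b (i *ᶠ (e -ᶠ c))
                ≡⟨ cong₂ _-_ (symmetric a′ b (i *ᶠ c) (trans (bil-*ˡ i a Y b) ie)
                     (λ h → c≢0 (integralᶠ i≢0 h)) (λ h → c≢e (*ᶠ-cancelˡ i≢0 (trans h (sym ie)))))
                     (cong (fibre f a′ b) (trans (S.solve 3 (λ i e c → i S.:* (e S.:- c) S.:= i S.:* e S.:- i S.:* c) refl i e c) (cong (_-ᶠ i *ᶠ c) ie))) ⟩
              fibre f a′ b (1ᶠ -ᶠ i *ᶠ c) - fibre f a′ b (1ᶠ -ᶠ i *ᶠ c)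
                ≡⟨ solve 2 (λ x l → x :- x := l :* (:0 :- :0)) refl _ l ⟩
              l * (0# - 0#) ∎
              where
              ie = trans (Rᶠ.*-comm i e) ei
              i≢0 = unit≢0 ie
              a′ = i *ᵛ a

          private
            ∑∑ : (𝕍 m → 𝕍 n → Carrier) → Carrier
            ∑∑ h = ∑ (𝕧 m) (λ a → ∑ (𝕧 n) (h a))

            ∑∑-cong : ∀ {g h} → (∀ a b → g a b ≡ h a b) → ∑∑ g ≡ ∑∑ h
            ∑∑-cong e = ∑-cong (𝕧 m) (λ a → ∑-cong (𝕧 n) (e a))

            ∑∑-- : ∀ g h → ∑∑ (λ a b → g a b - h a b) ≡ ∑∑ g - ∑∑ h
            ∑∑-- g h = trans (∑-cong (𝕧 m) (λ a → ∑-- (𝕧 n) _ _)) (∑-- (𝕧 m) _ _)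

            ∑∑-*ˡ : ∀ c g → ∑∑ (λ a b → c * g a b) ≡ c * ∑∑ g
            ∑∑-*ˡ c g = trans (∑-cong (𝕧 m) (λ a → ∑-*ˡ (𝕧 n) c _)) (∑-*ˡ (𝕧 m) c _)

            P = (Q - 1#) * pw m

            κ-χ : ∀ d → P * κ d ≡ ∑∑ (λ a b → χ (bil a d b))
            κ-χ d = begin
              P * κ d ≡⟨ solve 3 (λ q p k → (q :* p) :* k := (p :* k) :* q) refl (Q - 1#) (pw m) (κ d) ⟩
              (pw m * κ d) * (Q - 1#) ≡⟨ cong ((pw m * κ d) *_) (sym χ-0) ⟩
              (pw m * κ d) * χ 0ᶠ ≡⟨ sym (∑∑-χ d 0ᶠ) ⟩
              ∑∑ (λ a b → χ (0ᶠ -ᶠ bil a d b)) ≡⟨ ∑∑-cong (λ a b → χ-neg _) ⟩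
              ∑∑ (λ a b → χ (bil a d b))               ∎

            -- `t a b` is the value of aᵗ z b at which aᵗ ψ(z) b vanishes. Once κ (ψ z) is expanded
            -- over all (a , b), each `χ` contributes Q on that fibre and -1 everywhere, so only
            -- fibres of f and its total weight remain.
            weighted : (ψ : Mat m n → Mat m n) (t : 𝕍 m → 𝕍 n → 𝔽) →
              (∀ a b z → bil a (ψ z) b ≡ 0ᶠ → bil a z b ≡ t a b) → (∀ a b z → bil a z b ≡ t a b → bil a (ψ z) b ≡ 0ᶠ) →
              P * ∑ X (λ z → f z * κ (ψ z)) ≡ ∑∑ (λ a b → Q * fibre f a b (t a b) - ∑ X f)
            weighted ψ t g h = begin
              P * ∑ X (λ z → f z * κ (ψ z))
                ≡⟨ sym (∑-*ˡ X P _) ⟩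
              ∑ X (λ z → P * (f z * κ (ψ z)))
                ≡⟨ ∑-cong X (λ z → trans (solve 3 (λ p f k → p :* (f :* k) := f :* (p :* k)) refl P (f z) (κ (ψ z)))
                     (trans (cong (f z *_) (κ-χ (ψ z))) (sym (∑∑-*ˡ (f z) _)))) ⟩
              ∑ X (λ z → ∑∑ (λ a b → f z * χ (bil a (ψ z) b)))
                ≡⟨ trans (∑-swap X (𝕧 m) _) (∑-cong (𝕧 m) (λ a → ∑-swap X (𝕧 n) _)) ⟩
              ∑∑ (λ a b → ∑ X (λ z → f z * χ (bil a (ψ z) b)))
                ≡⟨ ∑∑-cong (λ a b → trans (∑-cong X (λ z → trans (cong (f z *_) (trans (χ-def _)
                       (cong (λ x → Q * x - 1#) (𝟙-cong (bil a (ψ z) b ≟ᶠ 0ᶠ) (bil a z b ≟ᶠ t a b) (g a b z) (h a b z)))))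
                       (solve 3 (λ f q x → f :* (q :* x :- :1) := q :* (x :* f) :- f) refl (f z) Q (𝟙 (bil a z b ≟ᶠ t a b)))))
                     (trans (∑-- X _ _) (cong (_- ∑ X f) (trans (∑-*ˡ X Q _) (cong (Q *_) (sym (fibre-def f a b (t a b)))))))) ⟩
              ∑∑ (λ a b → Q * fibre f a b (t a b) - ∑ X f) ∎

          -- The total weights of f cancel between the two sums. With c = aᵗ u b and e = aᵗ Y b, the
          -- remaining Q l ([c = 0] - [c = e]) is l (χ c - χ (c - e)), and summing over a and b
          -- returns kernel counts.
          balanced-with : ∀ l → (∀ a b → bil a Y b ≢ 0ᶠ → gap a b ≡ l) → ∀ u →
            ∑ X (λ z → f z * (κ (u -ᴹ z) - κ (u -ᴹ (Y -ᴹ z)))) ≡ l * (κ u - κ (u -ᴹ Y))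
          balanced-with l gap≡l u = *-cancelˡ P P≢0 (begin
            P * ∑ X (λ z → f z * (κ (u -ᴹ z) - κ (u -ᴹ (Y -ᴹ z))))
              ≡⟨ cong (P *_) (trans (∑-cong X (λ z → solve 3 (λ f x y → f :* (x :- y) := f :* x :- f :* y) refl (f z) _ _)) (∑-- X _ _)) ⟩
            P * (∑ X (λ z → f z * κ (u -ᴹ z)) - ∑ X (λ z → f z * κ (u -ᴹ (Y -ᴹ z))))
              ≡⟨ solve 3 (λ p x y → p :* (x :- y) := p :* x :- p :* y) refl P _ _ ⟩
            P * ∑ X (λ z → f z * κ (u -ᴹ z)) - P * ∑ X (λ z → f z * κ (u -ᴹ (Y -ᴹ z)))
              ≡⟨ cong₂ _-_
                   (weighted (u -ᴹ_) (λ a b → bil a u b)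
                     (λ a b z e → sym (-ᶠ≡0 (trans (sym (bil-- a u z b)) e)))
                     (λ a b z e → trans (bil-- a u z b) (trans (cong (bil a u b -ᶠ_) e) (Rᶠ.-‿inverseʳ _))))
                   (weighted (λ z → u -ᴹ (Y -ᴹ z)) (λ a b → bil a Y b -ᶠ bil a u b)
                     (λ a b z e → -ᶠ≡0 (trans (S.solve 3 (λ u y z → z S.:- (y S.:- u) S.:= u S.:- (y S.:- z)) refl (bil a u b) (bil a Y b) (bil a z b)) (trans (sym (bil-u-Y-z a b z)) e)))
                     (λ a b z e → trans (bil-u-Y-z a b z) (trans (cong (λ x → bil a u b -ᶠ (bil a Y b -ᶠ x)) e)
                       (S.solve 2 (λ u y → u S.:- (y S.:- (y S.:- u)) S.:= S.:0) refl (bil a u b) (bil a Y b))))) ⟩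
            ∑∑ (λ a b → Q * fibre f a b (bil a u b) - ∑ X f) - ∑∑ (λ a b → Q * fibre f a b (bil a Y b -ᶠ bil a u b) - ∑ X f)
              ≡⟨ sym (∑∑-- _ _) ⟩
            ∑∑ (λ a b → (Q * fibre f a b (bil a u b) - ∑ X f) - (Q * fibre f a b (bil a Y b -ᶠ bil a u b) - ∑ X f))
              ≡⟨ ∑∑-cong (λ a b → trans
                   (solve 4 (λ q x y s → (q :* x :- s) :- (q :* y :- s) := q :* (x :- y)) refl Q _ _ (∑ X f))
                   (trans (cong (Q *_) (fibre-difference l gap≡l a b (bil a u b)))
                     (trans (solve 4 (λ q l x y → q :* (l :* (x :- y)) := l :* ((q :* x :- :1) :- (q :* y :- :1))) refl Q l _ _)
                       (cong (l *_) (cong₂ _-_ (sym (χ-def _)) (trans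
                         (cong (λ x → Q * x - 1#) (𝟙-cong (bil a u b ≟ᶠ bil a Y b) (bil a u b -ᶠ bil a Y b ≟ᶠ 0ᶠ)
                           (λ e → trans (cong (_-ᶠ bil a Y b) e) (Rᶠ.-‿inverseʳ _)) -ᶠ≡0))
                         (sym (trans (cong χ (bil-- a u Y b)) (χ-def _))))))))) ⟩
            ∑∑ (λ a b → l * (χ (bil a u b) - χ (bil a (u -ᴹ Y) b)))
              ≡⟨ trans (∑∑-*ˡ l _) (cong (l *_) (∑∑-- _ _)) ⟩
            l * (∑∑ (λ a b → χ (bil a u b)) - ∑∑ (λ a b → χ (bil a (u -ᴹ Y) b)))
              ≡⟨ cong (l *_) (cong₂ _-_ (sym (κ-χ u)) (sym (κ-χ (u -ᴹ Y)))) ⟩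
            l * (P * κ u - P * κ (u -ᴹ Y))
              ≡⟨ solve 4 (λ l p x y → l :* (p :* x :- p :* y) := p :* (l :* (x :- y))) refl l P _ _ ⟩
            P * (l * (κ u - κ (u -ᴹ Y))) ∎)
            where
            bil-u-Y-z : ∀ a b z → bil a (u -ᴹ (Y -ᴹ z)) b ≡ bil a u b -ᶠ (bil a Y b -ᶠ bil a z b)
            bil-u-Y-z a b z = trans (bil-- a u _ b) (cong (bil a u b -ᶠ_) (bil-- a Y z b))
            P≢0 : P ≢ 0#
            P≢0 e = pw≢0 m (*-cancelˡ (Q - 1#) Q-1≢0 (trans e (sym (zeroʳ (Q - 1#)))))

          balanced : Y ≢ 0ᴹ → Balanced f
          balanced Y≢0 with nonzero-bil Y Y≢0
          ... | a , b , ab = gap a b , balanced-with (gap a b)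
            (λ a′ b′ h → gap-constant a′ b′ a b h (λ e → 1≢0 (trans (sym ab) e)))

-- Booleans, decisions and propositions.

T-ext : ∀ {x y} → (T x → T y) → (T y → T x) → x ≡ y
T-ext {true} {true} f g = refl
T-ext {true} {false} f g = contradiction (f _) λ ()
T-ext {false} {true} f g = contradiction (g _) λ ()
T-ext {false} {false} f g = refl

T-does : {P : Set} (p : Dec P) → T (does p) → P
T-does (yes p) _ = p

does-T : {P : Set} (p : Dec P) → P → T (does p)
does-T (yes _) _ = _
does-T (no ¬p) p = contradiction p ¬p

T-not : ∀ {x} → T (not x) → ¬ T x
T-not {false} _ ()

not-T : ∀ {x} → ¬ T x → T (not x)
not-T {true} f = contradiction _ f
not-T {false} f = _

any⇒∃ : {A : Set} (p : A → Bool) (xs : List A) → T (any p xs) → ∃ λ a → T (p a)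
any⇒∃ p xs t = Any.satisfied (Anyₚ.any⁻ p xs t)

∃⇒any : {A : Set} (p : A → Bool) {xs : List A} {a : A} → a ∈ xs → T (p a) → T (any p xs)
∃⇒any p m t = Anyₚ.any⁺ p (lose m t)

lookup-ext : {A : Set} {n : ℕ} {u v : Vec A n} → (∀ i → lookup u i ≡ lookup v i) → u ≡ v
lookup-ext {u = u} {v} e = trans (sym (Vecₚ.tabulate∘lookup u)) (trans (Vecₚ.tabulate-cong e) (Vecₚ.tabulate∘lookup v))

-- Adjacency and distance in terms of rank; automorphisms.

module Graph (K : CharacteristicZeroDomain) (F : FiniteField) (D N : ℕ) where

  open Balance K F public
  open ≡-Reasoning
  module B = Bilinear F D N
  open B using (X; M)

  private
    module Rᶠ = CommutativeRing ringᶠ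
    module S = IntegerSolver ringᶠ

  column-⊗ : ∀ (s : 𝕍 D) (t : 𝕍 M) j → B.column (s ⊗ t) j ≡ lookup t j *ᵛ s
  column-⊗ s t j = trans (sym (Vecₚ.map-∘ _ _ s))
    (Vecₚ.map-cong (λ x → trans (Vecₚ.lookup-map j (x *ᶠ_) t) (Rᶠ.*-comm x _)) s)

  columns-⊗ : ∀ (d : X) (s : 𝕍 D) (c : Fin M → 𝔽) → (∀ j → B.column d j ≡ c j *ᵛ s) → d ≡ s ⊗ Vec.tabulate c
  columns-⊗ d s c h = lookup-ext (λ i → lookup-ext (λ j → begin
    lookup (lookup d i) j ≡⟨ sym (Vecₚ.lookup-map i _ d) ⟩
    lookup (B.column d j) i ≡⟨ cong (λ v → lookup v i) (h j) ⟩
    lookup (c j *ᵛ s) i ≡⟨ cong (λ x → lookup (x *ᵛ s) i) (sym (Vecₚ.lookup∘tabulate c j)) ⟩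
    lookup (lookup (Vec.tabulate c) j *ᵛ s) i ≡⟨ cong (λ v → lookup v i) (sym (column-⊗ s (Vec.tabulate c) j)) ⟩
    lookup (B.column (s ⊗ Vec.tabulate c) j) i ≡⟨ Vecₚ.lookup-map i _ (s ⊗ Vec.tabulate c) ⟩
    lookup (lookup (s ⊗ Vec.tabulate c) i) j           ∎))

  private
    nonzero⇒T : ∀ (v : 𝕍 D) → v ≢ 0ᵛ → T (not (B.isZeroD v))
    nonzero⇒T v v≢0 = not-T (λ t → v≢0 (toWitness t))

    T⇒nonzero : ∀ (v : 𝕍 D) → T (not (B.isZeroD v)) → v ≢ 0ᵛ
    T⇒nonzero v t e = T-not t (fromWitness e)

  rankOne⇒ : ∀ d → T (B.rankOne d) → rank d ≡ 1
  rankOne⇒ d t with Equivalence.to T-∧ t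
  ... | t₁ , t₂ with any⇒∃ _ (List.allFin M) t₁ | any⇒∃ _ (allVecsOf B.allF D) t₂
  ...   | j , dj≢0 | s , t₃ with Equivalence.to T-∧ t₃
  ...     | s≢0 , t₄ = trans (cong rank d≡) (rank-⊗ (T⇒nonzero s s≢0)
              (λ e → T⇒nonzero (B.column d j) dj≢0 (trans (proj₂ (scalar j)) (trans
                (cong (_*ᵛ s) (trans (sym (Vecₚ.lookup∘tabulate (proj₁ ∘ scalar) j))
                  (trans (cong (λ v → lookup v j) e) (Vecₚ.lookup-replicate j 0ᶠ)))) (*ᵛ-0 s)))))
    where
    scalar : ∀ j → ∃ λ c → B.column d j ≡ c *ᵛ s
    scalar j with any⇒∃ _ B.allF (All.lookup (Allₚ.all⁺ _ (List.allFin M) t₄) (∈-allFin j))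
    ... | c , e = c , toWitness e
    d≡ : d ≡ s ⊗ Vec.tabulate (proj₁ ∘ scalar)
    d≡ = columns-⊗ d s (proj₁ ∘ scalar) (proj₂ ∘ scalar)

  rankOne⇐ : ∀ d → rank d ≡ 1 → T (B.rankOne d)
  rankOne⇐ d h with rank≡1⇒dyad d h
  ... | s , t , s≢0 , t≢0 , refl with Finₚ.¬∀⟶∃¬ M (λ j → lookup t j ≡ 0ᶠ) (λ j → lookup t j ≟ᶠ 0ᶠ)
          (λ z → t≢0 (lookup-ext (λ j → trans (z j) (sym (Vecₚ.lookup-replicate j 0ᶠ)))))
  ...   | j , tj≢0 = Equivalence.from T-∧
            ( ∃⇒any _ {List.allFin M} (∈-allFin j)
                (nonzero⇒T _ (λ e → *ᵛ-≢0 tj≢0 s≢0 (trans (sym (column-⊗ s t j)) e)))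
            , ∃⇒any _ (complete (𝕧 D) s) (Equivalence.from T-∧
                ( nonzero⇒T s s≢0
                , Allₚ.all⁻ _ (All.tabulate {xs = List.allFin M} (λ {i} _ →
                    ∃⇒any _ (complete 𝕗 (lookup t i)) (fromWitness (column-⊗ s t i)))))))

  adj⇒ : ∀ a b → T (B.adj a b) → rank (a -ᴹ b) ≡ 1
  adj⇒ a b = rankOne⇒ (a -ᴹ b)

  adj-rank : ∀ a b → B.adj a b ≡ does (rank (a -ᴹ b) ℕ.≟ 1)
  adj-rank a b = T-ext (λ t → does-T (_ ℕ.≟ 1) (adj⇒ a b t)) (λ t → rankOne⇐ (a -ᴹ b) (T-does (_ ℕ.≟ 1) t))

  Lowers⇒nonzero : ∀ {m n} {d : Mat m n} {s t} → Lowers d s t → s ≢ 0ᵛ × t ≢ 0ᵛ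
  Lowers⇒nonzero {d = d} {s} {t} (w , r , dw , dr , tw) =
    ∙≡1⇒≢0 {a = r} (trans (cong (r ∙_) (sym dw)) (trans (sym (ᵀ⋆-∙ d r w)) (trans (cong (_∙ w) dr) tw))) ,
    ∙≡1⇒≢0 {a = w} (trans (∙-comm w t) tw)

  -- Each edge of a path changes the difference by a dyad, hence its rank by at most one.
  withinW⇒ : ∀ n a b → T (B.withinW n a b) → rank (a -ᴹ b) ℕ.≤ n
  withinW⇒ zero a b t = ℕₚ.≤-reflexive (trans (cong rank (trans (cong (_-ᴹ b) (toWitness t)) (-ᴹ-self b))) (rank-0 {D} {M}))
  withinW⇒ (suc n) a b t with B.withinW n a b in eq
  ... | true = ℕₚ.m≤n⇒m≤1+n (withinW⇒ n a b (subst T (sym eq) _))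
  ... | false with any⇒∃ _ B.allX t
  ...   | w , t′ with Equivalence.to T-∧ t′
  ...     | near , edge = combine (rank≡1⇒dyad (w -ᴹ b) (adj⇒ w b edge)) (withinW⇒ n a w near)
    where
    combine : (∃₂ λ s t → s ≢ 0ᵛ × t ≢ 0ᵛ × w -ᴹ b ≡ s ⊗ t) → rank (a -ᴹ w) ℕ.≤ n → rank (a -ᴹ b) ℕ.≤ suc n
    combine (s , t , _ , _ , e) le = ℕₚ.≤-trans (rank-dyad-bound (a -ᴹ b) s t)
      (ℕ.s≤s (subst (λ d → rank d ℕ.≤ n) (trans
        (matrix-identity (⌈ a ⌉ ⊟ ⌈ w ⌉) (⌈ a ⌉ ⊟ ⌈ b ⌉ ⊟ (⌈ w ⌉ ⊟ ⌈ b ⌉))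
          (λ x y → S.solve 3 (λ a b w → a S.:- w S.:= (a S.:- b) S.:- (w S.:- b)) refl _ (bil x b y) _))
        (cong (a -ᴹ b -ᴹ_) e)) le))

  -- A dyad s ⊗ t lowering the rank of a - b supplies the last edge: w = b + s ⊗ t is adjacent to b
  -- and closer to a by one.
  withinW⇐ : ∀ n a b → rank (a -ᴹ b) ℕ.≤ n → T (B.withinW n a b)
  withinW⇐ zero a b le = fromWitness (-ᴹ≡0 (rank≡0⇒≡0 _ (ℕₚ.n≤0⇒n≡0 le)))
  withinW⇐ (suc n) a b le with B.withinW n a b in eq
  ... | true = _
  ... | false = combine (nonzero-lowers (a -ᴹ b) nonzero)
    where
    r≡ : rank (a -ᴹ b) ≡ suc n
    r≡ = ℕₚ.≤-antisym le (ℕₚ.≰⇒> (λ le′ → subst T eq (withinW⇐ n a b le′)))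
    nonzero : a -ᴹ b ≢ 0ᴹ
    nonzero e = contradiction (trans (sym (rank-0 {D} {M})) (trans (cong rank (sym e)) r≡)) λ ()
    combine : ∃₂ (Lowers (a -ᴹ b)) → T (any (λ w → B.withinW n a w ∧ B.adj w b) B.allX)
    combine (s , t , l) = ∃⇒any _ (complete (𝕞 D M) w) (Equivalence.from T-∧
      ( withinW⇐ n a w (ℕₚ.≤-reflexive (ℕₚ.suc-injective (trans (cong (suc ∘ rank) a-w) (trans (sym (lowers⇒rank l)) r≡))))
      , rankOne⇐ (w -ᴹ b) (trans (cong rank w-b) (rank-⊗ (proj₁ (Lowers⇒nonzero l)) (proj₂ (Lowers⇒nonzero l))))))
      where
      w = b +ᴹ s ⊗ t
      a-w : a -ᴹ w ≡ a -ᴹ b -ᴹ s ⊗ t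
      a-w = matrix-identity (⌈ a ⌉ ⊟ (⌈ b ⌉ ⊞ s ⊡ t)) (⌈ a ⌉ ⊟ ⌈ b ⌉ ⊟ s ⊡ t)
        (λ x y → S.solve 3 (λ a b c → a S.:- (b S.:+ c) S.:= (a S.:- b) S.:- c) refl (bil x a y) (bil x b y) ((x ∙ s) *ᶠ (t ∙ y)))
      w-b : w -ᴹ b ≡ s ⊗ t
      w-b = matrix-identity (⌈ b ⌉ ⊞ s ⊡ t ⊟ ⌈ b ⌉) (s ⊡ t)
        (λ x y → S.solve 2 (λ b c → (b S.:+ c) S.:- b S.:= c) refl (bil x b y) ((x ∙ s) *ᶠ (t ∙ y)))

  isDist-rank : ∀ i a b → B.isDist i a b ≡ does (rank (a -ᴹ b) ℕ.≟ i)
  isDist-rank zero a b = T-ext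
    (λ t → does-T (_ ℕ.≟ 0) (ℕₚ.n≤0⇒n≡0 (withinW⇒ 0 a b t)))
    (λ t → withinW⇐ 0 a b (ℕₚ.≤-reflexive (T-does (_ ℕ.≟ 0) t)))
  isDist-rank (suc i) a b = T-ext
    (λ t → let (w , ¬w) = Equivalence.to T-∧ t in does-T (_ ℕ.≟ suc i)
      (ℕₚ.≤-antisym (withinW⇒ (suc i) a b w) (ℕₚ.≰⇒> (λ le → T-not ¬w (withinW⇐ i a b le)))))
    (λ t → let e = T-does (_ ℕ.≟ suc i) t in Equivalence.from T-∧
      ( withinW⇐ (suc i) a b (ℕₚ.≤-reflexive e)
      , not-T (λ w → ℕₚ.1+n≰n (ℕₚ.≤-trans (ℕₚ.≤-reflexive (sym e)) (withinW⇒ i a b w)))))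

  fromℕ-card : ∀ S → fromℕ (B.card S) ≡ ∑ (𝕞 D M) (λ z → ind (S z))
  fromℕ-card S = sym (sumOver-ind B.allX S)

  card-cong : ∀ {S S′} → (∀ z → S z ≡ S′ z) → B.card S ≡ B.card S′
  card-cong {S} {S′} e = fromℕ-injective (trans (fromℕ-card S) (trans (∑-cong (𝕞 D M) (λ z → cong ind (e z))) (sym (fromℕ-card S′))))

  record Automorphism : Set where
    field
      act inv : X → X
      inv-act : ∀ z → inv (act z) ≡ z
      act-inv : ∀ z → act (inv z) ≡ z
      rank-act : ∀ a b → rank (act a -ᴹ act b) ≡ rank (a -ᴹ b)

    card-act : ∀ S → B.card (λ z → S (act z)) ≡ B.card S
    card-act S = fromℕ-injective (trans (fromℕ-card _) (trans
      (∑-reindex (𝕞 D M) (𝕞 D M) act inv inv-act act-inv (λ z → ind (S z))) (sym (fromℕ-card S))))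

    adj-act : ∀ a b → B.adj (act a) (act b) ≡ B.adj a b
    adj-act a b = trans (adj-rank _ _) (trans (cong (λ r → does (r ℕ.≟ 1)) (rank-act a b)) (sym (adj-rank a b)))

    isDist-act : ∀ i a b → B.isDist i (act a) (act b) ≡ B.isDist i a b
    isDist-act i a b = trans (isDist-rank i _ _) (trans (cong (λ r → does (r ℕ.≟ i)) (rank-act a b)) (sym (isDist-rank i a b)))

    private
      count-act : ∀ x y z i → B.card (λ w → B.adj (act x) w ∧ B.adj (act z) w ∧ B.isDist i (act y) w)
        ≡ B.card (λ w → B.adj x w ∧ B.adj z w ∧ B.isDist i y w)
      count-act x y z i = trans (sym (card-act _))
        (card-cong (λ w → cong₂ _∧_ (adj-act x w) (cong₂ _∧_ (adj-act z w) (isDist-act i y w))))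

    -- The sets are defined by adjacency, distances and cardinalities alone; reindexing the counted
    -- vertices handles the last of these.
    O-act : ∀ x y k i z → B.O (act x) (act y) k i (act z) ≡ B.O x y k i z
    O-act x y k Fin.zero z = cong₂ _∧_ (adj-act x z) (isDist-act (k ℕ.∸ 1) y z)
    O-act x y k (Fin.suc Fin.zero) z = cong₂ _∧_ (adj-act x z) (cong₂ _∧_ (isDist-act k y z)
      (cong₂ (λ a b → (a ℕ.≡ᵇ _) ∧ (b ℕ.≡ᵇ 0)) (count-act x y z (k ℕ.∸ 1)) (count-act x y z (suc k))))
    O-act x y k (Fin.suc (Fin.suc Fin.zero)) z = cong₂ _∧_ (adj-act x z) (cong₂ _∧_ (isDist-act k y z)
      (cong₂ (λ a b → (a ℕ.≡ᵇ _) ∧ (b ℕ.≡ᵇ 0)) (count-act x y z (k ℕ.∸ 1)) (count-act x y z (suc k))))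
    O-act x y k (Fin.suc (Fin.suc (Fin.suc Fin.zero))) z = cong₂ _∧_ (adj-act x z) (cong₂ _∧_ (isDist-act k y z)
      (cong₂ (λ a b → (a ℕ.≡ᵇ _) ∧ (b ℕ.≡ᵇ _)) (count-act x y z (k ℕ.∸ 1)) (count-act x y z (suc k))))
    O-act x y k (Fin.suc (Fin.suc (Fin.suc (Fin.suc Fin.zero)))) z = cong₂ _∧_ (adj-act x z) (cong₂ _∧_ (isDist-act k y z)
      (cong₂ (λ a b → (a ℕ.≡ᵇ _) ∧ (b ℕ.≡ᵇ _)) (count-act x y z (k ℕ.∸ 1)) (count-act x y z (suc k))))
    O-act x y k (Fin.suc (Fin.suc (Fin.suc (Fin.suc (Fin.suc Fin.zero))))) z = cong₂ _∧_ (adj-act x z) (isDist-act (suc k) y z)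

-- Common neighbours of matrices of rank one.

module Neighbourhood (K : CharacteristicZeroDomain) (F : FiniteField) (D N : ℕ) where

  open Graph K F D N public
  open B using (X; M)
  open ≡-Reasoning

  private
    module Rᶠ = CommutativeRing ringᶠ
    module S = IntegerSolver ringᶠ

  lowers? : ∀ {m n} (d : Mat m n) s t → Dec (Lowers d s t)
  lowers? d s t = map′ (rank⇒lowers d s t) lowers⇒rank (rank d ℕ.≟ suc (rank (d -ᴹ s ⊗ t)))

  Lowers-ᵀ : ∀ {m n} {d : Mat m n} {s t} → Lowers d s t → Lowers (d ᵀ) t s
  Lowers-ᵀ {d = d} {s} {t} (w , r , dw , dr , tw) =
    r , w , dr , trans (cong (_⋆ w) (ᵀ-involutive d)) dw , (begin
      s ∙ r ≡⟨ ∙-comm s r ⟩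
      r ∙ s ≡⟨ cong (r ∙_) (sym dw) ⟩
      bil r d w ≡⟨ sym (ᵀ⋆-∙ d r w) ⟩
      (d ᵀ ⋆ r) ∙ w ≡⟨ trans (cong (_∙ w) dr) tw ⟩
      1ᶠ                    ∎)

  Lowers-ᵀ⁻ : ∀ {m n} {d : Mat m n} {s t} → Lowers (d ᵀ) t s → Lowers d s t
  Lowers-ᵀ⁻ {d = d} {s} {t} l = subst (λ e → Lowers e s t) (ᵀ-involutive d) (Lowers-ᵀ l)

  -- Since t = dᵗ r, the scalar t ∙ w = r ∙ d w depends on d w only, so the normalisation passes to
  -- every preimage of s.
  Lowers-preimage : ∀ {m n} {d : Mat m n} {s t} → Lowers d s t → ∀ w → d ⋆ w ≡ s → t ∙ w ≡ 1ᶠ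
  Lowers-preimage {d = d} {s} {t} (w′ , r , dw′ , dr , tw′) w dw = begin
    t ∙ w ≡⟨ trans (cong (_∙ w) (sym dr)) (ᵀ⋆-∙ d r w) ⟩
    r ∙ (d ⋆ w) ≡⟨ cong (r ∙_) (trans dw (sym dw′)) ⟩
    r ∙ (d ⋆ w′) ≡⟨ trans (sym (ᵀ⋆-∙ d r w′)) (cong (_∙ w′) dr) ⟩
    t ∙ w′ ≡⟨ tw′ ⟩
    1ᶠ                    ∎

  -- Counting pairs (t , r) with t = dᵗ r : each t in the row space arises from κ (dᵗ) vectors r.
  lowering-count : ∀ {m n} (d : Mat m n) w k → d ⋆ w ≢ 0ᵛ → rank d ≡ suc k →
    ∑ (𝕧 n) (λ t → 𝟙 (lowers? d (d ⋆ w) t)) ≡ pw k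
  lowering-count {m} {n} d w k s≢0 h with dual (d ⋆ w) s≢0
  ... | e , es = *-cancelˡ (κ (d ᵀ)) (κ≢0 (d ᵀ)) (*-cancelˡ Q Q≢0 (begin
    Q * (κ (d ᵀ) * N₁)
      ≡⟨ cong (Q *_) (trans (*-comm _ _) (sym (∑-*ʳ (𝕧 n) _ (κ (d ᵀ))))) ⟩
    Q * ∑ (𝕧 n) (λ t → 𝟙 (lowers? d s t) * κ (d ᵀ))
      ≡⟨ cong (Q *_) (∑-cong (𝕧 n) (λ t → trans (𝟙-guard (lowers? d s t) (preimages t)) (sym (∑-*ˡ (𝕧 m) _ _)))) ⟩
    Q * ∑ (𝕧 n) (λ t → ∑ (𝕧 m) (λ r → 𝟙 (lowers? d s t) * 𝟙 (d ᵀ ⋆ r ≟ᵛ t)))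
      ≡⟨ cong (Q *_) (∑-swap (𝕧 n) (𝕧 m) _) ⟩
    Q * ∑ (𝕧 m) (λ r → ∑ (𝕧 n) (λ t → 𝟙 (lowers? d s t) * 𝟙 (d ᵀ ⋆ r ≟ᵛ t)))
      ≡⟨ cong (Q *_) (∑-cong (𝕧 m) (λ r → trans (∑-cong (𝕧 n) (λ t → *-comm _ _))
           (trans (sift′ (𝕧 n) (d ᵀ ⋆ r) (λ t → 𝟙 (lowers? d s t)))
             -- For t = dᵗ r the lowering condition reduces to r ∙ s = 1, which one r in Q satisfies
             -- because s ≠ 0.
             (trans (𝟙-cong (lowers? d s (d ᵀ ⋆ r)) (r ∙ s ≟ᶠ 1ᶠ)
               (λ l → trans (sym (ᵀ⋆-∙ d r w)) (Lowers-preimage l w refl))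
               (λ e → w , r , refl , refl , trans (ᵀ⋆-∙ d r w) e)) (sym (*-identityʳ _)))))) ⟩
    Q * ∑ (𝕧 m) (λ r → 𝟙 (r ∙ s ≟ᶠ 1ᶠ) * 1#)
      ≡⟨ equidistributed (𝕧 m) (λ _ → 1#) (_∙ s) (λ c r → r +ᵛ c *ᵛ e) (shift-inverse e) (λ _ _ → refl)
           (λ c r → trans (∙-+ˡ r _ s) (cong (r ∙ s +ᶠ_) (trans (∙-*ˡ c e s)
             (trans (cong (c *ᶠ_) es) (Rᶠ.*-identityʳ c))))) 1ᶠ ⟩
    ∑ (𝕧 m) (λ _ → 1#)
      ≡⟨ ∑1-𝕍 m ⟩
    pw m
      ≡⟨ sym (κ-rank (d ᵀ)) ⟩
    κ (d ᵀ) * pw (rank (d ᵀ))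
      ≡⟨ cong (λ r → κ (d ᵀ) * pw r) (trans (rank-ᵀ d) h) ⟩
    κ (d ᵀ) * pw (suc k)
      ≡⟨ trans (cong (κ (d ᵀ) *_) (pw-suc k)) (solve 3 (λ k q p → k :* (q :* p) := q :* (k :* p)) refl (κ (d ᵀ)) Q (pw k)) ⟩
    Q * (κ (d ᵀ) * pw k) ∎))
    where
    s = d ⋆ w
    N₁ = ∑ (𝕧 n) (λ t → 𝟙 (lowers? d s t))
    Q≢0 : Q ≢ 0#
    Q≢0 z = pw≢0 1 (trans (pw-suc 0) (trans (cong (_* pw 0) z) (zeroˡ _)))
    preimages : ∀ t → Lowers d s t → κ (d ᵀ) ≡ ∑ (𝕧 m) (λ r → 𝟙 (d ᵀ ⋆ r ≟ᵛ t))
    preimages t (_ , r₀ , _ , dr₀ , _) = begin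
      κ (d ᵀ)
        ≡⟨ κ-def (d ᵀ) ⟩
      ∑ (𝕧 m) (λ r → 𝟙 (d ᵀ ⋆ r ≟ᵛ 0ᵛ))
        ≡⟨ ∑-cong (𝕧 m) (λ r → 𝟙-cong (d ᵀ ⋆ r ≟ᵛ 0ᵛ) (d ᵀ ⋆ (r +ᵛ r₀) ≟ᵛ t)
             (λ z → trans (⋆-+ʳ (d ᵀ) r r₀) (trans (cong₂ _+ᵛ_ z dr₀) (0+ t)))
             (λ z → trans (sym (+-cancel (d ᵀ ⋆ r) t)) (trans (cong (_-ᵛ t) (trans (cong (d ᵀ ⋆ r +ᵛ_) (sym dr₀)) (trans (sym (⋆-+ʳ (d ᵀ) r r₀)) z))) (-ᵛ-self t)))) ⟩
      ∑ (𝕧 m) (λ r → 𝟙 (d ᵀ ⋆ (r +ᵛ r₀) ≟ᵛ t))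
        ≡⟨ ∑-reindex (𝕧 m) (𝕧 m) (_+ᵛ r₀) (_-ᵛ r₀) (λ r → +-cancel r r₀) (λ r → -+-cancel r r₀) (λ r → 𝟙 (d ᵀ ⋆ r ≟ᵛ t)) ⟩
      ∑ (𝕧 m) (λ r → 𝟙 (d ᵀ ⋆ r ≟ᵛ t)) ∎
      where
      0+ : ∀ {n} (v : 𝕍 n) → 0ᵛ +ᵛ v ≡ v
      0+ v = ∙-ext (λ a → trans (∙-+ʳ a 0ᵛ v) (trans (cong (_+ᶠ a ∙ v) (∙-0ʳ a)) (Rᶠ.+-identityˡ _)))
      +-cancel : ∀ {n} (u v : 𝕍 n) → (u +ᵛ v) -ᵛ v ≡ u
      +-cancel u v = ∙-ext (λ a → trans (∙--ʳ a _ v) (trans (cong (_-ᶠ a ∙ v) (∙-+ʳ a u v))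
        (S.solve 2 (λ x y → (x S.:+ y) S.:- y S.:= x) refl _ _)))
      -+-cancel : ∀ {n} (u v : 𝕍 n) → (u -ᵛ v) +ᵛ v ≡ u
      -+-cancel u v = ∙-ext (λ a → trans (∙-+ʳ a _ v) (trans (cong (_+ᶠ a ∙ v) (∙--ʳ a u v))
        (S.solve 2 (λ x y → (x S.:- y) S.:+ y S.:= x) refl _ _)))

  *ᴹ-⊗ : ∀ {m n} μ (s : 𝕍 m) (t : 𝕍 n) → μ *ᴹ (s ⊗ t) ≡ (μ *ᵛ s) ⊗ t
  *ᴹ-⊗ μ s t = matrix-identity (μ ⊠ (s ⊡ t)) ((μ *ᵛ s) ⊡ t) (λ a b → trans (sym (Rᶠ.*-assoc μ _ _))
    (cong (_*ᶠ (t ∙ b)) (sym (∙-*ʳ a μ s))))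

  ⊗-injectiveʳ : ∀ {m n} {s : 𝕍 m} {t t′ : 𝕍 n} → s ≢ 0ᵛ → s ⊗ t ≡ s ⊗ t′ → t ≡ t′
  ⊗-injectiveʳ {s = s} {t} {t′} s≢0 e = -ᵛ≡0 (⊗≡0 s≢0 (trans (sym (⊗--ʳ s t t′)) (trans (cong (s ⊗ t -ᴹ_) (sym e)) (-ᴹ-self _))))

  ⊗-injectiveˡ : ∀ {m n} {s s′ : 𝕍 m} {t : 𝕍 n} → t ≢ 0ᵛ → s ⊗ t ≡ s′ ⊗ t → s ≡ s′
  ⊗-injectiveˡ {s = s} {s′} {t} t≢0 e with dual t t≢0
  ... | b , bt = ∙-ext (λ a → begin
    a ∙ s ≡⟨ unit (a ∙ s) ⟩
    (a ∙ s) *ᶠ (t ∙ b) ≡⟨ trans (sym (bil-⊗ a s t b)) (trans (cong (λ d → bil a d b) e) (bil-⊗ a s′ t b)) ⟩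
    (a ∙ s′) *ᶠ (t ∙ b) ≡⟨ sym (unit (a ∙ s′)) ⟩
    a ∙ s′                     ∎)
    where
    unit : ∀ x → x ≡ x *ᶠ (t ∙ b)
    unit x = sym (trans (cong (x *ᶠ_) (trans (∙-comm t b) bt)) (Rᶠ.*-identityʳ x))

  module _ {A C : Set} (EA : Enumeration A) (EC : Enumeration C) {P : A → Set} (P? : ∀ a → Dec (P a)) (g : A → C)
    (injective : ∀ {a b} → g a ≡ g b → a ≡ b) where

    private
      _≟ᶜ_ = Enumeration._≟_ EC
      _≟ᵃ_ = Enumeration._≟_ EA

      fibre-of : ∀ c (p : Dec (∃ λ a → P a × g a ≡ c)) → ∑ EA (λ a → 𝟙 (P? a) * 𝟙 (g a ≟ᶜ c)) ≡ 𝟙 p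
      fibre-of c (yes (a₀ , pa₀ , refl)) = begin
        ∑ EA (λ a → 𝟙 (P? a) * 𝟙 (g a ≟ᶜ g a₀))
          ≡⟨ ∑-cong EA (λ a → trans (*-comm _ _) (cong (_* 𝟙 (P? a)) (𝟙-cong (g a ≟ᶜ g a₀) (a ≟ᵃ a₀) injective (cong g)))) ⟩
        ∑ EA (λ a → 𝟙 (a ≟ᵃ a₀) * 𝟙 (P? a))
          ≡⟨ trans (sift EA a₀ (λ a → 𝟙 (P? a))) (𝟙-yes (P? a₀) pa₀) ⟩
        1# ∎
      fibre-of c (no none) = ∑-vanish EA (λ a → trans
        (𝟙-guard (P? a) (λ pa → 𝟙-no (g a ≟ᶜ c) (λ e → none (a , pa , e)))) (zeroʳ _))

    ∑-image : (p : ∀ c → Dec (∃ λ a → P a × g a ≡ c)) → ∑ EC (λ c → 𝟙 (p c)) ≡ ∑ EA (λ a → 𝟙 (P? a))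
    ∑-image p = begin
      ∑ EC (λ c → 𝟙 (p c)) ≡⟨ ∑-cong EC (λ c → sym (fibre-of c (p c))) ⟩
      ∑ EC (λ c → ∑ EA (λ a → 𝟙 (P? a) * 𝟙 (g a ≟ᶜ c))) ≡⟨ ∑-swap EC EA _ ⟩
      ∑ EA (λ a → ∑ EC (λ c → 𝟙 (P? a) * 𝟙 (g a ≟ᶜ c))) ≡⟨ ∑-cong EA (λ a → trans (∑-*ˡ EC _ _)
                                                                 (trans (cong (𝟙 (P? a) *_) (∑-𝟙≡′ EC (g a))) (*-identityʳ _))) ⟩
      ∑ EA (λ a → 𝟙 (P? a))                                 ∎

  -- The predicate counted by `aCnt` and `bCnt` at x = 0ᴹ, with j equal to k - 1 and k + 1
  -- respectively.
  commonᵇ : X → ℕ → X → X → Bool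
  commonᵇ Y j z w = B.adj 0ᴹ w ∧ B.adj z w ∧ B.isDist j Y w

  Common : X → ℕ → X → X → Set
  Common Y j z w = rank w ≡ 1 × rank (z -ᴹ w) ≡ 1 × rank (Y -ᴹ w) ≡ j

  rank-neg : ∀ {m n} (w : Mat m n) → rank (0ᴹ -ᴹ w) ≡ rank w
  rank-neg w = rank-cong (0ᴹ -ᴹ w) w (κ-cong (0ᴹ -ᴹ w) w
    (λ b e → sym (-ᵛ≡0 (trans (sym (minus b)) e)))
    (λ b e → trans (minus b) (trans (cong (0ᵛ -ᵛ_) e) (-ᵛ-self 0ᵛ))))
    where
    minus : ∀ b → (0ᴹ -ᴹ w) ⋆ b ≡ 0ᵛ -ᵛ w ⋆ b
    minus b = trans (⋆--ˡ 0ᴹ w b) (cong (_-ᵛ w ⋆ b) (⋆-0ˡ b))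

  adj-0 : ∀ w → B.adj 0ᴹ w ≡ does (rank w ℕ.≟ 1)
  adj-0 w = trans (adj-rank 0ᴹ w) (cong (λ r → does (r ℕ.≟ 1)) (rank-neg w))

  common? : ∀ Y j z w → Dec (Common Y j z w)
  common? Y j z w = (rank w ℕ.≟ 1) ×-dec ((rank (z -ᴹ w) ℕ.≟ 1) ×-dec (rank (Y -ᴹ w) ℕ.≟ j))

  commonᵇ-does : ∀ Y j z w → commonᵇ Y j z w ≡ does (common? Y j z w)
  commonᵇ-does Y j z w = cong₂ _∧_ (adj-0 w) (cong₂ _∧_ (adj-rank z w) (isDist-rank j Y w))

  rank≤1∧≢⇒≡1 : ∀ {z w : X} → rank (z -ᴹ w) ℕ.≤ 1 → z ≢ w → rank (z -ᴹ w) ≡ 1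
  rank≤1∧≢⇒≡1 {z} {w} le z≢w with rank (z -ᴹ w) in e
  ... | 0 = contradiction (-ᴹ≡0 (rank≡0⇒≡0 _ e)) z≢w
  ... | 1 = refl
  rank≤1∧≢⇒≡1 (ℕ.s≤s ()) _ | suc (suc _)

  Shares-scale : ∀ {m n} {s s′ : 𝕍 m} {t t′ : 𝕍 n} {μ ν} → ν *ᶠ μ ≡ 1ᶠ → Shares s t s′ t′ → Shares (μ *ᵛ s) t s′ t′
  Shares-scale {s = s} {μ = μ} {ν} νμ (inj₁ (c , e)) = inj₁ (c *ᶠ ν , trans e (trans
    (cong (_*ᵛ s) (sym (trans (Rᶠ.*-assoc c ν μ) (trans (cong (c *ᶠ_) νμ) (Rᶠ.*-identityʳ c))))) (sym (*ᵛ-assoc (c *ᶠ ν) μ s))))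
  Shares-scale νμ (inj₂ x) = inj₂ x

  -- Adjacency of two rank-one matrices only depends on whether they share a factor, hence not on their scale.
  common-scale : ∀ Y j (z w : X) {μ ν} → μ *ᶠ ν ≡ 1ᶠ → rank z ≡ 1 → rank (Y -ᴹ (μ *ᴹ z)) ≢ j →
    Common Y j z w → Common Y j (μ *ᴹ z) w
  common-scale Y j z w {μ} {ν} μν z1 off (w1 , zw , Yw) = w1 , combine (rank≡1⇒dyad z z1) (rank≡1⇒dyad w w1) , Yw
    where
    combine : (∃₂ λ s t → s ≢ 0ᵛ × t ≢ 0ᵛ × z ≡ s ⊗ t) → (∃₂ λ s t → s ≢ 0ᵛ × t ≢ 0ᵛ × w ≡ s ⊗ t) →
      rank (μ *ᴹ z -ᴹ w) ≡ 1
    combine (s , t , s≢0 , t≢0 , z≡) (s′ , t′ , _ , _ , w≡) = rank≤1∧≢⇒≡1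
      (subst (λ d → rank d ℕ.≤ 1) (cong₂ _-ᴹ_ (sym (trans (cong (μ *ᴹ_) z≡) (*ᴹ-⊗ μ s t))) (sym w≡))
        (shares⇒rank≤1 (Shares-scale (trans (Rᶠ.*-comm ν μ) μν)
          (rank≤1⇒shares s≢0 t≢0 (ℕₚ.≤-reflexive (trans (cong rank (cong₂ _-ᴹ_ (sym z≡) (sym w≡))) zw))))))
      -- Sharing a factor only bounds the rank by 1. It is not 0, since w is at distance j from Y
      -- and the scaled matrix is not.
      (λ e → off (trans (cong (λ d → rank (Y -ᴹ d)) e) Yw))

  rank-scale : ∀ {m n} (z : Mat m n) {μ} → μ ≢ 0ᶠ → rank (μ *ᴹ z) ≡ rank z
  rank-scale z {μ} μ≢0 = rank-cong (μ *ᴹ z) z (κ-cong (μ *ᴹ z) z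
    (λ b e → cancel b (trans (sym (⋆-*ˡ μ z b)) e))
    (λ b e → trans (⋆-*ˡ μ z b) (trans (cong (μ *ᵛ_) e) (*ᵛ-zeroʳ μ))))
    where
    cancel : ∀ b → μ *ᵛ z ⋆ b ≡ 0ᵛ → z ⋆ b ≡ 0ᵛ
    cancel b e with inverse μ μ≢0
    ... | ν , μν = trans (*ᵛ-inverse {c = μ} {ν} (trans (Rᶠ.*-comm ν μ) μν) e) (*ᵛ-zeroʳ ν)

  count-scale : ∀ Y j (z : X) {μ} → μ ≢ 0ᶠ → rank z ≡ 1 → rank (Y -ᴹ z) ≢ j → rank (Y -ᴹ (μ *ᴹ z)) ≢ j →
    B.card (commonᵇ Y j (μ *ᴹ z)) ≡ B.card (commonᵇ Y j z)
  count-scale Y j z {μ} μ≢0 z1 off off′ with inverse μ μ≢0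
  ... | ν , μν = card-cong (λ w → trans (commonᵇ-does Y j (μ *ᴹ z) w) (trans
      (does-⇔ (mk⇔ (back w) (common-scale Y j z w μν z1 off′)) (common? Y j (μ *ᴹ z) w) (common? Y j z w))
      (sym (commonᵇ-does Y j z w))))
    where
    νμ = trans (Rᶠ.*-comm ν μ) μν
    unscale : ν *ᴹ (μ *ᴹ z) ≡ z
    unscale = scale-scale z νμ
    back : ∀ w → Common Y j (μ *ᴹ z) w → Common Y j z w
    back w c = subst (λ d → Common Y j d w) unscale
      (common-scale Y j (μ *ᴹ z) w νμ (trans (rank-scale z μ≢0) z1)
        (λ e → off (trans (cong (λ d → rank (Y -ᴹ d)) (sym unscale)) e)) c)

  -- Here k is one less than the distance k of the theorem. The dyad s ⊗ t lies in O₁ and z is a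
  -- multiple of it by φ ≠ 0 , 1; the aim is to find the two counts that place z in O₃.
  module _ (Y : X) (k : ℕ) (rankY : rank Y ≡ suc k) {s : 𝕍 D} {t : 𝕍 M} (lowers : Lowers Y s t)
    {φ : 𝔽} (φ≢0 : φ ≢ 0ᶠ) (φ≢1 : φ ≢ 1ᶠ) where

    private
      z = (φ *ᵛ s) ⊗ t
      s≢0 = proj₁ (Lowers⇒nonzero lowers)
      t≢0 = proj₂ (Lowers⇒nonzero lowers)
      w₀ = proj₁ lowers
      r₀ = proj₁ (proj₂ lowers)
      Yw₀ : Y ⋆ w₀ ≡ s
      Yw₀ = proj₁ (proj₂ (proj₂ lowers))
      Yr₀ : Y ᵀ ⋆ r₀ ≡ t
      Yr₀ = proj₁ (proj₂ (proj₂ (proj₂ lowers)))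

      -- The neighbours of z in O₁ fall into those with left factor s and those with right factor t.
      -- Each family has q^k members and they meet in s ⊗ t alone, which explains 2 q^k - 1.
      P₁ P₂ : X → Set
      P₁ w = ∃ λ t′ → Lowers Y s t′ × s ⊗ t′ ≡ w
      P₂ w = ∃ λ s′ → Lowers Y s′ t × s′ ⊗ t ≡ w

      P₁? : ∀ w → Dec (P₁ w)
      P₁? w = search (𝕧 M) (λ t′ → lowers? Y s t′ ×-dec (s ⊗ t′ ≟ᴹ w))

      P₂? : ∀ w → Dec (P₂ w)
      P₂? w = search (𝕧 D) (λ s′ → lowers? Y s′ t ×-dec (s′ ⊗ t ≟ᴹ w))

      ∑-P₁ : ∑ (𝕞 D M) (λ w → 𝟙 (P₁? w)) ≡ pw k
      ∑-P₁ = begin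
        ∑ (𝕞 D M) (λ w → 𝟙 (P₁? w))
          ≡⟨ ∑-image (𝕧 M) (𝕞 D M) (lowers? Y s) (s ⊗_) (⊗-injectiveʳ s≢0) P₁? ⟩
        ∑ (𝕧 M) (λ t′ → 𝟙 (lowers? Y s t′))
          ≡⟨ cong (λ s → ∑ (𝕧 M) (λ t′ → 𝟙 (lowers? Y s t′))) (sym Yw₀) ⟩
        ∑ (𝕧 M) (λ t′ → 𝟙 (lowers? Y (Y ⋆ w₀) t′))
          ≡⟨ lowering-count Y w₀ k (λ e → s≢0 (trans (sym Yw₀) e)) rankY ⟩
        pw k ∎

      ∑-P₂ : ∑ (𝕞 D M) (λ w → 𝟙 (P₂? w)) ≡ pw k
      ∑-P₂ = begin
        ∑ (𝕞 D M) (λ w → 𝟙 (P₂? w))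
          ≡⟨ ∑-image (𝕧 D) (𝕞 D M) (λ s′ → lowers? Y s′ t) (_⊗ t) (⊗-injectiveˡ t≢0) P₂? ⟩
        ∑ (𝕧 D) (λ s′ → 𝟙 (lowers? Y s′ t))
          ≡⟨ ∑-cong (𝕧 D) (λ s′ → 𝟙-cong (lowers? Y s′ t) (lowers? (Y ᵀ) t s′) Lowers-ᵀ Lowers-ᵀ⁻) ⟩
        ∑ (𝕧 D) (λ s′ → 𝟙 (lowers? (Y ᵀ) t s′))
          ≡⟨ cong (λ t → ∑ (𝕧 D) (λ s′ → 𝟙 (lowers? (Y ᵀ) t s′))) (sym Yr₀) ⟩
        ∑ (𝕧 D) (λ s′ → 𝟙 (lowers? (Y ᵀ) (Y ᵀ ⋆ r₀) s′))
          ≡⟨ lowering-count (Y ᵀ) r₀ k (λ e → t≢0 (trans (sym Yr₀) e)) (trans (rank-ᵀ Y) rankY) ⟩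
        pw k ∎

      lowered : ∀ {s′ t′} → Lowers Y s′ t′ → rank (Y -ᴹ s′ ⊗ t′) ≡ k
      lowered l = ℕₚ.suc-injective (trans (sym (lowers⇒rank l)) rankY)

      rank-z : rank (Y -ᴹ z) ≡ suc k
      rank-z = trans (lowers-scaled lowers φ≢1) rankY

      φs≢0 : φ *ᵛ s ≢ 0ᵛ
      φs≢0 = *ᵛ-≢0 φ≢0 s≢0

      -- Adjacent dyads share a factor up to a scalar; sliding that scalar to the other factor makes
      -- the shared one equal to s or t itself.
      shared : ∀ w → Common Y k z w → P₁ w ⊎ P₂ w
      shared w (w1 , zw , Yw) = combine (rank≡1⇒dyad w w1)
        where
        lowers-w : ∀ {s′ t′} → s′ ⊗ t′ ≡ w → Lowers Y s′ t′
        lowers-w {s′} {t′} e = rank⇒lowers Y s′ t′ (trans rankY (cong suc (sym (trans (cong (λ d → rank (Y -ᴹ d)) e) Yw))))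
        combine : (∃₂ λ s′ t′ → s′ ≢ 0ᵛ × t′ ≢ 0ᵛ × w ≡ s′ ⊗ t′) → P₁ w ⊎ P₂ w
        combine (s′ , t′ , _ , _ , w≡) with rank≤1⇒shares φs≢0 t≢0 (ℕₚ.≤-reflexive (trans (cong (λ d → rank (z -ᴹ d)) (sym w≡)) zw))
        ... | inj₁ (c , e) = inj₁ (_ , lowers-w eq , eq)
          where
          eq : s ⊗ ((c *ᶠ φ) *ᵛ t′) ≡ w
          eq = trans (sym (⊗-slide (c *ᶠ φ) s t′)) (trans (cong (_⊗ t′) (trans (sym (*ᵛ-assoc c φ s)) (sym e))) (sym w≡))
        ... | inj₂ (c , e) = inj₂ (_ , lowers-w eq , eq)
          where
          eq : (c *ᵛ s′) ⊗ t ≡ w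
          eq = trans (⊗-slide c s′ t) (trans (cong (s′ ⊗_) (sym e)) (sym w≡))

      common-of : ∀ {s′ t′} → Shares (φ *ᵛ s) t s′ t′ → Lowers Y s′ t′ → Common Y k z (s′ ⊗ t′)
      common-of sh l = rank-⊗ (proj₁ (Lowers⇒nonzero l)) (proj₂ (Lowers⇒nonzero l)) ,
        rank≤1∧≢⇒≡1 (shares⇒rank≤1 sh)
          (λ e → ℕₚ.1+n≢n (trans (sym rank-z) (trans (cong (λ d → rank (Y -ᴹ d)) e) (lowered l)))) ,
        lowered l

      common-P₁ : ∀ w → P₁ w → Common Y k z w
      common-P₁ w (t′ , l , refl) with inverse φ φ≢0
      ... | ν , φν = common-of (inj₁ (ν , *ᵛ-inverse {c = φ} {ν} (trans (Rᶠ.*-comm ν φ) φν) refl)) l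

      common-P₂ : ∀ w → P₂ w → Common Y k z w
      common-P₂ w (s′ , l , refl) = common-of (inj₂ (1ᶠ , sym (*ᵛ-1 t))) l

      -- Applying s ⊗ t′ = s′ ⊗ t to w₀ gives s = s′, because t′ ∙ w₀ and t ∙ w₀ are both 1.
      both : ∀ w → P₁ w → P₂ w → s ⊗ t ≡ w
      both w (t′ , l , e) (s′ , l′ , e′) = trans (cong (_⊗ t) s≡s′) e′
        where
        s≡s′ : s ≡ s′
        s≡s′ = begin
          s ≡⟨ sym (*ᵛ-1 s) ⟩
          1ᶠ *ᵛ s ≡⟨ cong (_*ᵛ s) (sym (Lowers-preimage l w₀ Yw₀)) ⟩
          (t′ ∙ w₀) *ᵛ s ≡⟨ trans (sym (⋆-⊗ s t′ w₀)) (cong (_⋆ w₀) (trans e (sym e′))) ⟩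
          (s′ ⊗ t) ⋆ w₀ ≡⟨ ⋆-⊗ s′ t w₀ ⟩
          (t ∙ w₀) *ᵛ s′ ≡⟨ trans (cong (_*ᵛ s′) (Lowers-preimage lowers w₀ Yw₀)) (*ᵛ-1 s′) ⟩
          s′                       ∎

      -- Inclusion-exclusion for the two families, whose intersection is the single point s ⊗ t.
      indicator : ∀ w → ind (commonᵇ Y k z w) ≡ 𝟙 (P₁? w) + 𝟙 (P₂? w) - 𝟙 (s ⊗ t ≟ᴹ w)
      indicator w = trans (cong ind (commonᵇ-does Y k z w)) (decide (common? Y k z w) (P₁? w) (P₂? w) (s ⊗ t ≟ᴹ w))
        where
        decide : (c : Dec (Common Y k z w)) (p : Dec (P₁ w)) (r : Dec (P₂ w)) (e : Dec (s ⊗ t ≡ w)) →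
          𝟙 c ≡ 𝟙 p + 𝟙 r - 𝟙 e
        decide (yes _) (yes _) (yes _) (yes _) = solve 0 (:1 := :1 :+ :1 :- :1) refl
        decide (yes _) (yes p) (yes r) (no ¬e) = contradiction (both w p r) ¬e
        decide _ _ (no ¬r) (yes e) = contradiction (s , lowers , e) ¬r
        decide _ (no ¬p) _ (yes e) = contradiction (t , lowers , e) ¬p
        decide (yes _) (yes _) (no _) (no _) = solve 0 (:1 := :1 :+ :0 :- :0) refl
        decide (yes _) (no _) (yes _) (no _) = solve 0 (:1 := :0 :+ :1 :- :0) refl
        decide (yes c) (no ¬p) (no ¬r) _ with shared w c
        ... | inj₁ p = contradiction p ¬p
        ... | inj₂ r = contradiction r ¬r
        decide (no ¬c) (yes p) _ _ = contradiction (common-P₁ w p) ¬c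
        decide (no ¬c) _ (yes r) _ = contradiction (common-P₂ w r) ¬c
        decide (no _) (no _) (no _) (no _) = solve 0 (:0 := :0 :+ :0 :- :0) refl

    lowering-common-count : B.card (commonᵇ Y k z) ≡ 2 ℕ.* size ℕ.^ k ℕ.∸ 1
    lowering-common-count = begin
      -- The successor of the cardinality is compared with 2 q^k, so that no truncated subtraction
      -- has to pass through `fromℕ`.
      B.card (commonᵇ Y k z) ≡⟨ sym (ℕₚ.m+n∸n≡m _ 1) ⟩
      B.card (commonᵇ Y k z) ℕ.+ 1 ℕ.∸ 1 ≡⟨ cong (ℕ._∸ 1) (trans (ℕₚ.+-comm _ 1) (fromℕ-injective {suc (B.card (commonᵇ Y k z))} {2 ℕ.* size ℕ.^ k} total)) ⟩
      2 ℕ.* size ℕ.^ k ℕ.∸ 1               ∎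
      where
      total : 1# + fromℕ (B.card (commonᵇ Y k z)) ≡ fromℕ (2 ℕ.* size ℕ.^ k)
      total = begin
        1# + fromℕ (B.card (commonᵇ Y k z))
          ≡⟨ cong (1# +_) (trans (fromℕ-card _) (∑-cong (𝕞 D M) indicator)) ⟩
        1# + ∑ (𝕞 D M) (λ w → 𝟙 (P₁? w) + 𝟙 (P₂? w) - 𝟙 (s ⊗ t ≟ᴹ w))
          ≡⟨ cong (1# +_) (trans (∑-- (𝕞 D M) _ _) (cong₂ _-_ (trans (∑-+ (𝕞 D M) _ _) (cong₂ _+_ ∑-P₁ ∑-P₂)) (∑-𝟙≡′ (𝕞 D M) (s ⊗ t)))) ⟩
        1# + (pw k + pw k - 1#)
          -- `fromℕ 2` unfolds to `1# + (1# + 0#)`, hence the shape of the right side.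
          ≡⟨ solve 1 (λ p → :1 :+ (p :+ p :- :1) := (:1 :+ (:1 :+ :0)) :* p) refl (pw k) ⟩
        fromℕ 2 * pw k
          ≡⟨ cong (fromℕ 2 *_) (sym (fromℕ-pw k)) ⟩
        fromℕ 2 * fromℕ (size ℕ.^ k)
          ≡⟨ sym (×1-homo-* 2 (size ℕ.^ k)) ⟩
        fromℕ (2 ℕ.* size ℕ.^ k) ∎

    -- A neighbour of z has a factor proportional to s or t. These lie in the column and the row
    -- space of Y, whereas raising the rank needs both factors outside them.
    raising-common-count : B.card (commonᵇ Y (suc (suc k)) z) ≡ 0
    raising-common-count = fromℕ-injective {B.card (commonᵇ Y (suc (suc k)) z)} {0} (trans (fromℕ-card _) (∑-vanish (𝕞 D M) (λ w →
      trans (cong ind (commonᵇ-does Y (suc (suc k)) z w)) (𝟙-no (common? Y (suc (suc k)) z w) (none w)))))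
      where
      none : ∀ w → ¬ Common Y (suc (suc k)) z w
      none w (w1 , zw , Yw) = combine (rank≡1⇒dyad w w1)
        where
        combine : ¬ (∃₂ λ s′ t′ → s′ ≢ 0ᵛ × t′ ≢ 0ᵛ × w ≡ s′ ⊗ t′)
        combine (s′ , t′ , _ , _ , w≡) = clash
            (rank≤1⇒shares φs≢0 t≢0 (ℕₚ.≤-reflexive (trans (cong (λ d → rank (z -ᴹ d)) (sym w≡)) zw)))
            (rank⇒raises Y s′ t′ (trans (cong (λ d → rank (Y -ᴹ d)) (sym w≡)) (trans Yw (cong suc (sym rankY)))))
          where
          clash : Shares (φ *ᵛ s) t s′ t′ → ¬ Raises Y s′ t′
          clash (inj₁ (c , e)) (_ , b , Yb , s′b) = 0≢1 (begin
            0ᶠ ≡⟨ sym (Rᶠ.zeroʳ (c *ᶠ φ)) ⟩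
            (c *ᶠ φ) *ᶠ 0ᶠ ≡⟨ cong ((c *ᶠ φ) *ᶠ_) (sym sb) ⟩
            (c *ᶠ φ) *ᶠ (s ∙ b) ≡⟨ sym (∙-*ˡ (c *ᶠ φ) s b) ⟩
            ((c *ᶠ φ) *ᵛ s) ∙ b ≡⟨ cong (_∙ b) (trans (sym (*ᵛ-assoc c φ s)) (sym e)) ⟩
            s′ ∙ b ≡⟨ s′b ⟩
            1ᶠ                          ∎)
            where
            sb : s ∙ b ≡ 0ᶠ
            sb = begin
              s ∙ b ≡⟨ trans (∙-comm s b) (cong (b ∙_) (sym Yw₀)) ⟩
              bil b Y w₀ ≡⟨ sym (ᵀ⋆-∙ Y b w₀) ⟩
              (Y ᵀ ⋆ b) ∙ w₀ ≡⟨ trans (cong (_∙ w₀) Yb) (∙-0ˡ w₀) ⟩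
              0ᶠ                        ∎
          clash (inj₂ (c , e)) ((b , Yb , t′b) , _) = 0≢1 (begin
            0ᶠ ≡⟨ sym (Rᶠ.zeroʳ c) ⟩
            c *ᶠ 0ᶠ ≡⟨ cong (c *ᶠ_) (sym (Lowers-dependent Yr₀ b Yb)) ⟩
            c *ᶠ (t ∙ b) ≡⟨ sym (∙-*ˡ c t b) ⟩
            (c *ᵛ t) ∙ b ≡⟨ cong (_∙ b) (sym e) ⟩
            t′ ∙ b ≡⟨ t′b ⟩
            1ᶠ                          ∎)

-- Every set of the partition satisfies the balance identity.

module YPartition (K : CharacteristicZeroDomain) (F : FiniteField) (D N : ℕ) where

  open Neighbourhood K F D N public
  open B using (X; M)
  open ≡-Reasoning

  private
    module Rᶠ = CommutativeRing ringᶠ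
    module S = IntegerSolver ringᶠ

  isometry⇒automorphism : LinearIsometry D M → Automorphism
  isometry⇒automorphism τ = record
    { act = to τ ; inv = from τ ; inv-act = from-to τ ; act-inv = to-from τ
    ; rank-act = λ a b → trans (cong rank (sym (to-- τ a b))) (rank-to τ (a -ᴹ b)) }

  to-0 : ∀ (τ : LinearIsometry D M) → to τ 0ᴹ ≡ 0ᴹ
  to-0 τ = trans (cong (to τ) (sym (-ᴹ-self 0ᴹ))) (trans (to-- τ 0ᴹ 0ᴹ) (-ᴹ-self _))

  O-stable : ∀ Y k i (τ : LinearIsometry D M) → to τ Y ≡ Y → ∀ z → B.O 0ᴹ Y k i (to τ z) ≡ B.O 0ᴹ Y k i z
  O-stable Y k i τ fix z = trans (cong₂ (λ x y → B.O x y k i (to τ z)) (sym (to-0 τ)) (sym fix))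
    (Automorphism.O-act (isometry⇒automorphism τ) 0ᴹ Y k i z)

  *ᴹ-1 : ∀ (d : X) → 1ᶠ *ᴹ d ≡ d
  *ᴹ-1 d = matrix-identity (1ᶠ ⊠ ⌈ d ⌉) ⌈ d ⌉ (λ a b → Rᶠ.*-identityˡ _)

  -- One implication suffices: the converse is closure under the inverse scalar.
  homogeneous-from : ∀ (Y : X) (p : X → Bool) → (∀ μ → μ ≢ 0ᶠ → ∀ z → T (p z) → T (p (μ *ᴹ z))) →
    Homogeneous Y (λ z → ind (p z))
  homogeneous-from Y p closed μ μ≢0 z with inverse μ μ≢0
  ... | ν , μν = cong ind (T-ext
      (λ h → subst (λ y → T (p y)) (scale-scale z νμ) (closed ν (unit≢0 νμ) (μ *ᴹ z) h)) (closed μ μ≢0 z))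
    where νμ = trans (Rᶠ.*-comm ν μ) μν

  rank-raise-scale : ∀ (Y z : X) {μ} → μ ≢ 0ᶠ → rank z ≡ 1 → rank (Y -ᴹ z) ≡ suc (rank Y) → rank (Y -ᴹ (μ *ᴹ z)) ≡ suc (rank Y)
  rank-raise-scale Y z {μ} μ≢0 z1 h with rank≡1⇒dyad z z1 | inverse μ μ≢0
  ... | s , t , _ , _ , refl | ν , μν = trans (cong (λ d → rank (Y -ᴹ d)) (*ᴹ-⊗ μ s t)) (raises⇒rank (scale (rank⇒raises Y s t h)))
    where
    scale : Raises Y s t → Raises Y (μ *ᵛ s) t
    scale (free , b , Yb , sb) = free , ν *ᵛ b ,
      trans (⋆-*ʳ (Y ᵀ) ν b) (trans (cong (ν *ᵛ_) Yb) (*ᵛ-zeroʳ ν)) , (begin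
        (μ *ᵛ s) ∙ (ν *ᵛ b) ≡⟨ trans (∙-*ˡ μ s _) (cong (μ *ᶠ_) (∙-*ʳ s ν b)) ⟩
        μ *ᶠ (ν *ᶠ (s ∙ b)) ≡⟨ trans (cong (λ x → μ *ᶠ (ν *ᶠ x)) sb) (cong (μ *ᶠ_) (Rᶠ.*-identityʳ ν)) ⟩
        μ *ᶠ ν ≡⟨ μν ⟩
        1ᶠ                      ∎)

  -- Writing k as j + 2 encodes 2 ≤ k and lets `k ∸ 1` compute.
  module _ (Y : X) (j : ℕ) (rankY : rank Y ≡ suc (suc j)) where

    private
      k′ = suc j
      k = suc k′
      α₀ = 2 ℕ.* size ℕ.^ k′ ℕ.∸ 1

    -- lowᵇ and highᵇ are O₁ and O₆; O₂, …, O₅ are middleᵇ α β for four pairs (α , β), with α = α₀ only for O₃.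
    lowᵇ : X → Bool
    lowᵇ z = B.adj 0ᴹ z ∧ B.isDist k′ Y z

    highᵇ : X → Bool
    highᵇ z = B.adj 0ᴹ z ∧ B.isDist (suc k) Y z

    middleᵇ : ℕ → ℕ → X → Bool
    middleᵇ α β z = B.adj 0ᴹ z ∧ B.isDist k Y z ∧ (B.aCnt 0ᴹ Y k z ℕ.≡ᵇ α) ∧ (B.bCnt 0ᴹ Y k z ℕ.≡ᵇ β)

    Middle : ℕ → ℕ → X → Set
    Middle α β z = rank z ≡ 1 × rank (Y -ᴹ z) ≡ k × B.aCnt 0ᴹ Y k z ≡ α × B.bCnt 0ᴹ Y k z ≡ β

    private
      adj⇒rank : ∀ {z} → T (B.adj 0ᴹ z) → rank z ≡ 1
      adj⇒rank {z} h = T-does (rank z ℕ.≟ 1) (subst T (adj-0 z) h)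

      rank⇒adj : ∀ {z} → rank z ≡ 1 → T (B.adj 0ᴹ z)
      rank⇒adj {z} h = subst T (sym (adj-0 z)) (does-T (rank z ℕ.≟ 1) h)

      isDist⇒rank : ∀ {i z} → T (B.isDist i Y z) → rank (Y -ᴹ z) ≡ i
      isDist⇒rank {i} {z} h = T-does (rank (Y -ᴹ z) ℕ.≟ i) (subst T (isDist-rank i Y z) h)

      rank⇒isDist : ∀ {i z} → rank (Y -ᴹ z) ≡ i → T (B.isDist i Y z)
      rank⇒isDist {i} {z} h = subst T (sym (isDist-rank i Y z)) (does-T (rank (Y -ᴹ z) ℕ.≟ i) h)

    middle⇒ : ∀ {α β z} → T (middleᵇ α β z) → Middle α β z
    middle⇒ h with Equivalence.to T-∧ h
    ... | h₁ , h′ with Equivalence.to T-∧ h′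
    ...   | h₂ , h″ with Equivalence.to T-∧ h″
    ...     | h₃ , h₄ = adj⇒rank h₁ , isDist⇒rank h₂ , ℕₚ.≡ᵇ⇒≡ _ _ h₃ , ℕₚ.≡ᵇ⇒≡ _ _ h₄

    middle⇐ : ∀ {α β z} → Middle α β z → T (middleᵇ α β z)
    middle⇐ (h₁ , h₂ , h₃ , h₄) = Equivalence.from T-∧ (rank⇒adj h₁ , Equivalence.from T-∧
      (rank⇒isDist h₂ , Equivalence.from T-∧ (ℕₚ.≡⇒≡ᵇ _ _ h₃ , ℕₚ.≡⇒≡ᵇ _ _ h₄)))

    Low : X → Set
    Low z = ∃₂ λ s t → Lowers Y s t × z ≡ s ⊗ t

    low-rank : ∀ {z} → rank z ≡ 1 → rank (Y -ᴹ z) ≡ k′ → Low z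
    low-rank {z} z1 Yz with rank≡1⇒dyad z z1
    ... | s , t , _ , _ , z≡ = s , t , rank⇒lowers Y s t
      (trans rankY (cong suc (sym (trans (cong (λ d → rank (Y -ᴹ d)) (sym z≡)) Yz)))) , z≡

    rank-low : ∀ {z} → Low z → rank z ≡ 1 × rank (Y -ᴹ z) ≡ k′
    rank-low (s , t , l , refl) = rank-⊗ (proj₁ (Lowers⇒nonzero l)) (proj₂ (Lowers⇒nonzero l)) ,
      ℕₚ.suc-injective (trans (sym (lowers⇒rank l)) rankY)

    low⇒ : ∀ {z} → T (lowᵇ z) → Low z
    low⇒ h = let (h₁ , h₂) = Equivalence.to T-∧ h in low-rank (adj⇒rank h₁) (isDist⇒rank h₂)

    low⇐ : ∀ {z} → Low z → T (lowᵇ z)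
    low⇐ l = Equivalence.from T-∧ (rank⇒adj (proj₁ (rank-low l)) , rank⇒isDist (proj₂ (rank-low l)))

    low-scale : ∀ {z μ} → μ ≢ 0ᶠ → μ ≢ 1ᶠ → Low z → Middle α₀ 0 (μ *ᴹ z)
    low-scale {μ = μ} μ≢0 μ≢1 (s , t , l , refl) =
      trans (rank-scale (s ⊗ t) μ≢0) (proj₁ (rank-low (s , t , l , refl))) ,
      trans (cong (λ d → rank (Y -ᴹ d)) eq) (trans (lowers-scaled l μ≢1) rankY) ,
      trans (cong (B.aCnt 0ᴹ Y k) eq) (lowering-common-count Y k′ rankY l μ≢0 μ≢1) ,
      trans (cong (B.bCnt 0ᴹ Y k) eq) (raising-common-count Y k′ rankY l μ≢0 μ≢1)
      where eq = *ᴹ-⊗ μ s t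

    data ScaledMiddle (α β : ℕ) (z : X) (μ : 𝔽) : Set where
      still-middle : Middle α β (μ *ᴹ z) → ScaledMiddle α β z μ
      now-low : α ≡ α₀ → Low (μ *ᴹ z) → ScaledMiddle α β z μ

    -- If the rank of Y - μ z is still k, both counts are unchanged. If it drops, μ z is in O₁, so
    -- z, a further multiple of it, has the counts of O₃ and α = α₀. It cannot rise, since a rise
    -- would persist under scaling back to z.
    middle-scale : ∀ {α β z μ} → μ ≢ 0ᶠ → Middle α β z → ScaledMiddle α β z μ
    middle-scale {α} {β} {z} {μ} μ≢0 (z1 , Yz , a , b) with inverse μ μ≢0
    ... | ν , μν = cases (subst (λ d → rank d ≡ rank Y ⊎ rank Y ≡ suc (rank d) ⊎ rank d ≡ suc (rank Y)) (cong (Y -ᴹ_) (sym μz≡))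
                     (rank-dyad-cases Y (μ *ᵛ s) t))
      where
      s = proj₁ (rank≡1⇒dyad z z1)
      t = proj₁ (proj₂ (rank≡1⇒dyad z z1))
      μz≡ : μ *ᴹ z ≡ (μ *ᵛ s) ⊗ t
      μz≡ = trans (cong (μ *ᴹ_) (proj₂ (proj₂ (proj₂ (proj₂ (rank≡1⇒dyad z z1)))))) (*ᴹ-⊗ μ s t)
      μz1 : rank (μ *ᴹ z) ≡ 1
      μz1 = trans (rank-scale z μ≢0) z1
      νμ = trans (Rᶠ.*-comm ν μ) μν
      νμz : ν *ᴹ (μ *ᴹ z) ≡ z
      νμz = scale-scale z νμ
      ν≢0 = unit≢0 νμ
      cases : rank (Y -ᴹ (μ *ᴹ z)) ≡ rank Y ⊎ rank Y ≡ suc (rank (Y -ᴹ (μ *ᴹ z))) ⊎ rank (Y -ᴹ (μ *ᴹ z)) ≡ suc (rank Y) →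
        ScaledMiddle α β z μ
      cases (inj₁ h) = still-middle (μz1 , trans h rankY ,
          trans (count-scale Y k′ z μ≢0 z1 (off (λ ()) Yz) (off (λ ()) (trans h rankY))) a ,
          trans (count-scale Y (suc k) z μ≢0 z1 (off (λ ()) Yz) (off (λ ()) (trans h rankY))) b)
        where
        off : ∀ {i r} → k ≢ i → r ≡ k → r ≢ i
        off k≢i e e′ = k≢i (trans (sym e) e′)
      cases (inj₂ (inj₁ h)) = now-low (trans (sym a) (subst (λ y → B.aCnt 0ᴹ Y k y ≡ α₀) νμz
            (proj₁ (proj₂ (proj₂ (low-scale ν≢0 ν≢1 low)))))) low
        where
        low : Low (μ *ᴹ z)
        low = low-rank μz1 (ℕₚ.suc-injective (trans (sym h) rankY))
        ν≢1 : ν ≢ 1ᶠ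
        ν≢1 ν≡1 = ℕₚ.1+n≢n {k′} (begin
          k ≡⟨ sym Yz ⟩
          rank (Y -ᴹ z) ≡⟨ cong (λ d → rank (Y -ᴹ d)) (trans (sym νμz) (trans (cong (_*ᴹ (μ *ᴹ z)) ν≡1) (*ᴹ-1 (μ *ᴹ z)))) ⟩
          rank (Y -ᴹ (μ *ᴹ z)) ≡⟨ proj₂ (rank-low low) ⟩
          k′                        ∎)
      cases (inj₂ (inj₂ h)) = contradiction (begin
        suc (rank Y) ≡⟨ sym (rank-raise-scale Y (μ *ᴹ z) ν≢0 μz1 h) ⟩
        rank (Y -ᴹ (ν *ᴹ (μ *ᴹ z))) ≡⟨ cong (λ d → rank (Y -ᴹ d)) νμz ⟩
        rank (Y -ᴹ z) ≡⟨ trans Yz (sym rankY) ⟩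
        rank Y                           ∎) ℕₚ.1+n≢n

    middle-homogeneous : ∀ α β → α ≢ α₀ → Homogeneous Y (λ z → ind (middleᵇ α β z))
    middle-homogeneous α β α≢α₀ = homogeneous-from Y (middleᵇ α β) (λ μ μ≢0 z h → closed μ z (middle-scale μ≢0 (middle⇒ h)))
      where
      closed : ∀ μ z → ScaledMiddle α β z μ → T (middleᵇ α β (μ *ᴹ z))
      closed μ z (still-middle m) = middle⇐ m
      closed μ z (now-low e _) = contradiction e α≢α₀

    high-homogeneous : Homogeneous Y (λ z → ind (highᵇ z))
    high-homogeneous = homogeneous-from Y highᵇ (λ μ μ≢0 z h → let (h₁ , h₂) = Equivalence.to T-∧ h in
      Equivalence.from T-∧ (rank⇒adj (trans (rank-scale z μ≢0) (adj⇒rank h₁)) ,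
        rank⇒isDist (trans (rank-raise-scale Y z μ≢0 (adj⇒rank h₁) (trans (isDist⇒rank h₂) (cong suc (sym rankY)))) (cong suc rankY))))

    lowOr : X → Bool
    lowOr z = lowᵇ z ∨ middleᵇ α₀ 0 z

    lowOr-homogeneous : Homogeneous Y (λ z → ind (lowOr z))
    lowOr-homogeneous = homogeneous-from Y lowOr (λ μ μ≢0 z h → closed μ μ≢0 z (Equivalence.to T-∨ h))
      where
      middle-case : ∀ μ z → ScaledMiddle α₀ 0 z μ → T (lowOr (μ *ᴹ z))
      middle-case μ z (still-middle m) = Equivalence.from (T-∨ {lowᵇ (μ *ᴹ z)}) (inj₂ (middle⇐ m))
      middle-case μ z (now-low _ l) = Equivalence.from T-∨ (inj₁ (low⇐ l))
      low-case : ∀ μ → μ ≢ 0ᶠ → ∀ z → Dec (μ ≡ 1ᶠ) → Low z → T (lowOr (μ *ᴹ z))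
      low-case μ μ≢0 z (yes refl) l = Equivalence.from T-∨ (inj₁ (low⇐ (subst Low
        (sym (*ᴹ-1 z)) l)))
      low-case μ μ≢0 z (no μ≢1) l = Equivalence.from (T-∨ {lowᵇ (μ *ᴹ z)}) (inj₂ (middle⇐ (low-scale μ≢0 μ≢1 l)))
      closed : ∀ μ → μ ≢ 0ᶠ → ∀ z → T (lowᵇ z) ⊎ T (middleᵇ α₀ 0 z) → T (lowOr (μ *ᴹ z))
      closed μ μ≢0 z (inj₁ h) = low-case μ μ≢0 z (μ ≟ᶠ 1ᶠ) (low⇒ h)
      closed μ μ≢0 z (inj₂ h) = middle-case μ z (middle-scale μ≢0 (middle⇒ h))

    ind-middle : ∀ z → ind (middleᵇ α₀ 0 z) ≡ ind (lowOr z) - ind (lowᵇ z)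
    ind-middle z = difference (lowᵇ z) (middleᵇ α₀ 0 z) (λ l m → ℕₚ.1+n≢n {k′}
      (trans (sym (proj₁ (proj₂ (middle⇒ {α₀} {0} {z} m)))) (proj₂ (rank-low (low⇒ {z} l)))))
      where
      difference : ∀ x y → (T x → ¬ T y) → ind y ≡ ind (x ∨ y) - ind x
      difference true true h = contradiction _ (h _)
      difference true false h = solve 0 (:0 := :1 :- :1) refl
      difference false y h = solve 1 (λ y → y := y :- :0) refl (ind y)

    -- The map z ↦ ε z + (1/ε - ε) (Y b)(aᵗ z), with ε = c / c′, takes O₁ to itself on the matrices with aᵗ z b = c,
    -- and takes that value to c′.
    module Twist (a : 𝕍 D) (b : 𝕍 M) (ab : bil a Y b ≡ 1ᶠ) where

      twist : 𝔽 → 𝔽 → X → X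
      twist ε ε′ z = ε *ᴹ z +ᴹ ((ε′ -ᶠ ε) *ᵛ (Y ⋆ b)) ⊗ (z ᵀ ⋆ a)

      bil-twist : ∀ ε ε′ a′ z b′ → bil a′ (twist ε ε′ z) b′ ≡ ε *ᶠ bil a′ z b′ +ᶠ ((ε′ -ᶠ ε) *ᶠ bil a′ Y b) *ᶠ bil a z b′
      bil-twist ε ε′ a′ z b′ = trans (bil-+ a′ _ _ b′) (cong₂ _+ᶠ_ (bil-* a′ ε z b′)
        (trans (bil-⊗ a′ _ _ b′) (cong₂ _*ᶠ_ (∙-*ʳ a′ _ _) (ᵀ⋆-∙ z a b′))))

      bil-twist-a : ∀ ε ε′ z b′ → bil a (twist ε ε′ z) b′ ≡ ε′ *ᶠ bil a z b′
      bil-twist-a ε ε′ z b′ = trans (bil-twist ε ε′ a z b′)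
        (trans (cong (λ x → ε *ᶠ bil a z b′ +ᶠ ((ε′ -ᶠ ε) *ᶠ x) *ᶠ bil a z b′) ab)
          (S.solve 3 (λ e e′ x → e S.:* x S.:+ ((e′ S.:- e) S.:* S.:1) S.:* x S.:= e′ S.:* x) refl ε ε′ _))

      twist-inverse : ∀ {ε ε′} → ε *ᶠ ε′ ≡ 1ᶠ → ∀ z → twist ε′ ε (twist ε ε′ z) ≡ z
      twist-inverse {ε} {ε′} εε′ z = bil-ext (λ a′ b′ → begin
        bil a′ (twist ε′ ε (twist ε ε′ z)) b′
          ≡⟨ trans (bil-twist ε′ ε a′ _ b′) (cong₂ (λ x y → ε′ *ᶠ x +ᶠ ((ε -ᶠ ε′) *ᶠ bil a′ Y b) *ᶠ y) (bil-twist ε ε′ a′ z b′) (bil-twist-a ε ε′ z b′)) ⟩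
        ε′ *ᶠ (ε *ᶠ bil a′ z b′ +ᶠ ((ε′ -ᶠ ε) *ᶠ bil a′ Y b) *ᶠ bil a z b′) +ᶠ ((ε -ᶠ ε′) *ᶠ bil a′ Y b) *ᶠ (ε′ *ᶠ bil a z b′)
          ≡⟨ S.solve 5 (λ e e′ x y w → e′ S.:* (e S.:* x S.:+ ((e′ S.:- e) S.:* y) S.:* w) S.:+ ((e S.:- e′) S.:* y) S.:* (e′ S.:* w) S.:= (e S.:* e′) S.:* x) refl ε ε′ _ _ _ ⟩
        (ε *ᶠ ε′) *ᶠ bil a′ z b′
          ≡⟨ trans (cong (_*ᶠ bil a′ z b′) εε′) (Rᶠ.*-identityˡ _) ⟩
        bil a′ z b′ ∎)

      -- On z = (Y w) tᵗ the map keeps t and replaces w by w₂ = ε w + (ε′ - ε)(a ∙ s) b. The wanted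
      -- value c′ forces ε′ = c′ / c. Then t ∙ w₂ = ε (1 - c) + c′, which equals 1 exactly for ε = c
      -- / c′, the inverse of ε′.
      twist-low : ∀ {c c′ i i′} → c +ᶠ c′ ≡ 1ᶠ → c *ᶠ i ≡ 1ᶠ → c′ *ᶠ i′ ≡ 1ᶠ → ∀ z → bil a z b ≡ c → Low z →
        Low (twist (c *ᶠ i′) (c′ *ᶠ i) z)
      twist-low {c} {c′} {i} {i′} cc′ ci ci′ z azb (s , t , (w , r , Yw , Yr , tw) , refl) =
        Y ⋆ w₂ , t , (w₂ , r , refl , Yr , tw₂) , bil-ext (λ a′ b′ → begin
          bil a′ (twist ε ε′ (s ⊗ t)) b′
            ≡⟨ trans (bil-twist ε ε′ a′ _ b′) (cong₂ (λ x y → ε *ᶠ x +ᶠ ((ε′ -ᶠ ε) *ᶠ bil a′ Y b) *ᶠ y) (bil-⊗ a′ s t b′) (bil-⊗ a s t b′)) ⟩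
          ε *ᶠ ((a′ ∙ s) *ᶠ (t ∙ b′)) +ᶠ ((ε′ -ᶠ ε) *ᶠ bil a′ Y b) *ᶠ ((a ∙ s) *ᶠ (t ∙ b′))
            ≡⟨ S.solve 6 (λ e x y p q u → e S.:* (x S.:* y) S.:+ (p S.:* q) S.:* (u S.:* y) S.:= (e S.:* x S.:+ (p S.:* u) S.:* q) S.:* y) refl ε _ _ (ε′ -ᶠ ε) _ _ ⟩
          (ε *ᶠ (a′ ∙ s) +ᶠ ((ε′ -ᶠ ε) *ᶠ (a ∙ s)) *ᶠ bil a′ Y b) *ᶠ (t ∙ b′)
            ≡⟨ cong (_*ᶠ (t ∙ b′)) (sym (trans (bil-+ʳ a′ Y _ _) (cong₂ _+ᶠ_ (trans (bil-*ʳ a′ Y ε w) (cong (λ v → ε *ᶠ (a′ ∙ v)) Yw)) (bil-*ʳ a′ Y _ b)))) ⟩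
          bil a′ Y w₂ *ᶠ (t ∙ b′)
            ≡⟨ sym (bil-⊗ a′ (Y ⋆ w₂) t b′) ⟩
          bil a′ ((Y ⋆ w₂) ⊗ t) b′ ∎)
        where
        ε = c *ᶠ i′
        ε′ = c′ *ᶠ i
        w₂ = ε *ᵛ w +ᵛ ((ε′ -ᶠ ε) *ᶠ (a ∙ s)) *ᵛ b
        tw₂ : t ∙ w₂ ≡ 1ᶠ
        tw₂ = begin
          t ∙ w₂
            ≡⟨ trans (∙-+ʳ t _ _) (cong₂ _+ᶠ_ (∙-*ʳ t ε w) (∙-*ʳ t _ b)) ⟩
          ε *ᶠ (t ∙ w) +ᶠ ((ε′ -ᶠ ε) *ᶠ (a ∙ s)) *ᶠ (t ∙ b)
            ≡⟨ cong₂ _+ᶠ_ (trans (cong (ε *ᶠ_) tw) (Rᶠ.*-identityʳ ε)) (trans (Rᶠ.*-assoc _ _ _)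
                 (cong ((ε′ -ᶠ ε) *ᶠ_) (trans (sym (bil-⊗ a s t b)) azb))) ⟩
          ε +ᶠ (ε′ -ᶠ ε) *ᶠ c
            ≡⟨ S.solve 4 (λ c c′ i i′ → c S.:* i′ S.:+ (c′ S.:* i S.:- c S.:* i′) S.:* c S.:=
                 c′ S.:* (c S.:* i) S.:+ c S.:* (i′ S.:* (S.:1 S.:- c))) refl c c′ i i′ ⟩
          c′ *ᶠ (c *ᶠ i) +ᶠ c *ᶠ (i′ *ᶠ (1ᶠ -ᶠ c))
            ≡⟨ cong₂ (λ x y → c′ *ᶠ x +ᶠ c *ᶠ (i′ *ᶠ y)) ci (trans (cong (_-ᶠ c) (sym cc′)) (S.solve 2 (λ c c′ → (c S.:+ c′) S.:- c S.:= c′) refl c c′)) ⟩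
          c′ *ᶠ 1ᶠ +ᶠ c *ᶠ (i′ *ᶠ c′)
            ≡⟨ cong₂ (λ x y → x +ᶠ c *ᶠ y) (Rᶠ.*-identityʳ c′) (trans (Rᶠ.*-comm i′ c′) ci′) ⟩
          c′ +ᶠ c *ᶠ 1ᶠ
            ≡⟨ trans (S.solve 2 (λ c c′ → c′ S.:+ c S.:* S.:1 S.:= c S.:+ c′) refl c c′) cc′ ⟩
          1ᶠ ∎

      twist-value : ∀ {c c′ i i′} → c *ᶠ i ≡ 1ᶠ → ∀ z → bil a z b ≡ c → bil a (twist (c *ᶠ i′) (c′ *ᶠ i) z) b ≡ c′
      twist-value {c} {c′} {i} ci z azb = trans (bil-twist-a _ _ z b) (trans (cong ((c′ *ᶠ i) *ᶠ_) azb)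
        (trans (S.solve 3 (λ c′ i c → (c′ S.:* i) S.:* c S.:= c′ S.:* (c S.:* i)) refl c′ i c)
          (trans (cong (c′ *ᶠ_) ci) (Rᶠ.*-identityʳ c′))))

      -- Exchanging c and c′ exchanges ε and ε′ and so gives the inverse map; it yields the converse
      -- membership in O₁.
      twist-fibre : ∀ {c c′ i i′} → c +ᶠ c′ ≡ 1ᶠ → c *ᶠ i ≡ 1ᶠ → c′ *ᶠ i′ ≡ 1ᶠ →
        fibre (λ z → ind (lowᵇ z)) a b c ≡ fibre (λ z → ind (lowᵇ z)) a b c′
      twist-fibre {c} {c′} {i} {i′} cc′ ci ci′ = fibre-reindex _ a b c a b c′ (twist ε ε′) (twist ε′ ε)
        (twist-inverse εε′) (twist-inverse ε′ε)
        (λ z azb → cong ind (T-ext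
          (λ h → low⇐ (subst Low (twist-inverse εε′ z) (twist-low c′c ci′ ci (twist ε ε′ z) (twist-value ci z azb) (low⇒ h))))
          (λ h → low⇐ (twist-low cc′ ci ci′ z azb (low⇒ h)))))
        (twist-value ci)
        (λ z e → subst (λ y → bil a y b ≡ c) (twist-inverse εε′ z) (twist-value ci′ (twist ε ε′ z) e))
        where
        ε = c *ᶠ i′
        ε′ = c′ *ᶠ i
        εε′ : ε *ᶠ ε′ ≡ 1ᶠ
        εε′ = trans (S.solve 4 (λ c i′ c′ i → (c S.:* i′) S.:* (c′ S.:* i) S.:= (c S.:* i) S.:* (c′ S.:* i′)) refl c i′ c′ i)
          (trans (cong₂ _*ᶠ_ ci ci′) (Rᶠ.*-identityˡ 1ᶠ))
        ε′ε = trans (Rᶠ.*-comm ε′ ε) εε′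
        c′c = trans (Rᶠ.+-comm c′ c) cc′

    low-symmetric : Symmetric Y (λ z → ind (lowᵇ z))
    low-symmetric a b c ab c≢0 c≢1 with inverse c c≢0 | inverse (1ᶠ -ᶠ c) (λ e → c≢1 (sym (-ᶠ≡0 e)))
    ... | i , ci | i′ , ci′ = Twist.twist-fibre a b ab (S.solve 1 (λ c → c S.:+ (S.:1 S.:- c) S.:= S.:1) refl c) ci ci′

    low-stable : Stable Y (λ z → ind (lowᵇ z))
    low-stable τ fix z = cong ind (O-stable Y k Fin.zero τ fix z)

    -- If aᵗ Y = 0 then aᵗ z = 0 on O₁; otherwise the stabilizer of Y negates aᵗ z b.
    low-even : Even Y (λ z → ind (lowᵇ z))
    low-even a b c ab = decide (Y ᵀ ⋆ a ≟ᵛ 0ᵛ) (c ≟ᶠ 0ᶠ)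
      where
      f = λ z → ind (lowᵇ z)
      empty : Y ᵀ ⋆ a ≡ 0ᵛ → ∀ e → e ≢ 0ᶠ → fibre f a b e ≡ 0#
      empty Ya e e≢0 = trans (fibre-def f a b e) (∑-vanish (𝕞 D M) (λ z → trans
        (𝟙-guard (bil a z b ≟ᶠ e) (λ azb → cong ind (T-ext {y = false} (λ h → e≢0 (trans (sym azb) (killed z (low⇒ h)))) λ ())))
        (zeroʳ _)))
        where
        killed : ∀ z → Low z → bil a z b ≡ 0ᶠ
        killed z (s , t , (w , _ , Yw , _) , z≡) = begin
          bil a z b ≡⟨ trans (cong (λ d → bil a d b) z≡) (bil-⊗ a s t b) ⟩
          (a ∙ s) *ᶠ (t ∙ b) ≡⟨ cong (_*ᶠ (t ∙ b)) (trans (cong (a ∙_) (sym Yw)) (trans (sym (ᵀ⋆-∙ Y a w)) (trans (cong (_∙ w) Ya) (∙-0ˡ w)))) ⟩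
          0ᶠ *ᶠ (t ∙ b) ≡⟨ Rᶠ.zeroˡ _ ⟩
          0ᶠ                               ∎
      ⊖0 : ⊖ 0ᶠ ≡ 0ᶠ
      ⊖0 = S.solve 0 (S.:- S.:0 S.:= S.:0) refl
      decide : Dec (Y ᵀ ⋆ a ≡ 0ᵛ) → Dec (c ≡ 0ᶠ) → fibre f a b c ≡ fibre f a b (⊖ c)
      decide _ (yes refl) = cong (fibre f a b) (sym ⊖0)
      decide (yes Ya) (no c≢0) = trans (empty Ya c c≢0) (sym (empty Ya (⊖ c) (λ e → c≢0
        (trans (S.solve 1 (λ c → c S.:= S.:- S.:- c) refl c) (trans (cong ⊖_ e) ⊖0)))))
      decide (no Ya≢0) (no _) with dual (Y ᵀ ⋆ a) Ya≢0
      ... | v , vYa = stable-even Y low-stable a b c v (trans (sym (bil-ᵀ a Y v)) vYa) ab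

    private
      Y≢0 : Y ≢ 0ᴹ
      Y≢0 e = contradiction (trans (sym (rank-0 {D} {M})) (trans (cong rank (sym e)) rankY)) λ ()

      homogeneous⇒balanced : ∀ {f} → Stable Y f → Homogeneous Y f → Balanced Y f
      homogeneous⇒balanced st hom = balanced Y st (homogeneous⇒symmetric Y hom) (homogeneous⇒even Y hom) Y≢0

      O-Stable : ∀ i → Stable Y (λ z → ind (B.O 0ᴹ Y k i z))
      O-Stable i τ fix z = cong ind (O-stable Y k i τ fix z)

      low-balanced : Balanced Y (λ z → ind (lowᵇ z))
      low-balanced = balanced Y low-stable low-symmetric low-even Y≢0

      lowOr-balanced : Balanced Y (λ z → ind (lowOr z))
      lowOr-balanced = homogeneous⇒balanced
        (λ τ fix z → cong ind (cong₂ _∨_ (O-stable Y k Fin.zero τ fix z) (O-stable Y k (Fin.suc (Fin.suc Fin.zero)) τ fix z)))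
        lowOr-homogeneous

      -- O₃ alone is not closed under scalars. As O₁ and O₃ are disjoint, its indicator is that of
      -- the union minus that of O₁, and the balance constants subtract.
      middle-balanced : Balanced Y (λ z → ind (middleᵇ α₀ 0 z))
      middle-balanced = combine low-balanced lowOr-balanced
        where
        combine : Balanced Y (λ z → ind (lowᵇ z)) → Balanced Y (λ z → ind (lowOr z)) → Balanced Y (λ z → ind (middleᵇ α₀ 0 z))
        combine (l , h) (l′ , h′) = l′ - l , λ u → begin
          ∑ (𝕞 D M) (λ z → ind (middleᵇ α₀ 0 z) * (κ (u -ᴹ z) - κ (u -ᴹ (Y -ᴹ z))))
            ≡⟨ ∑-cong (𝕞 D M) (λ z → trans (cong (_* (κ (u -ᴹ z) - κ (u -ᴹ (Y -ᴹ z)))) (ind-middle z))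
                 (solve 3 (λ x y w → (x :- y) :* w := x :* w :- y :* w) refl (ind (lowOr z)) (ind (lowᵇ z)) _)) ⟩
          ∑ (𝕞 D M) (λ z → ind (lowOr z) * (κ (u -ᴹ z) - κ (u -ᴹ (Y -ᴹ z))) - ind (lowᵇ z) * (κ (u -ᴹ z) - κ (u -ᴹ (Y -ᴹ z))))
            ≡⟨ trans (∑-- (𝕞 D M) _ _) (cong₂ _-_ (h′ u) (h u)) ⟩
          l′ * (κ u - κ (u -ᴹ Y)) - l * (κ u - κ (u -ᴹ Y))
            ≡⟨ solve 3 (λ x y w → x :* w :- y :* w := (x :- y) :* w) refl l′ l (κ u - κ (u -ᴹ Y)) ⟩
          (l′ - l) * (κ u - κ (u -ᴹ Y)) ∎

      -- Separates the a-value 2 q^(k-1) - 1 of O₃ from 2 q^(k-1) and q^(k-1): equality with the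
      -- latter would force q^(k-1) = 1.
      2≤q^k′ : 2 ℕ.≤ size ℕ.^ k′
      2≤q^k′ = ℕₚ.*-mono-≤ 2≤size (ℕₚ.m^n>0 size {{ℕ.>-nonZero (ℕₚ.≤-trans (ℕ.s≤s ℕ.z≤n) 2≤size)}} j)

      2n≢2n-1 : ∀ {n} → 2 ℕ.≤ n → 2 ℕ.* n ≢ 2 ℕ.* n ℕ.∸ 1
      2n≢2n-1 {suc n} _ e = ℕₚ.1+n≢n e

      n≢2n-1 : ∀ {n} → 2 ℕ.≤ n → n ≢ 2 ℕ.* n ℕ.∸ 1
      n≢2n-1 {suc (suc n)} _ e = ℕₚ.m≢1+m+n (suc n) (trans (ℕₚ.suc-injective e)
        (trans (ℕₚ.+-suc n _) (cong suc (ℕₚ.+-suc n _))))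
      n≢2n-1 {suc zero} (ℕ.s≤s ()) _

    O-balanced : ∀ i → Balanced Y (λ z → ind (B.O 0ᴹ Y k i z))
    O-balanced Fin.zero = low-balanced
    O-balanced i@(Fin.suc Fin.zero) = homogeneous⇒balanced (O-Stable i) (middle-homogeneous _ _ (2n≢2n-1 2≤q^k′))
    O-balanced (Fin.suc (Fin.suc Fin.zero)) = middle-balanced
    O-balanced i@(Fin.suc (Fin.suc (Fin.suc Fin.zero))) = homogeneous⇒balanced (O-Stable i) (middle-homogeneous _ _ (n≢2n-1 2≤q^k′))
    O-balanced i@(Fin.suc (Fin.suc (Fin.suc (Fin.suc Fin.zero)))) = homogeneous⇒balanced (O-Stable i) (middle-homogeneous _ _ (n≢2n-1 2≤q^k′))
    O-balanced i@(Fin.suc (Fin.suc (Fin.suc (Fin.suc (Fin.suc Fin.zero))))) = homogeneous⇒balanced (O-Stable i) high-homogeneous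

-- The identity for E over an abstract coefficient ring.

module Theorem (K : CharacteristicZeroDomain) (F : FiniteField) (D N : ℕ) where

  open YPartition K F D N public
  open B using (X; M)
  open ≡-Reasoning

  private
    module S = IntegerSolver ringᶠ
    𝕏 = 𝕞 D M

  rank-swap : ∀ {m n} (a b : Mat m n) → rank (a -ᴹ b) ≡ rank (b -ᴹ a)
  rank-swap a b = trans (sym (rank-neg (a -ᴹ b))) (cong rank
    (matrix-identity (⌈ 0ᴹ ⌉ ⊟ (⌈ a ⌉ ⊟ ⌈ b ⌉)) (⌈ b ⌉ ⊟ ⌈ a ⌉) (λ x y → trans (cong (_-ᶠ (bil x a y -ᶠ bil x b y)) (bil-0 x y))
      (S.solve 2 (λ a b → S.:0 S.:- (a S.:- b) S.:= b S.:- a) refl (bil x a y) (bil x b y)))))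

  translation : X → Automorphism
  translation c = record
    { act = _-ᴹ c
    ; inv = _+ᴹ c
    ; inv-act = λ z → matrix-identity (⌈ z ⌉ ⊟ ⌈ c ⌉ ⊞ ⌈ c ⌉) ⌈ z ⌉
        (λ a b → S.solve 2 (λ z c → (z S.:- c) S.:+ c S.:= z) refl (bil a z b) (bil a c b))
    ; act-inv = λ z → matrix-identity (⌈ z ⌉ ⊞ ⌈ c ⌉ ⊟ ⌈ c ⌉) ⌈ z ⌉
        (λ a b → S.solve 2 (λ z c → (z S.:+ c) S.:- c S.:= z) refl (bil a z b) (bil a c b))
    ; rank-act = λ p q → cong rank (matrix-identity ((⌈ p ⌉ ⊟ ⌈ c ⌉) ⊟ (⌈ q ⌉ ⊟ ⌈ c ⌉)) (⌈ p ⌉ ⊟ ⌈ q ⌉)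
        (λ a b → S.solve 3 (λ p q c → (p S.:- c) S.:- (q S.:- c) S.:= p S.:- q) refl (bil a p b) (bil a q b) (bil a c b))) }

  reflection : X → Automorphism
  reflection c = record
    { act = c -ᴹ_
    ; inv = c -ᴹ_
    ; inv-act = -ᴹ-involutive c
    ; act-inv = -ᴹ-involutive c
    ; rank-act = λ p q → trans (cong rank (matrix-identity ((⌈ c ⌉ ⊟ ⌈ p ⌉) ⊟ (⌈ c ⌉ ⊟ ⌈ q ⌉)) (⌈ q ⌉ ⊟ ⌈ p ⌉)
        (λ a b → S.solve 3 (λ p q c → (c S.:- p) S.:- (c S.:- q) S.:= q S.:- p) refl (bil a p b) (bil a q b) (bil a c b))))
        (rank-swap q p) }

  O-rank : ∀ Y k i {z} → T (B.O 0ᴹ Y k i z) → rank z ≡ 1 × rank (Y -ᴹ z) ≡ B.jIdx k i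
  O-rank Y k i {z} h = T-does (rank z ℕ.≟ 1) (subst T (adj-0 z) (proj₁ (near i h))) ,
    T-does (rank (Y -ᴹ z) ℕ.≟ B.jIdx k i) (subst T (isDist-rank (B.jIdx k i) Y z) (proj₂ (near i h)))
    where
    middle : ∀ {a b c} → T (a ∧ b ∧ c) → T a × T b
    middle h = let (x , y) = Equivalence.to T-∧ h in x , proj₁ (Equivalence.to T-∧ y)
    near : ∀ i → T (B.O 0ᴹ Y k i z) → T (B.adj 0ᴹ z) × T (B.isDist (B.jIdx k i) Y z)
    near Fin.zero h = Equivalence.to T-∧ h
    near (Fin.suc Fin.zero) h = middle h
    near (Fin.suc (Fin.suc Fin.zero)) h = middle h
    near (Fin.suc (Fin.suc (Fin.suc Fin.zero))) h = middle h
    near (Fin.suc (Fin.suc (Fin.suc (Fin.suc Fin.zero)))) h = middle h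
    near (Fin.suc (Fin.suc (Fin.suc (Fin.suc (Fin.suc Fin.zero))))) h = Equivalence.to T-∧ h

  module _ (θ : ℕ → Carrier) (θ-def : ∀ r → (Q - 1#) * θ r ≡ pw (D ℕ.+ M ℕ.∸ r) - R D M)
    (E : X → X → Carrier)
    (E-spectral : ∀ r → r ℕ.≤ D → (v : X → Carrier) →
      (∀ u → ∑ 𝕏 (λ w → 𝟙 (u ∼? w) * v w) ≡ θ r * v u) →
      ∀ u → ∑ 𝕏 (λ w → E u w * v w) ≡ 𝟙 (r ℕ.≟ 1) * v u) where

    private
      C₀ = |X| {D} {M} * (Q - 1#)

      C₀≢0 : C₀ ≢ 0#
      C₀≢0 e = Q-1≢0 (*-cancelˡ (|X| {D} {M}) (|X|≢0 {D} {M}) (trans e (sym (zeroʳ (|X| {D} {M})))))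

      apply-E : ∀ v u → C₀ * ∑ 𝕏 (λ w → E u w * v w) ≡ ∑ 𝕏 (λ z → v z * (pw D * κ (u -ᴹ z) - R D M))
      apply-E = apply-idempotent θ θ-def E E-spectral

      θ-difference : ∀ r r′ → pw (D ℕ.+ M ℕ.∸ r) - pw (D ℕ.+ M ℕ.∸ r′) ≡ (Q - 1#) * (θ r - θ r′)
      θ-difference r r′ = sym (trans (solve 3 (λ q x y → q :* (x :- y) := q :* x :- q :* y) refl (Q - 1#) (θ r) (θ r′))
        (trans (cong₂ _-_ (θ-def r) (θ-def r′)) (solve 3 (λ x y r → (x :- r) :- (y :- r) := x :- y) refl _ _ (R D M))))

    -- Reduces to injectivity of n ↦ q^n. Applied to 0 and k, it shows that the denominator of λ is
    -- nonzero.
    θ-injective : ∀ {r r′} → r ℕ.≤ D → r′ ℕ.≤ D → θ r - θ r′ ≡ 0# → r ≡ r′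
    θ-injective {r} {r′} r≤D r′≤D e = ℕₚ.∸-cancelˡ-≡ (ℕₚ.≤-trans r≤D (ℕₚ.m≤m+n D M)) (ℕₚ.≤-trans r′≤D (ℕₚ.m≤m+n D M))
      (pw-injective (begin
        p ≡⟨ solve 2 (λ x y → x := (x :- y) :+ y) refl p p′ ⟩
        (p - p′) + p′ ≡⟨ cong (_+ p′) (trans (θ-difference r r′) (trans (cong ((Q - 1#) *_) e) (zeroʳ _))) ⟩
        0# + p′ ≡⟨ +-identityˡ p′ ⟩
        p′                    ∎))
      where
      p = pw (D ℕ.+ M ℕ.∸ r)
      p′ = pw (D ℕ.+ M ℕ.∸ r′)

    module _ (x y : X) (k : ℕ) (2≤k : 2 ℕ.≤ k) (rank-xy : rank (x -ᴹ y) ≡ k) (i : Fin 6) where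

      private
        Y = y -ᴹ x

        rankY : rank Y ≡ k
        rankY = trans (rank-swap y x) rank-xy

        f : X → Carrier
        f z = ind (B.O 0ᴹ Y k i z)

        O-from-x : ∀ z → B.O x y k i z ≡ B.O 0ᴹ Y k i (z -ᴹ x)
        O-from-x z = trans (sym (Automorphism.O-act (translation x) x y k i z))
          (cong (λ o → B.O o Y k i (z -ᴹ x)) (-ᴹ-self x))

        -- Translation by x carries (x , y) to (0ᴹ , Y), and z ↦ y - z carries (y , x) to the same
        -- pair. Both partitions are thus pulled back from one.
        O-from-y : ∀ z → B.O y x k i z ≡ B.O 0ᴹ Y k i (y -ᴹ z)
        O-from-y z = trans (sym (Automorphism.O-act (reflection y) y x k i z))
          (cong (λ o → B.O o Y k i (y -ᴹ z)) (-ᴹ-self y))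

        f-balanced : Balanced Y f
        f-balanced = go k 2≤k rankY
          where
          go : ∀ k → 2 ℕ.≤ k → rank Y ≡ k → Balanced Y (λ z → ind (B.O 0ᴹ Y k i z))
          go (suc zero) (ℕ.s≤s ()) _
          go (suc (suc j)) _ h = O-balanced Y j h i

        l = proj₁ f-balanced

      -- Both sums are moved to the set centred at 0ᴹ. There u - z becomes (u - x) - z in the first
      -- and (u - x) - (Y - z) in the second, the shape required by `Balanced`; the constant R
      -- cancels.
      C₀-difference : ∀ u →
        C₀ * (∑ 𝕏 (λ w → E u w * ind (B.O x y k i w)) - ∑ 𝕏 (λ w → E u w * ind (B.O y x k i w)))
          ≡ (pw D * l) * (κ (u -ᴹ x) - κ (u -ᴹ y))
      C₀-difference u = begin
        C₀ * (∑ 𝕏 (λ w → E u w * ind (B.O x y k i w)) - ∑ 𝕏 (λ w → E u w * ind (B.O y x k i w)))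
          ≡⟨ trans (solve 3 (λ c a b → c :* (a :- b) := c :* a :- c :* b) refl C₀ _ _) (cong₂ _-_ (apply-E _ u) (apply-E _ u)) ⟩
        ∑ 𝕏 (λ z → ind (B.O x y k i z) * (pw D * κ (u -ᴹ z) - R D M)) - ∑ 𝕏 (λ z → ind (B.O y x k i z) * (pw D * κ (u -ᴹ z) - R D M))
          ≡⟨ cong₂ _-_
               (trans (∑-cong 𝕏 (λ z → cong₂ (λ b d → ind b * (pw D * κ d - R D M)) (O-from-x z) (from-x z)))
                 (∑-reindex 𝕏 𝕏 (_-ᴹ x) (_+ᴹ x) (Automorphism.inv-act (translation x)) (Automorphism.act-inv (translation x))
                   (λ z → f z * (pw D * κ (u -ᴹ x -ᴹ z) - R D M))))
               (trans (∑-cong 𝕏 (λ z → cong₂ (λ b d → ind b * (pw D * κ d - R D M)) (O-from-y z) (from-y z)))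
                 (∑-reindex 𝕏 𝕏 (y -ᴹ_) (y -ᴹ_) (-ᴹ-involutive y) (-ᴹ-involutive y)
                   (λ z → f z * (pw D * κ (u -ᴹ x -ᴹ (Y -ᴹ z)) - R D M)))) ⟩
        ∑ 𝕏 (λ z → f z * (pw D * κ (u -ᴹ x -ᴹ z) - R D M)) - ∑ 𝕏 (λ z → f z * (pw D * κ (u -ᴹ x -ᴹ (Y -ᴹ z)) - R D M))
          ≡⟨ trans (sym (∑-- 𝕏 _ _)) (trans (∑-cong 𝕏 (λ z → solve 5 (λ f p a b r → f :* (p :* a :- r) :- f :* (p :* b :- r) := p :* (f :* (a :- b))) refl
               (f z) (pw D) _ _ (R D M))) (∑-*ˡ 𝕏 (pw D) _)) ⟩
        pw D * ∑ 𝕏 (λ z → f z * (κ (u -ᴹ x -ᴹ z) - κ (u -ᴹ x -ᴹ (Y -ᴹ z))))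
          ≡⟨ cong (pw D *_) (proj₂ f-balanced (u -ᴹ x)) ⟩
        pw D * (l * (κ (u -ᴹ x) - κ (u -ᴹ x -ᴹ Y)))
          ≡⟨ sym (*-assoc _ _ _) ⟩
        (pw D * l) * (κ (u -ᴹ x) - κ (u -ᴹ x -ᴹ Y))
          ≡⟨ cong (λ d → (pw D * l) * (κ (u -ᴹ x) - κ d)) (matrix-identity (⌈ u ⌉ ⊟ ⌈ x ⌉ ⊟ (⌈ y ⌉ ⊟ ⌈ x ⌉)) (⌈ u ⌉ ⊟ ⌈ y ⌉)
               (λ a b → S.solve 3 (λ u x y → (u S.:- x) S.:- (y S.:- x) S.:= u S.:- y) refl (bil a u b) (bil a x b) (bil a y b))) ⟩
        (pw D * l) * (κ (u -ᴹ x) - κ (u -ᴹ y)) ∎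
        where
        from-x : ∀ z → u -ᴹ z ≡ u -ᴹ x -ᴹ (z -ᴹ x)
        from-x z = matrix-identity (⌈ u ⌉ ⊟ ⌈ z ⌉) (⌈ u ⌉ ⊟ ⌈ x ⌉ ⊟ (⌈ z ⌉ ⊟ ⌈ x ⌉))
          (λ a b → S.solve 3 (λ u x z → u S.:- z S.:= (u S.:- x) S.:- (z S.:- x)) refl (bil a u b) (bil a x b) (bil a z b))
        from-y : ∀ z → u -ᴹ z ≡ u -ᴹ x -ᴹ (Y -ᴹ (y -ᴹ z))
        from-y z = matrix-identity (⌈ u ⌉ ⊟ ⌈ z ⌉) (⌈ u ⌉ ⊟ ⌈ x ⌉ ⊟ ((⌈ y ⌉ ⊟ ⌈ x ⌉) ⊟ (⌈ y ⌉ ⊟ ⌈ z ⌉)))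
          (λ a b → S.solve 4 (λ u x y z → u S.:- z S.:= (u S.:- x) S.:- ((y S.:- x) S.:- (y S.:- z))) refl
            (bil a u b) (bil a x b) (bil a y b) (bil a z b))

      C₀-hat : ∀ u w → C₀ * ∑ 𝕏 (λ z → E u z * 𝟙 (w ≟ᴹ z)) ≡ pw D * κ (u -ᴹ w) - R D M
      C₀-hat u w = trans (apply-E (λ z → 𝟙 (w ≟ᴹ z)) u) (sift′ 𝕏 w (λ z → pw D * κ (u -ᴹ z) - R D M))

      difference : ∀ u →
        ∑ 𝕏 (λ w → E u w * ind (B.O x y k i w)) - ∑ 𝕏 (λ w → E u w * ind (B.O y x k i w))
          ≡ l * (∑ 𝕏 (λ z → E u z * 𝟙 (x ≟ᴹ z)) - ∑ 𝕏 (λ z → E u z * 𝟙 (y ≟ᴹ z)))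
      difference u = *-cancelˡ C₀ C₀≢0 (begin
        C₀ * (∑ 𝕏 (λ w → E u w * ind (B.O x y k i w)) - ∑ 𝕏 (λ w → E u w * ind (B.O y x k i w)))
          ≡⟨ C₀-difference u ⟩
        (pw D * l) * (κ (u -ᴹ x) - κ (u -ᴹ y))
          -- R is inserted again on both sides, so that each bracket becomes an entry of E by
          -- `C₀-hat`.
          ≡⟨ solve 5 (λ p l a b r → (p :* l) :* (a :- b) := l :* ((p :* a :- r) :- (p :* b :- r))) refl (pw D) l _ _ (R D M) ⟩
        l * ((pw D * κ (u -ᴹ x) - R D M) - (pw D * κ (u -ᴹ y) - R D M))
          ≡⟨ cong (l *_) (sym (cong₂ _-_ (C₀-hat u x) (C₀-hat u y))) ⟩
        l * (C₀ * ∑ 𝕏 (λ z → E u z * 𝟙 (x ≟ᴹ z)) - C₀ * ∑ 𝕏 (λ z → E u z * 𝟙 (y ≟ᴹ z)))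
          ≡⟨ solve 4 (λ l c a b → l :* (c :* a :- c :* b) := c :* (l :* (a :- b))) refl l C₀ _ _ ⟩
        C₀ * (l * (∑ 𝕏 (λ z → E u z * 𝟙 (x ≟ᴹ z)) - ∑ 𝕏 (λ z → E u z * 𝟙 (y ≟ᴹ z)))) ∎)

      -- The balance identity at u = 0.
      coefficient : l * (θ 0 - θ k) ≡ fromℕ (B.card (B.O x y k i)) * (θ 1 - θ (B.jIdx k i))
      coefficient = *-cancelˡ (Q - 1#) Q-1≢0 (begin
        (Q - 1#) * (l * (θ 0 - θ k))
          ≡⟨ solve 3 (λ q l t → q :* (l :* t) := l :* (q :* t)) refl (Q - 1#) l _ ⟩
        l * ((Q - 1#) * (θ 0 - θ k))
          ≡⟨ cong (l *_) (sym (θ-difference 0 k)) ⟩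
        l * (pw (D ℕ.+ M) - pw (D ℕ.+ M ℕ.∸ k))
          ≡⟨ cong (l *_) (sym (cong₂ _-_ (pκ {0ᴹ} {0} (rank-0 {D} {M})) (pκ {0ᴹ -ᴹ Y} {k} (trans (rank-neg Y) rankY)))) ⟩
        l * (pw D * κ (0ᴹ {D} {M}) - pw D * κ (0ᴹ -ᴹ Y))
          ≡⟨ solve 4 (λ l p a b → l :* (p :* a :- p :* b) := p :* (l :* (a :- b))) refl l (pw D) _ _ ⟩
        pw D * (l * (κ (0ᴹ {D} {M}) - κ (0ᴹ -ᴹ Y)))
          ≡⟨ cong (pw D *_) (sym (proj₂ f-balanced 0ᴹ)) ⟩
        pw D * ∑ 𝕏 (λ z → f z * (κ (0ᴹ -ᴹ z) - κ (0ᴹ -ᴹ (Y -ᴹ z))))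
          -- On O₍ᵢ₎ the ranks of z and Y - z have the constant values 1 and `jIdx k i`, so all
          -- terms agree and the sum is a multiple of the cardinality.
          ≡⟨ trans (sym (∑-*ˡ 𝕏 (pw D) _)) (∑-cong 𝕏 term) ⟩
        ∑ 𝕏 (λ z → f z * ((Q - 1#) * (θ 1 - θ j)))
          ≡⟨ ∑-*ʳ 𝕏 f _ ⟩
        ∑ 𝕏 f * ((Q - 1#) * (θ 1 - θ j))
          ≡⟨ cong (_* ((Q - 1#) * (θ 1 - θ j))) (sym (trans (cong fromℕ card-O) (fromℕ-card (B.O 0ᴹ Y k i)))) ⟩
        fromℕ (B.card (B.O x y k i)) * ((Q - 1#) * (θ 1 - θ j))
          ≡⟨ solve 3 (λ c q t → c :* (q :* t) := q :* (c :* t)) refl _ (Q - 1#) _ ⟩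
        (Q - 1#) * (fromℕ (B.card (B.O x y k i)) * (θ 1 - θ j)) ∎)
        where
        j = B.jIdx k i
        pκ : ∀ {d : X} {r} → rank d ≡ r → pw D * κ d ≡ pw (D ℕ.+ M ℕ.∸ r)
        pκ {d} h = trans (pw-κ d) (cong (λ r → pw (D ℕ.+ M ℕ.∸ r)) h)
        card-O : B.card (B.O x y k i) ≡ B.card (B.O 0ᴹ Y k i)
        card-O = trans (card-cong O-from-x) (Automorphism.card-act (translation x) (B.O 0ᴹ Y k i))
        guarded : ∀ b {p q} → (T b → p ≡ q) → ind b * p ≡ ind b * q
        guarded true h = cong (1# *_) (h _)
        guarded false h = trans (zeroˡ _) (sym (zeroˡ _))
        term : ∀ z → pw D * (f z * (κ (0ᴹ -ᴹ z) - κ (0ᴹ -ᴹ (Y -ᴹ z)))) ≡ f z * ((Q - 1#) * (θ 1 - θ j))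
        term z = trans (solve 4 (λ p f a b → p :* (f :* (a :- b)) := f :* (p :* a :- p :* b)) refl (pw D) (f z) _ _)
          (guarded (B.O 0ᴹ Y k i z) (λ h → let (z1 , Yz) = O-rank Y k i h in trans
            (cong₂ _-_ (pκ (trans (rank-neg z) z1)) (pκ (trans (rank-neg (Y -ᴹ z)) Yz))) (θ-difference 1 j)))

      result : ∃ λ l → l * (θ 0 - θ k) ≡ fromℕ (B.card (B.O x y k i)) * (θ 1 - θ (B.jIdx k i)) ×
        (∀ u → ∑ 𝕏 (λ w → E u w * ind (B.O x y k i w)) - ∑ 𝕏 (λ w → E u w * ind (B.O y x k i w))
          ≡ l * (∑ 𝕏 (λ z → E u z * 𝟙 (x ≟ᴹ z)) - ∑ 𝕏 (λ z → E u z * 𝟙 (y ≟ᴹ z))))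
      result = l , coefficient , difference

-- Specialisation to the rational numbers.

module RationalCoefficients where

  open import Data.Rational as ℚ using (ℚ; 0ℚ; 1ℚ)
  import Data.Rational.Properties as ℚₚ
  import Data.Rational.Unnormalised as ℚᵘ
  import Data.Rational.Unnormalised.Properties as ℚᵘₚ
  open import Data.Integer as ℤ using (ℤ; +_)
  import Data.Integer.Properties as ℤₚ
  open ≡-Reasoning

  -- The fraction with denominator 1 is built by a gcd normalisation that is stuck on a variable n;
  -- unnormalised rationals avoid it.
  fromℕℚ-≃ : ∀ n → ℚ.toℚᵘ (fromℕℚ n) ℚᵘ.≃ ℚᵘ.mkℚᵘ (+ n) 0
  fromℕℚ-≃ n = ℚₚ.toℚᵘ-fromℚᵘ (ℚᵘ.mkℚᵘ (+ n) 0)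

  fromℕℚ-suc : ∀ n → 1ℚ ℚ.+ fromℕℚ n ≡ fromℕℚ (suc n)
  fromℕℚ-suc n = ℚₚ.toℚᵘ-injective (ℚᵘₚ.≃-trans (ℚₚ.toℚᵘ-homo-+ 1ℚ (fromℕℚ n))
    (ℚᵘₚ.≃-trans (ℚᵘₚ.+-congʳ ℚᵘ.1ℚᵘ (fromℕℚ-≃ n))
      (ℚᵘₚ.≃-trans (ℚᵘ.*≡* (cong (λ m → (+ 1 ℤ.+ m) ℤ.* + 1) (ℤₚ.*-identityʳ (+ n)))) (ℚᵘₚ.≃-sym (fromℕℚ-≃ (suc n))))))

  fromℕℚ-injective : ∀ {m n} → fromℕℚ m ≡ fromℕℚ n → m ≡ n
  fromℕℚ-injective {m} {n} e with ℚᵘₚ.≃-trans (ℚᵘₚ.≃-sym (fromℕℚ-≃ m))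
    (ℚᵘₚ.≃-trans (ℚᵘₚ.≃-reflexive (cong ℚ.toℚᵘ e)) (fromℕℚ-≃ n))
  ... | ℚᵘ.*≡* h = ℤₚ.+-injective (trans (sym (ℤₚ.*-identityʳ (+ m))) (trans h (ℤₚ.*-identityʳ (+ n))))

  times-1 : ∀ n → Mult._×_ (CommutativeRing.semiring ℚₚ.+-*-commutativeRing) n 1ℚ ≡ fromℕℚ n
  times-1 zero = refl
  times-1 (suc n) = trans (cong (1ℚ ℚ.+_) (times-1 n)) (fromℕℚ-suc n)

  *-cancel : ∀ x {y z} → x ≢ 0ℚ → x ℚ.* y ≡ x ℚ.* z → y ≡ z
  *-cancel x {y} {z} x≢0 e = trans (sym (unit y)) (trans (cong (x⁻¹ ℚ.*_) e) (unit z))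
    where
    instance _ = ℚ.≢-nonZero x≢0
    x⁻¹ = ℚ.1/ x
    unit : ∀ y → x⁻¹ ℚ.* (x ℚ.* y) ≡ y
    unit y = trans (sym (ℚₚ.*-assoc x⁻¹ x y)) (trans (cong (ℚ._* y) (ℚₚ.*-inverseˡ x)) (ℚₚ.*-identityˡ y))

  rationals : CharacteristicZeroDomain
  rationals = record
    { Carrier = ℚ ; isCommutativeRing = ℚₚ.+-*-isCommutativeRing
    ; *-cancelˡ = *-cancel
    ; fromℕ-injective = λ {m} {n} e → fromℕℚ-injective (trans (sym (times-1 m)) (trans e (times-1 n))) }

  /ℚ-cancel : ∀ p {r} → r ≢ 0ℚ → (p /ℚ r) ℚ.* r ≡ p
  /ℚ-cancel p {r} r≢0 with r ℚₚ.≟ 0ℚ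
  ... | yes r≡0 = contradiction r≡0 r≢0
  ... | no r≢0′ = trans (ℚₚ.*-assoc p (ℚ.1/_ r {{ℚ.≢-nonZero r≢0′}}) r)
    (trans (cong (p ℚ.*_) (ℚₚ.*-inverseˡ r {{ℚ.≢-nonZero r≢0′}})) (ℚₚ.*-identityʳ p))

  module _ (F : FiniteField) (D N : ℕ) (D≤N : D ℕ.≤ N) where

    open Theorem rationals F D N
    open B using (X; M)

    q-1≡ : fromℕℚ (size ℕ.∸ 1) ≡ Q - 1#
    q-1≡ = begin
      fromℕℚ (size ℕ.∸ 1) ≡⟨ solve 1 (λ x → x := (:1 :+ x) :- :1) refl (fromℕℚ (size ℕ.∸ 1)) ⟩
      (1# + fromℕℚ (size ℕ.∸ 1)) - 1# ≡⟨ cong (_- 1#) (fromℕℚ-suc (size ℕ.∸ 1)) ⟩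
      fromℕℚ (suc (size ℕ.∸ 1)) - 1# ≡⟨ cong (λ n → fromℕℚ n - 1#) (ℕₚ.m+[n∸m]≡n (ℕₚ.≤-trans (ℕ.s≤s ℕ.z≤n) 2≤size)) ⟩
      fromℕℚ size - 1# ≡⟨ cong (_- 1#) (trans (sym (times-1 size)) (sym Q-def)) ⟩
      Q - 1#                                     ∎

    fromℕℚ-pw : ∀ n → fromℕℚ (size ℕ.^ n) ≡ pw n
    fromℕℚ-pw n = trans (sym (times-1 (size ℕ.^ n))) (fromℕ-pw n)

    θ-def : ∀ r → (Q - 1#) * B.θ r ≡ pw (D ℕ.+ M ℕ.∸ r) - R D M
    θ-def r = begin
      (Q - 1#) * (numerator /ℚ fromℕℚ (size ℕ.∸ 1))
        ≡⟨ trans (*-comm (Q - 1#) (numerator /ℚ fromℕℚ (size ℕ.∸ 1))) (cong ((numerator /ℚ fromℕℚ (size ℕ.∸ 1)) *_) (sym q-1≡)) ⟩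
      (numerator /ℚ fromℕℚ (size ℕ.∸ 1)) * fromℕℚ (size ℕ.∸ 1)
        ≡⟨ /ℚ-cancel numerator (λ e → Q-1≢0 (trans (sym q-1≡) e)) ⟩
      numerator
        -- Rewriting N as D + M uses D ≤ N, because M is a truncated difference.
        ≡⟨ cong₂ _-_ (cong₂ _-_ (cong (_+ 1#) (trans (fromℕℚ-pw (N ℕ.∸ r)) (cong (λ n → pw (n ℕ.∸ r)) (sym (ℕₚ.m+[n∸m]≡n D≤N)))))
             (fromℕℚ-pw D)) (fromℕℚ-pw M) ⟩
      pw (D ℕ.+ M ℕ.∸ r) + 1# - pw D - pw M
        ≡⟨ solve 3 (λ x d m → x :+ :1 :- d :- m := x :- (d :+ m :- :1)) refl (pw (D ℕ.+ M ℕ.∸ r)) (pw D) (pw M) ⟩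
      pw (D ℕ.+ M ℕ.∸ r) - R D M ∎
      where
      numerator = fromℕℚ (size ℕ.^ (N ℕ.∸ r)) + 1# - fromℕℚ (size ℕ.^ D) - fromℕℚ (size ℕ.^ (N ℕ.∸ D))

    if-ind : ∀ b x → (if b then x else 0#) ≡ ind b * x
    if-ind true x = sym (*-identityˡ x)
    if-ind false x = sym (zeroˡ x)

    module _ (E : X → X → ℚ) (isE₁ : B.IsE₁ E) where

      E-spectral : ∀ r → r ℕ.≤ D → (v : X → ℚ) →
        (∀ u → ∑ (𝕞 D M) (λ w → 𝟙 (u ∼? w) * v w) ≡ B.θ r * v u) →
        ∀ u → ∑ (𝕞 D M) (λ w → E u w * v w) ≡ 𝟙 (r ℕ.≟ 1) * v u
      E-spectral r r≤D v eigen u = trans (isE₁ r r≤D v (λ u → trans (∑-cong (𝕞 D M) (λ w →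
        trans (if-ind (B.adj u w) (v w)) (cong (λ b → ind b * v w) (adj-rank u w)))) (eigen u)) u)
        -- The Boolean part of `r ℕ.≟ 1` is `r ℕ.≡ᵇ 1`, so the test in `IsE₁` is the indicator
        -- demanded here.
        (if-ind (r ℕ.≡ᵇ 1) (v u))

      module _ (x y : X) (k : ℕ) (dist : T (B.isDist k x y)) (2≤k : 2 ℕ.≤ k) (k≤D : k ℕ.≤ D) (i : Fin 6) where

        private
          j = B.jIdx k i

          main = result B.θ θ-def E E-spectral x y k 2≤k
            (T-does (rank (x -ᴹ y) ℕ.≟ k) (subst T (isDist-rank k x y) dist)) i

          Δ : Carrier
          Δ = B.θ 0 - B.θ k

          Δ≢0 : Δ ≢ 0#
          Δ≢0 e = ℕₚ.<⇒≢ (ℕₚ.≤-trans (ℕ.s≤s ℕ.z≤n) 2≤k) (θ-injective B.θ θ-def E E-spectral ℕ.z≤n k≤D e)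

          hat-∑ : ∀ a u → ∑ (𝕞 D M) (λ z → E u z * 𝟙 (a ≟ᴹ z)) ≡ B.apply E (B.hat a) u
          hat-∑ a u = ∑-cong (𝕞 D M) (λ z → cong (λ b → E u z * ind b) (sym (isYes≗does (a B.≟X z))))

          coefficient-λ : proj₁ main ≡ B.λc x y k i
          coefficient-λ = *-cancel Δ Δ≢0 (begin
            Δ * proj₁ main
              ≡⟨ *-comm Δ (proj₁ main) ⟩
            proj₁ main * Δ
              ≡⟨ proj₁ (proj₂ main) ⟩
            fromℕ c * (B.θ 1 - B.θ j)
              ≡⟨ cong₂ _*_ (times-1 c) (sym (/ℚ-cancel (B.θ 1 - B.θ j) Δ≢0)) ⟩
            fromℕℚ c * (((B.θ 1 - B.θ j) /ℚ Δ) * Δ)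
              ≡⟨ solve 3 (λ c r t → c :* (r :* t) := t :* (c :* r)) refl (fromℕℚ c) ((B.θ 1 - B.θ j) /ℚ Δ) Δ ⟩
            Δ * (fromℕℚ c * ((B.θ 1 - B.θ j) /ℚ Δ)) ∎)
            where c = B.card (B.O x y k i)

        conclusion : ∀ u →
          B.apply E (B.hatS (B.O x y k i)) u - B.apply E (B.hatS (B.O y x k i)) u
            ≡ B.λc x y k i * (B.apply E (B.hat x) u - B.apply E (B.hat y) u)
        conclusion u = trans (proj₂ (proj₂ main) u) (cong₂ _*_ coefficient-λ (cong₂ _-_ (hat-∑ x u) (hat-∑ y u)))

open import Data.Nat using (_≤_; _<_; _*_; _∸_)
open import Data.Rational using (ℚ; _-_) renaming (_*_ to _*ℚ_)

theorem8p1 : (F : FiniteField) → FiniteField.size F ≢ 2 →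
    (D N : ℕ) → 6 ≤ 2 * D → 2 * D < N →
    (x y : Bilinear.X F D N) (k : ℕ) → Bilinear.isDist F D N k x y ≡ true →
    2 ≤ k → k ≤ D ∸ 1 →
    (E : Bilinear.X F D N → Bilinear.X F D N → ℚ) → Bilinear.IsE₁ F D N E →
    (i : Fin 6) (u : Bilinear.X F D N) →
    Bilinear.apply F D N E (Bilinear.hatS F D N (Bilinear.O F D N x y k i)) u
    - Bilinear.apply F D N E (Bilinear.hatS F D N (Bilinear.O F D N y x k i)) u
    ≡ Bilinear.λc F D N x y k i
    *ℚ (Bilinear.apply F D N E (Bilinear.hat F D N x) u
    - Bilinear.apply F D N E (Bilinear.hat F D N y) u)
theorem8p1 F _ D N _ 2D<N x y k dist 2≤k k≤D-1 E isE₁ i u =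
  RationalCoefficients.conclusion F D N D≤N E isE₁ x y k (subst T (sym dist) tt) 2≤k
    (ℕₚ.≤-trans k≤D-1 (ℕₚ.m∸n≤m D 1)) i u
  where
  D≤N : D ≤ N
  D≤N = ℕₚ.≤-trans (ℕₚ.m≤n*m D 2) (ℕₚ.<⇒≤ 2D<N)
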